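{- Let $\alpha$ be a simple permutation of length at least $4$. Then the class $\mathrm{Av}(\alpha)\odot\mathrm{Av}(\alpha)$ is not definable by an FO sentence in \textsf{TOTO}; that is, there is no first-order sentence $\varphi$ over the signature $\{<_1,<_2\}$ such that for every permutation $\pi$, $\pi\models\varphi$ if and only if $\pi\in\mathrm{Av}(\alpha)\odot\mathrm{Av}(\alpha)$.
   Context: A permutation $\pi$ of $[n]$ is identified with its diagram $S_\pi=\{(i,\pi_i)\}$ and viewed as the structure $(S_\pi,\prec_1,\prec_2)$, where $<_1,<_2$ are interpreted as the orders by $x$- and $y$-coordinate (\textsf{TOTO}: the theory stating both are linear orders). A permutation $\tau$ contains $\sigma$ if $S_\tau$ has a subset isomorphic to $S_\sigma$ (an isomorphism of point sets in general position is a bijection preserving relative order of $x$-coordinates and of $y$-coordinates); otherwise $\tau$ avoids $\sigma$, and $\mathrm{Av}(\sigma)$ is the class of permutations avoiding $\sigma$. The inflation $\sigma[\tau_1,\dots,\tau_m]$ of $\sigma$ of length $m$ is the permutation obtained by replacing each point $(i,\sigma_i)$ of $S_\sigma$ by a tiny copy of $S_{\tau_i}$; a permutation is simple if it cannot be obtained as an inflation of a strictly smaller permutation (by permutations that are not all of length one, i.e., it has no nontrivial interval). For classes $\mathcal C,\mathcal D$, $\mathcal C\odot\mathcal D$ is the set of permutations whose points can be colored red and blue so that the red points form a permutation in $\mathcal C$ and the blue points form a permutation in $\mathcal D$. -}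

module Defs where

open import Data.Nat using (ℕ; zero; suc; _+_; _≤_)
open import Data.Fin using (Fin; toℕ; _<_; _≟_)
open import Data.Fin.Permutation using (Permutation′; _⟨$⟩ʳ_)
open import Data.Bool using (Bool; true; false; not; _∧_)
open import Data.List using (allFin)
open import Data.Bool.ListAction using (any)
open import Data.Product using (Σ; _×_; ∃)
open import Data.Sum using (_⊎_)
open import Relation.Nullary using (¬_; does)
open import Relation.Binary.PropositionalEquality using (_≡_)
open import Function.Bundles using (_⇔_)
import Data.Fin.Properties as FinP

-- A permutation of [n]: a bijection Fin n → Fin n (stdlib notion).
-- Its diagram is {(i , π i)}; <₁ compares i, <₂ compares π i.
Perm : ℕ → Set
Perm = Permutation′

Class : Set₁
Class = ∀ {n} → Perm n → Set

Induces : ∀ {k n} → Perm k → Perm n → (Fin k → Fin n) → Set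
Induces σ π f =
  (∀ i j → i < j → f i < f j) ×
  (∀ i j → (σ ⟨$⟩ʳ i < σ ⟨$⟩ʳ j) ⇔ (π ⟨$⟩ʳ f i < π ⟨$⟩ʳ f j))

Contains : ∀ {n k} → Perm n → Perm k → Set
Contains {n} {k} τ σ = Σ (Fin k → Fin n) λ f → Induces σ τ f

Av : ∀ {k} → Perm k → Class
Av α τ = ¬ Contains τ α

FormsIn : Class → ∀ {n} → Perm n → (Fin n → Bool) → Set
FormsIn C {n} π P =
  Σ ℕ λ k → Σ (Perm k) λ σ → Σ (Fin k → Fin n) λ f →
    Induces σ π f × (∀ p → P p ≡ true ⇔ ∃ λ i → f i ≡ p) × C σ

_⊙_ : Class → Class → Class
(C ⊙ D) {n} π = Σ (Fin n → Bool) λ red →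
  FormsIn C π red × FormsIn D π (λ p → not (red p))

-- Intervals and simplicity.  The block of positions a, a+1, …, a+ℓ-1
-- (requires a + ℓ ≤ n) is an interval if its set of values is also a set
-- of consecutive values, i.e. no point outside the block has a value
-- strictly between two values of points inside the block.
InBlock : ∀ {n} → ℕ → ℕ → Fin n → Set
InBlock a ℓ x = (a ≤ toℕ x) × (toℕ x Data.Nat.< a + ℓ)

IsInterval : ∀ {n} → Perm n → ℕ → ℕ → Set
IsInterval {n} π a ℓ =
  ∀ (x y p : Fin n) → InBlock a ℓ x → InBlock a ℓ y → ¬ InBlock a ℓ p →
    ¬ ((π ⟨$⟩ʳ x < π ⟨$⟩ʳ p) × (π ⟨$⟩ʳ p < π ⟨$⟩ʳ y))

Simple : ∀ {n} → Perm n → Set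
Simple {n} π = ∀ (a ℓ : ℕ) → 2 ≤ ℓ → ℓ Data.Nat.< n → a + ℓ ≤ n → ¬ IsInterval π a ℓ

data Formula : ℕ → Set where
  _≐_  : ∀ {m} → Fin m → Fin m → Formula m
  _<₁_ : ∀ {m} → Fin m → Fin m → Formula m
  _<₂_ : ∀ {m} → Fin m → Fin m → Formula m
  ¬'_  : ∀ {m} → Formula m → Formula m
  _∧'_ : ∀ {m} → Formula m → Formula m → Formula m
  ∃'   : ∀ {m} → Formula (suc m) → Formula m

Sentence : Set
Sentence = Formula zero

extend : ∀ {m n} → (Fin m → Fin n) → Fin n → Fin (suc m) → Fin n
extend ρ x Fin.zero = x
extend ρ x (Fin.suc i) = ρ i

-- Tarskian satisfaction in the finite structure (S_π, <₁, <₂) (decided,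
-- hence Boolean-valued).
sat : ∀ {n m} → Perm n → (Fin m → Fin n) → Formula m → Bool
sat π ρ (i ≐ j) = does (ρ i ≟ ρ j)
sat π ρ (i <₁ j) = does (ρ i FinP.<? ρ j)
sat π ρ (i <₂ j) = does ((π ⟨$⟩ʳ ρ i) FinP.<? (π ⟨$⟩ʳ ρ j))
sat π ρ (¬' φ) = not (sat π ρ φ)
sat π ρ (φ ∧' ψ) = sat π ρ φ ∧ sat π ρ ψ
sat {n} π ρ (∃' φ) = any (λ x → sat π (extend ρ x) φ) (allFin n)

_⊨_ : ∀ {n} → Perm n → Sentence → Set
π ⊨ φ = sat π (λ ()) φ ≡ true

FODefinable : Class → Set
FODefinable C = Σ Sentence λ φ → ∀ n (π : Perm n) → (π ⊨ φ) ⇔ C π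

{-# OPTIONS --safe #-}
module Submission where

open import Defs
open import Data.Nat using (ℕ; _≤_)
open import Relation.Nullary using (¬_)
open import Data.Bool using (Bool; true; false; not; if_then_else_; _∧_)
open import Data.Bool.ListAction using (any)
open import Data.Bool.Properties using (not-¬) renaming (_≟_ to _≟ᵇ_)
open import Data.Empty using (⊥)
open import Data.Fin
  using (Fin; zero; suc; toℕ; fromℕ; fromℕ<; inject₁; inject≤; punchIn; punchOut; combine; remQuot; opposite)
  renaming (_≟_ to _≟ᶠ_)
open import Data.Fin.Permutation using (permutation; _⟨$⟩ʳ_; _⟨$⟩ˡ_; inverseˡ; inverseʳ; flip; _∘ₚ_; reverse)
open import Data.Fin.Properties
  using ( toℕ-injective; toℕ-fromℕ; toℕ-fromℕ<; toℕ-inject₁; toℕ-inject≤; toℕ<n; any?; injective⇒≤; ≤fromℕ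
        ; punchIn-injective; punchInᵢ≢i; punchIn-mono-≤; punchIn-punchOut
        ; punchOut-injective; punchOut-cong; punchOut-punchIn
        ; inject₁-injective; combine-remQuot; remQuot-combine; opposite-prop)
  renaming (_<?_ to _<?ᶠ_)
open import Data.List using (tabulate)
open import Data.Nat using (zero; suc; _+_; _*_; _∸_; _⊔_; _⊓_; _<_; z≤n; s≤s; s≤s⁻¹; _≟_; _≤?_; _<?_)
open import Data.Nat.Properties
open import Data.Product using (Σ; ∃; ∃₂; _×_; _,_; proj₁; proj₂)
open import Data.Product.Properties using (≡-dec)
open import Data.Sum as Sum using (_⊎_; inj₁; inj₂)
open import Function using (_∘_; id)
open import Function.Bundles using (_⇔_; mk⇔; module Equivalence)
open import Function.Construct.Composition using (_⇔-∘_)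
open import Function.Construct.Symmetry using (⇔-sym)
open import Relation.Binary using (tri<; tri≈; tri>)
open import Relation.Binary.PropositionalEquality using (_≡_; _≢_; refl; sym; trans; cong; cong₂; subst; subst₂)
open import Relation.Nullary using (Dec; yes; no; does; contradiction; ¬?; _×-dec_)
open import Relation.Nullary.Decidable using (dec-true; dec-false; decidable-stable; does-⇔)
open import Relation.Unary using (Decidable)
open Equivalence using (to; from)

-- A copy of α inserted in place of a point receives both colours in every
-- admissible colouring.  If all points of a copy of α except two are inflated
-- in this way, the two remaining points must get different colours.  Such
-- gadgets, placed in columns 0, …, n along a diagonal, force colour changes on a
-- cycle whose length has the parity of n + 1.  If n is even, no colouring
-- exists.  If n is odd, the alternating colouring of the cycle is admissible:
-- α being simple, a copy of it is either contained in one inflated point or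
-- meets all of them in at most one point, and the points of one colour always
-- leave a part of such a transversal copy that is an interval or a summand.
-- A first-order sentence of small rank does not notice an additional column
-- in the middle, so it cannot tell the two parities apart.
--
-- The chain along the diagonal can be closed to a cycle in two ways.  One of
-- them works if the extreme points of α are not adjacent to each other in
-- certain ways and no point of α is a bottleneck between two summands.  The
-- other one works if α starts with its second largest value and ends with
-- its largest value followed by one more point.  Up to the symmetries of the
-- square, every simple permutation of length at least 4 is of one of the two
-- kinds.

-- Off the diagonal there are only the arcs, one from each column but the last to the next row, and
-- the point that closes the cycle. A copy of `α` that avoids the closing point and skips an arc has
-- to stay on one side of it, because `α` is not a direct sum. In an alternating colouring a
-- monochromatic copy that uses an arc skips both neighbouring arcs, so it lives in two adjacent
-- columns joined by one point. What remains is a finite comparison: a copy inside one column must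
-- put every point into its own place, while some place there is vacant or has the wrong colour.
--
-- The bottleneck condition is no restriction in the end. A bottleneck puts the leftmost point below
-- the rightmost one, so `α` and its complement cannot both have one, and it provides all the gaps
-- that the complement needs for the first way of closing the cycle.
--
-- Both grids come from a table that distinguishes only the first, the middle and the last columns.
-- The game and the passage from points to slots are thus done once for all tables.

-- Increasing maps, counting and standardisation.

Increasing : ∀ {m} → (Fin m → ℕ) → Set
Increasing f = ∀ i j → toℕ i < toℕ j → f i < f j

-- Both orders of a permutation being linear, order preservation along two
-- functions is automatically an equivalence.
reflects : ∀ {A : Set} (u v : A → ℕ) → (∀ {i j} → u i ≡ u j → i ≡ j) →
  (∀ i j → u i < u j → v i < v j) → ∀ i j → v i < v j → u i < u j
reflects u v inj mono i j vi<vj with <-cmp (u i) (u j)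
... | tri< lt _ _ = lt
... | tri≈ _ eq _ = contradiction vi<vj (<-irrefl (cong v (inj eq)))
... | tri> _ _ gt = contradiction vi<vj (<-asym (mono j i gt))

increasing-reflects : ∀ {m} (f : Fin m → ℕ) → Increasing f → ∀ i j → f i < f j → toℕ i < toℕ j
increasing-reflects f inc = reflects toℕ f toℕ-injective inc

increasing-injective : ∀ {m} (f : Fin m → ℕ) → Increasing f → ∀ {i j} → f i ≡ f j → i ≡ j
increasing-injective f inc {i} {j} eq with <-cmp (toℕ i) (toℕ j)
... | tri< lt _ _ = contradiction eq (<⇒≢ (inc i j lt))
... | tri≈ _ e _ = toℕ-injective e
... | tri> _ _ gt = contradiction (sym eq) (<⇒≢ (inc j i gt))

perm-injective : ∀ {n} (π : Perm n) {i j} → π ⟨$⟩ʳ i ≡ π ⟨$⟩ʳ j → i ≡ j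
perm-injective π {i} {j} eq = trans (sym (inverseˡ π)) (trans (cong (π ⟨$⟩ˡ_) eq) (inverseˡ π))

injective⇒surjective : ∀ {n} (f : Fin n → Fin n) → (∀ {i j} → f i ≡ f j → i ≡ j) →
  ∀ j → ∃ λ i → f i ≡ j
injective⇒surjective {suc n} f inj j with any? (λ i → f i ≟ᶠ j)
... | yes hit = hit
... | no miss = contradiction (injective⇒≤ {f = g} g-inj) 1+n≰n
  where
    ne : ∀ i → j ≢ f i
    ne i eq = miss (i , sym eq)
    g : Fin (suc n) → Fin n
    g i = punchOut (ne i)
    g-inj : ∀ {a b} → g a ≡ g b → a ≡ b
    g-inj {a} {b} = inj ∘ punchOut-injective (ne a) (ne b)

fromInjective : ∀ {n} (f : Fin n → Fin n) → (∀ {i j} → f i ≡ f j → i ≡ j) →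
  Σ (Perm n) λ σ → ∀ i → σ ⟨$⟩ʳ i ≡ f i
fromInjective f inj =
  permutation f (proj₁ ∘ sur) (proj₂ ∘ sur) (λ i → inj (proj₂ (sur (f i)))) , λ _ → refl
  where sur = injective⇒surjective f inj

count : ∀ {m} → (Fin m → Bool) → ℕ
count {zero} p = 0
count {suc m} p = if p zero then suc (count (p ∘ suc)) else count (p ∘ suc)

count-mono : ∀ {m} (p q : Fin m → Bool) → (∀ i → p i ≡ true → q i ≡ true) → count p ≤ count q
count-mono {zero} p q imp = z≤n
count-mono {suc m} p q imp with p zero in pz | q zero in qz
... | true | true = s≤s (count-mono _ _ (imp ∘ suc))
... | true | false with () ← trans (sym (imp zero pz)) qz
... | false | true = m≤n⇒m≤1+n (count-mono _ _ (imp ∘ suc))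
... | false | false = count-mono _ _ (imp ∘ suc)

count-strict : ∀ {m} (p q : Fin m → Bool) → (∀ i → p i ≡ true → q i ≡ true) →
  ∀ i → p i ≡ false → q i ≡ true → count p < count q
count-strict p q imp zero pf qt rewrite pf | qt = s≤s (count-mono _ _ (imp ∘ suc))
count-strict p q imp (suc i) pf qt with p zero in pz | q zero in qz
... | true | true = s≤s (count-strict _ _ (imp ∘ suc) i pf qt)
... | true | false with () ← trans (sym (imp zero pz)) qz
... | false | true = m≤n⇒m≤1+n (count-strict _ _ (imp ∘ suc) i pf qt)
... | false | false = count-strict _ _ (imp ∘ suc) i pf qt

count-all : ∀ m → count {m} (λ _ → true) ≡ m
count-all zero = refl
count-all (suc m) = cong suc (count-all m)

does-true⇒ : ∀ {P : Set} (d : Dec P) → does d ≡ true → P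
does-true⇒ (yes p) _ = p

-- The rank of `i` is the number of indices with a smaller value. It is below `m` because `i` itself
-- is not counted, and injectivity of `y` makes the ranks distinct.
standardise : ∀ {m} (y : Fin m → ℕ) → (∀ {i j} → y i ≡ y j → i ≡ j) →
  Σ (Perm m) λ σ → ∀ i j → (toℕ (σ ⟨$⟩ʳ i) < toℕ (σ ⟨$⟩ʳ j)) ⇔ (y i < y j)
standardise {m} y inj =
  σ , λ i j → mk⇔ (reflects y (toℕ ∘ (σ ⟨$⟩ʳ_)) inj mono i j) (mono i j)
  where
    below : Fin m → Fin m → Bool
    below i j = does (y j <? y i)
    rank< : ∀ i → count (below i) < m
    rank< i = subst (count (below i) <_) (count-all m)
      (count-strict (below i) (λ _ → true) (λ _ _ → refl) i (dec-false (y i <? y i) (<-irrefl refl)) refl)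
    rank-mono : ∀ i j → y i < y j → count (below i) < count (below j)
    rank-mono i j lt = count-strict (below i) (below j)
      (λ l t → dec-true (y l <? y j) (<-trans (does-true⇒ (y l <? y i) t) lt))
      i (dec-false (y i <? y i) (<-irrefl refl)) (dec-true (y i <? y j) lt)
    f : Fin m → Fin m
    f i = fromℕ< (rank< i)
    f-mono : ∀ i j → y i < y j → toℕ (f i) < toℕ (f j)
    f-mono i j lt = subst₂ _<_ (sym (toℕ-fromℕ< (rank< i))) (sym (toℕ-fromℕ< (rank< j))) (rank-mono i j lt)
    f-inj : ∀ {i j} → f i ≡ f j → i ≡ j
    f-inj {i} {j} eq with <-cmp (y i) (y j)
    ... | tri< lt _ _ = contradiction (cong toℕ eq) (<⇒≢ (f-mono i j lt))
    ... | tri≈ _ e _ = inj e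
    ... | tri> _ _ gt = contradiction (cong toℕ (sym eq)) (<⇒≢ (f-mono j i gt))
    σ = proj₁ (fromInjective f f-inj)
    mono : ∀ i j → y i < y j → toℕ (σ ⟨$⟩ʳ i) < toℕ (σ ⟨$⟩ʳ j)
    mono = f-mono

enumerate : ∀ {n} (p : Fin n → Bool) → Σ ℕ λ m → Σ (Fin m → Fin n) λ f →
  Increasing (toℕ ∘ f) × (∀ x → p x ≡ true ⇔ ∃ λ i → f i ≡ x)
enumerate {zero} p = 0 , (λ ()) , (λ ()) , λ ()
enumerate {suc n} p with enumerate (p ∘ suc) | p zero in pz
... | m , f , inc , img | true = suc m , f⁺ , inc⁺ , img⁺
  where
    f⁺ : Fin (suc m) → Fin (suc n)
    f⁺ zero = zero
    f⁺ (suc i) = suc (f i)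
    inc⁺ : Increasing (toℕ ∘ f⁺)
    inc⁺ zero (suc j) lt = s≤s z≤n
    inc⁺ (suc i) (suc j) (s≤s lt) = s≤s (inc i j lt)
    img⁺ : ∀ x → p x ≡ true ⇔ ∃ λ i → f⁺ i ≡ x
    img⁺ zero = mk⇔ (λ _ → zero , refl) (λ _ → pz)
    img⁺ (suc x) = mk⇔ (λ px → let i , eq = to (img x) px in suc i , cong suc eq)
      λ { (suc i , refl) → from (img x) (i , refl) }
... | m , f , inc , img | false = m , suc ∘ f , (λ i j lt → s≤s (inc i j lt)) , img⁺
  where
    img⁺ : ∀ x → p x ≡ true ⇔ ∃ λ i → suc (f i) ≡ x
    img⁺ zero = mk⇔ (λ pz′ → contradiction (trans (sym pz′) pz) λ ()) λ ()
    img⁺ (suc x) = mk⇔ (λ px → let i , eq = to (img x) px in i , cong suc eq)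
      λ { (i , refl) → from (img x) (i , refl) }

-- The product of two avoidance classes in terms of colourings.

module _ {k n : ℕ} (α : Perm k) (π : Perm n) where

  CopyFree : (Fin n → Bool) → Set
  CopyFree P = ∀ f → Induces α π f → ¬ (∀ i → P (f i) ≡ true)

  -- A copy of `α` inside `P` can be pulled back along the map `f` that lists the points of `P`; it
  -- becomes a copy in `σ`.
  formsIn⇒copyFree : ∀ P → FormsIn (Av α) π P → CopyFree P
  formsIn⇒copyFree P (m , σ , f , (f-inc , f-val) , img , avoids) h (h-inc , h-val) hP =
    avoids (j , j-inc , λ a b → mk⇔ (from (f-val (j a) (j b)) ∘ ↓ a b ∘ to (h-val a b))
                                     (from (h-val a b) ∘ ↑ a b ∘ to (f-val (j a) (j b))))
    where
      j : Fin k → Fin m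
      j a = proj₁ (to (img (h a)) (hP a))
      fj : ∀ a → f (j a) ≡ h a
      fj a = proj₂ (to (img (h a)) (hP a))
      j-inc : ∀ a b → toℕ a < toℕ b → toℕ (j a) < toℕ (j b)
      j-inc a b lt = increasing-reflects (toℕ ∘ f) f-inc (j a) (j b)
        (subst₂ (λ u v → toℕ u < toℕ v) (sym (fj a)) (sym (fj b)) (h-inc a b lt))
      val : Fin n → ℕ
      val x = toℕ (π ⟨$⟩ʳ x)
      ↓ : ∀ a b → val (h a) < val (h b) → val (f (j a)) < val (f (j b))
      ↓ a b = subst₂ (λ u v → val u < val v) (sym (fj a)) (sym (fj b))
      ↑ : ∀ a b → val (f (j a)) < val (f (j b)) → val (h a) < val (h b)
      ↑ a b = subst₂ (λ u v → val u < val v) (fj a) (fj b)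

  copyFree⇒formsIn : ∀ P → CopyFree P → FormsIn (Av α) π P
  copyFree⇒formsIn P free with enumerate P
  ... | m , f , f-inc , img = m , σ , f , (f-inc , σ-val) , img ,
      λ { (h , h-inc , h-val) → free (f ∘ h)
            ( (λ a b lt → f-inc (h a) (h b) (h-inc a b lt))
            , (λ a b → mk⇔ (to (σ-val (h a) (h b)) ∘ to (h-val a b))
                            (from (h-val a b) ∘ from (σ-val (h a) (h b)))))
            λ a → from (img (f (h a))) (h a , refl) }
    where
      std = standardise (toℕ ∘ (π ⟨$⟩ʳ_) ∘ f)
        (increasing-injective (toℕ ∘ f) f-inc ∘ cong toℕ ∘ perm-injective π ∘ toℕ-injective)
      σ = proj₁ std
      σ-val = proj₂ std

  -- Quantifying over the colour `c` treats both factors of the product alike. From here on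
  -- membership in the class means having a 2-colouring without monochromatic copies of `α`.
  MonoFree : (Fin n → Bool) → Set
  MonoFree red = ∀ c f → Induces α π f → ¬ (∀ i → red (f i) ≡ c)

  ⊙⇒monoFree : (Av α ⊙ Av α) π → ∃ MonoFree
  ⊙⇒monoFree (red , r , b) = red , free
    where
      free : MonoFree red
      free true = formsIn⇒copyFree red r
      free false f ind all = formsIn⇒copyFree (not ∘ red) b f ind (cong not ∘ all)

  monoFree⇒⊙ : ∃ MonoFree → (Av α ⊙ Av α) π
  monoFree⇒⊙ (red , free) = red , copyFree⇒formsIn red (free true) ,
    copyFree⇒formsIn (not ∘ red) λ f ind all →
      free false f ind λ i → not-true (red (f i)) (all i)
    where
      not-true : ∀ b → not b ≡ true → b ≡ false
      not-true false _ = refl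

-- Ehrenfeucht-Fraïssé games.

any-tabulate : ∀ {n} {A : Set} (p : A → Bool) (f : Fin n → A) →
  any p (tabulate f) ≡ true ⇔ ∃ λ i → p (f i) ≡ true
any-tabulate {zero} p f = mk⇔ (λ ()) λ ()
any-tabulate {suc n} p f with p (f zero) in eq
... | true = mk⇔ (λ _ → zero , eq) (λ _ → refl)
... | false = mk⇔ (λ t → let i , q = to (any-tabulate p (f ∘ suc)) t in suc i , q)
  λ { (zero , q) → contradiction (trans (sym q) eq) (λ ()) ; (suc i , q) → from (any-tabulate p (f ∘ suc)) (i , q) }

bool-ext : ∀ {b c : Bool} → (b ≡ true → c ≡ true) → (c ≡ true → b ≡ true) → b ≡ c
bool-ext {true} {c} f g = sym (f refl)
bool-ext {false} {false} f g = refl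
bool-ext {false} {true} f g = g refl

rank : ∀ {m} → Formula m → ℕ
rank (i ≐ j) = 0
rank (i <₁ j) = 0
rank (i <₂ j) = 0
rank (¬' φ) = rank φ
rank (φ ∧' ψ) = rank φ ⊔ rank ψ
rank (∃' φ) = suc (rank φ)

-- A winning strategy of the duplicator as a family of relations: `E r` holds between positions from
-- which `r` more rounds can be survived.
record BackAndForth {N N′} (π : Perm N) (π′ : Perm N′)
    (E : ℕ → ∀ {m} → (Fin m → Fin N) → (Fin m → Fin N′) → Set) : Set where
  field
    ≐-resp : ∀ {r m} {ρ : Fin m → Fin N} {ρ′} → E r ρ ρ′ → ∀ i j → (ρ i ≡ ρ j) ⇔ (ρ′ i ≡ ρ′ j)
    <₁-resp : ∀ {r m} {ρ : Fin m → Fin N} {ρ′} → E r ρ ρ′ → ∀ i j →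
      (toℕ (ρ i) < toℕ (ρ j)) ⇔ (toℕ (ρ′ i) < toℕ (ρ′ j))
    <₂-resp : ∀ {r m} {ρ : Fin m → Fin N} {ρ′} → E r ρ ρ′ → ∀ i j →
      (toℕ (π ⟨$⟩ʳ ρ i) < toℕ (π ⟨$⟩ʳ ρ j)) ⇔ (toℕ (π′ ⟨$⟩ʳ ρ′ i) < toℕ (π′ ⟨$⟩ʳ ρ′ j))
    forth : ∀ {r m} {ρ : Fin m → Fin N} {ρ′} → E (suc r) ρ ρ′ → ∀ x → ∃ λ x′ → E r (extend ρ x) (extend ρ′ x′)
    back : ∀ {r m} {ρ : Fin m → Fin N} {ρ′} → E (suc r) ρ ρ′ → ∀ x′ → ∃ λ x → E r (extend ρ x) (extend ρ′ x′)

module _ {N N′} {π : Perm N} {π′ : Perm N′}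
    {E : ℕ → ∀ {m} → (Fin m → Fin N) → (Fin m → Fin N′) → Set} (G : BackAndForth π π′ E) where
  open BackAndForth G

  sat-resp : ∀ {m r} (φ : Formula m) → rank φ ≤ r → ∀ {ρ ρ′} → E r ρ ρ′ → sat π ρ φ ≡ sat π′ ρ′ φ
  sat-resp (i ≐ j) _ e = does-⇔ (≐-resp e i j) (_ ≟ᶠ _) (_ ≟ᶠ _)
  sat-resp (i <₁ j) _ e = does-⇔ (<₁-resp e i j) (_ <?ᶠ _) (_ <?ᶠ _)
  sat-resp (i <₂ j) _ e = does-⇔ (<₂-resp e i j) (_ <?ᶠ _) (_ <?ᶠ _)
  sat-resp (¬' φ) le e = cong not (sat-resp φ le e)
  sat-resp (φ ∧' ψ) le e = cong₂ _∧_ (sat-resp φ (m⊔n≤o⇒m≤o (rank φ) (rank ψ) le) e)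
                                      (sat-resp ψ (m⊔n≤o⇒n≤o (rank φ) (rank ψ) le) e)
  sat-resp (∃' φ) (s≤s le) {ρ} {ρ′} e = bool-ext
    (λ t → let x , s = to (any-tabulate (λ x → sat π (extend ρ x) φ) id) t
               x′ , e′ = forth e x
           in from (any-tabulate (λ x → sat π′ (extend ρ′ x) φ) id) (x′ , trans (sym (sat-resp φ le e′)) s))
    (λ t → let x′ , s = to (any-tabulate (λ x → sat π′ (extend ρ′ x) φ) id) t
               x , e′ = back e x′
           in from (any-tabulate (λ x → sat π (extend ρ x) φ) id) (x , trans (sat-resp φ le e′) s))

-- Lexicographic coordinates.

-- A pair with second entry below `K`, packed into one number. Coordinates remain plain naturals,
-- and nesting orders points by column, then place, then position inside an inserted copy.
lex : ∀ {K} → ℕ → Fin K → ℕ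
lex {K} a b = a * K + toℕ b

lex-<ˡ : ∀ {K} {a c} (b d : Fin K) → a < c → lex a b < lex c d
lex-<ˡ {K} {a} {c} b d a<c = begin-strict
  a * K + toℕ b  <⟨ +-monoʳ-< (a * K) (toℕ<n b) ⟩
  a * K + K      ≡⟨ +-comm (a * K) K ⟩
  suc a * K      ≤⟨ *-monoˡ-≤ K a<c ⟩
  c * K          ≤⟨ m≤m+n (c * K) (toℕ d) ⟩
  c * K + toℕ d  ∎
  where open ≤-Reasoning

lex-<ʳ : ∀ {K} a {b d : Fin K} → toℕ b < toℕ d → lex a b < lex a d
lex-<ʳ {K} a = +-monoʳ-< (a * K)

lex-cancel : ∀ {K} a {b d : Fin K} → lex a b < lex a d → toℕ b < toℕ d
lex-cancel {K} a {b} {d} = +-cancelˡ-< (a * K) (toℕ b) (toℕ d)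

lex-< : ∀ {K} a c (b d : Fin K) → lex a b < lex c d ⇔ (a < c ⊎ (a ≡ c × toℕ b < toℕ d))
lex-< {K} a c b d = mk⇔ ⇒ λ { (inj₁ a<c) → lex-<ˡ b d a<c ; (inj₂ (refl , b<d)) → lex-<ʳ a b<d }
  where
    ⇒ : lex a b < lex c d → a < c ⊎ (a ≡ c × toℕ b < toℕ d)
    ⇒ lt with <-cmp a c
    ... | tri< a<c _ _ = inj₁ a<c
    ... | tri≈ _ refl _ = inj₂ (refl , +-cancelˡ-< (a * K) (toℕ b) (toℕ d) lt)
    ... | tri> _ _ c<a = contradiction lt (<-asym (lex-<ˡ d b c<a))

lex-≤ˡ : ∀ {K} a c (b d : Fin K) → lex a b < lex c d → a ≤ c
lex-≤ˡ a c b d lt with to (lex-< a c b d) lt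
... | inj₁ a<c = <⇒≤ a<c
... | inj₂ (refl , _) = ≤-refl

lex-≡ : ∀ {K} a c (b d : Fin K) → lex a b ≡ lex c d → a ≡ c × b ≡ d
lex-≡ {K} a c b d eq with <-cmp a c
... | tri< a<c _ _ = contradiction eq (<⇒≢ (lex-<ˡ b d a<c))
... | tri≈ _ refl _ = refl , toℕ-injective (+-cancelˡ-≡ (a * K) (toℕ b) (toℕ d) eq)
... | tri> _ _ c<a = contradiction (sym eq) (<⇒≢ (lex-<ˡ d b c<a))

SameCmp : ℕ → ℕ → ℕ → ℕ → Set
SameCmp a c a′ c′ = (a < c ⇔ a′ < c′) × (a ≡ c ⇔ a′ ≡ c′)

sameCmp-lex : ∀ {K} {a c a′ c′} (b d : Fin K) → SameCmp a c a′ c′ →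
  SameCmp (lex a b) (lex c d) (lex a′ b) (lex c′ d)
sameCmp-lex {K} {a} {c} {a′} {c′} b d (lt , eq) =
  mk⇔ (λ h → from (lex-< a′ c′ b d) (Sum.map (to lt) (λ (p , q) → to eq p , q) (to (lex-< a c b d) h)))
      (λ h → from (lex-< a c b d) (Sum.map (from lt) (λ (p , q) → from eq p , q) (to (lex-< a′ c′ b d) h))) ,
  mk⇔ (λ h → let p , q = lex-≡ a c b d h in cong₂ lex (to eq p) q)
      (λ h → let p , q = lex-≡ a′ c′ b d h in cong₂ lex (from eq p) q)

-- Grids described by a table.

data Kind : Set where
  vacant wild single : Kind

data Row : Set where
  own next bottom top : Row

data Zone : Set where
  first middle last : Zone

record Cell (V : ℕ) : Set where
  constructor cell
  field
    kind : Kind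
    row : Row
    level : Fin V
open Cell

-- One finite table serves all `n`. As an entry depends on the column only through its zone, all
-- middle columns look alike, which is what lets a column be inserted unnoticed.
record Table : Set where
  field
    width : ℕ
    height : ℕ
    entry : Zone → Fin width → Cell height

-- For `n = 0` the only column counts as `first`; hence `1 ≤ n` wherever column `n` has to be
-- `last`.
zone : ℕ → ℕ → Zone
zone n zero = first
zone n (suc t) with n ≟ suc t
... | yes _ = last
... | no _ = middle

rowOf : ℕ → ℕ → Row → ℕ
rowOf n t own = t
rowOf n t next = suc t
rowOf n t bottom = 0
rowOf n t top = n

-- Columns are numbered 0, …, n.  The slot (t , i) is the i-th place of column t;
-- a wild slot is inflated by a copy of α, a single slot holds one point.
module Grid (T : Table) {k : ℕ} (α : Perm k) where
  open Table T

  Slot : Set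
  Slot = ℕ × Fin width

  Point : Set
  Point = Slot × Fin k

  at : ℕ → Slot → Cell height
  at n (t , i) = entry (zone n t) i

  sx : Slot → ℕ
  sx (t , i) = lex t i

  sy : ℕ → Slot → ℕ
  sy n s = lex (rowOf n (proj₁ s) (row (at n s))) (level (at n s))

  sy-at : ∀ n s {c} → at n s ≡ c → sy n s ≡ lex (rowOf n (proj₁ s) (row c)) (level c)
  sy-at n s eq = cong (λ c → lex (rowOf n (proj₁ s) (row c)) (level c)) eq

  px : Point → ℕ
  px (s , w) = lex (sx s) w

  py : ℕ → Point → ℕ
  py n (s , w) = lex (sy n s) (α ⟨$⟩ʳ w)

  Occupied : ℕ → Slot → Set
  Occupied n s = proj₁ s ≤ n × kind (at n s) ≢ vacant

  -- The one point of a single slot carries index 0, so that single and wild slots share the type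
  -- `Point`.
  Fits : Kind → Fin k → Set
  Fits κ w = κ ≡ wild ⊎ (κ ≡ single × toℕ w ≡ 0)

  Present : ℕ → Point → Set
  Present n (s , w) = proj₁ s ≤ n × Fits (kind (at n s)) w

  fits⇒occupied : ∀ {κ w} → Fits κ w → κ ≢ vacant
  fits⇒occupied (inj₁ refl) ()
  fits⇒occupied (inj₂ (refl , _)) ()

  present⇒occupied : ∀ {n p} → Present n p → Occupied n (proj₁ p)
  present⇒occupied (le , f) = le , fits⇒occupied f

  -- Horizontally, distinct slots are distinct by the definition of `sx`. Vertically they may
  -- collide, since slots are moved into foreign rows; each table has to exclude this.
  SeparatedRows : ℕ → Set
  SeparatedRows n = ∀ {s s′} → Occupied n s → Occupied n s′ → sy n s ≡ sy n s′ → s ≡ s′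

  fits? : ∀ κ w → Dec (Fits κ w)
  fits? vacant w = no λ { (inj₁ ()) ; (inj₂ (() , _)) }
  fits? wild w = yes (inj₁ refl)
  fits? single w with toℕ w ≟ 0
  ... | yes z = yes (inj₂ (refl , z))
  ... | no nz = no λ { (inj₁ ()) ; (inj₂ (_ , z)) → nz z }

  present? : ∀ n p → Dec (Present n p)
  present? n (s , w) = (proj₁ s ≤? n) ×-dec fits? (kind (at n s)) w

  px-injective : ∀ {p q} → px p ≡ px q → p ≡ q
  px-injective {(t , i) , w} {(t′ , i′) , w′} eq with lex-≡ (lex t i) (lex t′ i′) w w′ eq
  ... | eq′ , refl with lex-≡ t t′ i i′ eq′
  ... | refl , refl = refl

  -- Only these order properties of the permutation are used later, never the way in which its
  -- points were enumerated.
  record Model (n : ℕ) : Set where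
    field
      size : ℕ
      perm : Perm size
      point : Fin size → Point
      isPresent : ∀ x → Present n (point x)
      index : ∀ {p} → Present n p → ∃ λ x → point x ≡ p
      x-order : ∀ x y → (toℕ x < toℕ y) ⇔ (px (point x) < px (point y))
      y-order : ∀ x y → (toℕ (perm ⟨$⟩ʳ x) < toℕ (perm ⟨$⟩ʳ y)) ⇔ (py n (point x) < py n (point y))

    point-injective : ∀ {x y} → point x ≡ point y → x ≡ y
    point-injective {x} {y} eq with <-cmp (toℕ x) (toℕ y)
    ... | tri< lt _ _ = contradiction (to (x-order x y) lt) (<-irrefl (cong px eq))
    ... | tri≈ _ e _ = toℕ-injective e
    ... | tri> _ _ gt = contradiction (to (x-order y x) gt) (<-irrefl (cong px (sym eq)))

  model : ∀ n → SeparatedRows n → Model n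
  model n sep = record
    { size = M
    -- `σX` and `σY` send an enumerated point to its horizontal and its vertical rank: a position is
    -- taken back to its point and then on to its value.
    ; perm = flip σX ∘ₚ σY
    ; point = λ x → e (σX ⟨$⟩ˡ x)
    ; isPresent = e-present ∘ (σX ⟨$⟩ˡ_)
    ; index = λ pr → let i , eq = e-index pr in
        σX ⟨$⟩ʳ i , trans (cong e (inverseˡ σX)) eq
    ; x-order = λ x y → subst₂ (λ u v → (toℕ u < toℕ v) ⇔ (px (e (σX ⟨$⟩ˡ x)) < px (e (σX ⟨$⟩ˡ y)))) (inverseʳ σX) (inverseʳ σX)
        (proj₂ stdX (σX ⟨$⟩ˡ x) (σX ⟨$⟩ˡ y))
    ; y-order = λ x y → proj₂ stdY (σX ⟨$⟩ˡ x) (σX ⟨$⟩ˡ y)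
    }
    where
      U = suc n * (width * k)
      glue : Fin (suc n) → Fin width × Fin k → Point
      glue t (i , w) = (toℕ t , i) , w
      unpack : Fin (suc n) × Fin (width * k) → Point
      unpack (t , r) = glue t (remQuot k r)
      decode : Fin U → Point
      decode u = unpack (remQuot (width * k) u)
      encode : ∀ {p} → Present n p → ∃ λ u → decode u ≡ p
      encode {(t , i) , w} (le , _) = combine c (combine i w) , eq
        where
          c = fromℕ< (s≤s le)
          eq : decode (combine c (combine i w)) ≡ ((t , i) , w)
          eq = trans (cong unpack (remQuot-combine c (combine i w)))
            (trans (cong (glue c) (remQuot-combine i w))
                   (cong (λ t → (t , i) , w) (toℕ-fromℕ< (s≤s le))))
      decode-injective : ∀ {u v} → decode u ≡ decode v → u ≡ v
      decode-injective {u} {v} eq =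
        trans (sym (combine-remQuot {suc n} (width * k) u))
          (trans (cong₂ combine (toℕ-injective (cong (proj₁ ∘ proj₁) eq))
            (trans (sym (combine-remQuot {width} k _))
              (trans (cong₂ combine (cong (proj₂ ∘ proj₁) eq) (cong proj₂ eq)) (combine-remQuot {width} k _))))
          (combine-remQuot {suc n} (width * k) v))
      enum = enumerate (λ u → does (present? n (decode u)))
      M = proj₁ enum
      f = proj₁ (proj₂ enum)
      f-inc = proj₁ (proj₂ (proj₂ enum))
      f-img = proj₂ (proj₂ (proj₂ enum))
      e : Fin M → Point
      e = decode ∘ f
      e-injective : ∀ {i j} → e i ≡ e j → i ≡ j
      e-injective = increasing-injective (toℕ ∘ f) f-inc ∘ cong toℕ ∘ decode-injective
      e-present : ∀ i → Present n (e i)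
      e-present i = does-true⇒ (present? n (e i)) (from (f-img (f i)) (i , refl))
      e-index : ∀ {p} → Present n p → ∃ λ i → e i ≡ p
      e-index pr with encode pr
      ... | u , refl with to (f-img u) (dec-true (present? n (decode u)) pr)
      ... | i , eq = i , cong decode eq
      stdX = standardise (px ∘ e) (e-injective ∘ px-injective)
      py-e-injective : ∀ {i j} → py n (e i) ≡ py n (e j) → i ≡ j
      py-e-injective {i} {j} eq with lex-≡ (sy n (proj₁ (e i))) (sy n (proj₁ (e j))) (α ⟨$⟩ʳ proj₂ (e i)) (α ⟨$⟩ʳ proj₂ (e j)) eq
      ... | eq′ , w≡ = e-injective (cong₂ _,_
            (sep (present⇒occupied (e-present i)) (present⇒occupied (e-present j)) eq′)
            (perm-injective α w≡))
      stdY = standardise (py n ∘ e) py-e-injective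
      σX = proj₁ stdX
      σY = proj₁ stdY

-- Insertion of a column.

-- Columns `lo`, ..., `hi - 1` have no partner: they are the free run in which the additional column
-- is hidden.
data Shift (lo hi : ℕ) : ℕ → ℕ → Set where
  below : ∀ {a} → a < lo → Shift lo hi a a
  above : ∀ {a} → hi ≤ a → Shift lo hi a (suc a)

shift-cmp : ∀ {lo hi a a′ c c′} → lo ≤ hi → Shift lo hi a a′ → Shift lo hi c c′ → SameCmp a c a′ c′
shift-cmp le (below _) (below _) = mk⇔ id id , mk⇔ id id
shift-cmp le (below a<) (above ≤c) =
  mk⇔ m≤n⇒m≤1+n (λ _ → a<c) , mk⇔ (λ e → contradiction e (<⇒≢ a<c)) (λ e → contradiction e (<⇒≢ (m≤n⇒m≤1+n a<c)))
  where a<c = ≤-trans a< (≤-trans le ≤c)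
shift-cmp le (above ≤a) (below c<) =
  mk⇔ (λ h → contradiction h (<-asym c<a)) (λ h → contradiction h (<-asym (m≤n⇒m≤1+n c<a))) ,
  mk⇔ (λ e → contradiction (sym e) (<⇒≢ c<a)) (λ e → contradiction (sym e) (<⇒≢ (m≤n⇒m≤1+n c<a)))
  where c<a = ≤-trans c< (≤-trans le ≤a)
shift-cmp le (above _) (above _) = mk⇔ s≤s s≤s⁻¹ , mk⇔ (cong suc) suc-injective

shift-narrow : ∀ {lo hi lo′ hi′ a a′} → lo ≤ lo′ → hi′ ≤ hi → Shift lo hi a a′ → Shift lo′ hi′ a a′
shift-narrow l h (below a<) = below (≤-trans a< l)
shift-narrow l h (above ≤a) = above (≤-trans h ≤a)

shift-≤ : ∀ {lo hi n t t′} → lo ≤ n → Shift lo hi t t′ → t ≤ n ⇔ t′ ≤ suc n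
shift-≤ lo≤n (below t<) = mk⇔ m≤n⇒m≤1+n (λ _ → <⇒≤ (≤-trans t< lo≤n))
shift-≤ lo≤n (above _) = mk⇔ s≤s s≤s⁻¹

shift-zone : ∀ {lo hi n t t′} → 1 ≤ lo → lo < hi → hi ≤ n → Shift lo hi t t′ → zone n t ≡ zone (suc n) t′
shift-zone {t = zero} 1≤lo lo<hi hi≤n (below _) = refl
shift-zone {n = n} {suc t} 1≤lo lo<hi hi≤n (below t<) with n ≟ suc t | suc n ≟ suc t
... | no _ | no _ = refl
... | yes refl | _ = contradiction (≤-trans lo<hi hi≤n) (<-asym t<)
... | no _ | yes refl = contradiction (≤-trans (m≤n⇒m≤1+n lo<hi) (s≤s hi≤n)) (<-asym t<)
shift-zone {t = zero} 1≤lo lo<hi hi≤n (above hi≤0) = contradiction (≤-trans lo<hi hi≤0) λ ()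
shift-zone {n = n} {suc t} 1≤lo lo<hi hi≤n (above _) with n ≟ suc t | suc n ≟ suc (suc t)
... | yes _ | yes _ = refl
... | no _ | no _ = refl
... | yes refl | no ne = contradiction refl ne
... | no ne | yes refl = contradiction refl ne

-- The bound rises to `suc lo` because column `lo - 1`, which is not moved, may have a cell in row
-- `lo` by way of `next`.
shift-row : ∀ {lo hi n t t′} → hi ≤ n → Shift lo hi t t′ → ∀ ρ →
  Shift (suc lo) hi (rowOf n t ρ) (rowOf (suc n) t′ ρ)
shift-row hi≤n sh own = shift-narrow (m≤n⇒m≤1+n ≤-refl) ≤-refl sh
shift-row hi≤n (below t<) next = below (s≤s t<)
shift-row hi≤n (above ≤t) next = above (m≤n⇒m≤1+n ≤t)
shift-row hi≤n sh bottom = below (s≤s z≤n)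
shift-row hi≤n sh top = above hi≤n

-- The free run needed with `r` rounds to go. At the end one free column must be left, as rows are
-- compared under `suc lo ≤ hi`; before a move there must be room for the chosen column and for a
-- run of length `gap r` on either side of it.
gap : ℕ → ℕ
gap zero = 1
gap (suc r) = suc (gap r + gap r)

gap>0 : ∀ r → 0 < gap r
gap>0 zero = s≤s z≤n
gap>0 (suc r) = s≤s z≤n

module Insertion (T : Table) {k : ℕ} (α : Perm k) where
  open Table T
  open Grid T α

  -- One column can be inserted anywhere in a run of columns without being
  -- noticed as long as the run contains none of the chosen points; after each
  -- choice about half of the run is still free.
  module _ {n : ℕ} (M : Model n) (M′ : Model (suc n)) where
    private
      module M = Model M
      module M′ = Model M′

    data Alike (lo hi : ℕ) : Point → Point → Set where
      alike : ∀ {t t′ i w} → Shift lo hi t t′ → Alike lo hi ((t , i) , w) ((t′ , i) , w)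

    record Close (r : ℕ) {m : ℕ} (ρ : Fin m → Fin M.size) (ρ′ : Fin m → Fin M′.size) : Set where
      constructor close
      field
        {lo hi} : ℕ
        1≤lo : 1 ≤ lo
        wide : lo + gap r ≤ hi
        hi≤n : hi ≤ n
        points : ∀ i → Alike lo hi (M.point (ρ i)) (M′.point (ρ′ i))

    wide⇒< : ∀ {lo hi} r → lo + gap r ≤ hi → lo < hi
    wide⇒< {lo} r w = ≤-trans (m<m+n lo (gap>0 r)) w

    alike-narrow : ∀ {lo hi lo′ hi′ p p′} → lo ≤ lo′ → hi′ ≤ hi → Alike lo hi p p′ → Alike lo′ hi′ p p′
    alike-narrow l h (alike sh) = alike (shift-narrow l h sh)

    module _ {lo hi : ℕ} (1≤lo : 1 ≤ lo) (lo<hi : lo < hi) (hi≤n : hi ≤ n) where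

      alike-px : ∀ {p p′ q q′} → Alike lo hi p p′ → Alike lo hi q q′ → SameCmp (px p) (px q) (px p′) (px q′)
      alike-px (alike {i = i} {w} sh) (alike {i = j} {v} sh′) =
        sameCmp-lex w v (sameCmp-lex i j (shift-cmp (<⇒≤ lo<hi) sh sh′))

      alike-py : ∀ {p p′ q q′} → Alike lo hi p p′ → Alike lo hi q q′ →
        SameCmp (py n p) (py n q) (py (suc n) p′) (py (suc n) q′)
      alike-py (alike {t} {i = i} {w} sh) (alike {u} {i = j} {v} sh′)
        rewrite sym (shift-zone 1≤lo lo<hi hi≤n sh) | sym (shift-zone 1≤lo lo<hi hi≤n sh′) =
        sameCmp-lex (α ⟨$⟩ʳ w) (α ⟨$⟩ʳ v) (sameCmp-lex (Cell.level c) (Cell.level d)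
          (shift-cmp lo<hi (shift-row hi≤n sh (Cell.row c)) (shift-row hi≤n sh′ (Cell.row d))))
        where
          c = at n (t , i)
          d = at n (u , j)

      alike-present : ∀ {p p′} → Alike lo hi p p′ → Present n p ⇔ Present (suc n) p′
      alike-present (alike {i = i} {w} sh) rewrite sym (shift-zone 1≤lo lo<hi hi≤n sh) =
        mk⇔ (λ (le , f) → to (shift-≤ lo≤n sh) le , f) (λ (le , f) → from (shift-≤ lo≤n sh) le , f)
        where lo≤n = <⇒≤ (≤-trans lo<hi hi≤n)

    private
      point≡ : ∀ {x y} → (x ≡ y) ⇔ (px (M.point x) ≡ px (M.point y))
      point≡ = mk⇔ (cong (px ∘ M.point)) (M.point-injective ∘ px-injective)

      point≡′ : ∀ {x y} → (x ≡ y) ⇔ (px (M′.point x) ≡ px (M′.point y))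
      point≡′ = mk⇔ (cong (px ∘ M′.point)) (M′.point-injective ∘ px-injective)

    close-refine : ∀ {r m} {ρ : Fin m → Fin M.size} {ρ′ : Fin m → Fin M′.size} {lo hi lo′ hi′ x x′} →
      lo ≤ lo′ → lo′ + gap r ≤ hi′ → hi′ ≤ hi → 1 ≤ lo → hi ≤ n →
      (∀ i → Alike lo hi (M.point (ρ i)) (M′.point (ρ′ i))) → Alike lo′ hi′ (M.point x) (M′.point x′) →
      Close r (extend ρ x) (extend ρ′ x′)
    close-refine l w h 1≤ ≤n pts al = close (≤-trans 1≤ l) w (≤-trans h ≤n)
      λ { zero → al ; (suc i) → alike-narrow l h (pts i) }

    keepLeft : ∀ {lo hi r t} → lo + gap (suc r) ≤ hi → lo + gap r ≤ t →
      ∃ λ hi′ → lo + gap r ≤ hi′ × hi′ ≤ hi × hi′ ≤ t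
    -- The minimum covers a choice beyond the run, which leaves all of the run free.
    keepLeft {lo} {hi} {r} {t} w le = t ⊓ hi , ⊓-glb le
      (≤-trans (+-monoʳ-≤ lo (m≤n⇒m≤1+n (m≤m+n (gap r) (gap r)))) w) , m⊓n≤n t hi , m⊓n≤m t hi

    keepRight : ∀ {lo hi r t} → lo + gap (suc r) ≤ hi → t ≤ lo + gap r →
      ∃ λ lo′ → lo ≤ lo′ × lo′ + gap r ≤ hi × t < lo′
    keepRight {lo} {hi} {r} {t} w le = suc (lo + gap r) , m≤n⇒m≤1+n (m≤m+n lo (gap r)) , le′ , s≤s le
      where
        open ≤-Reasoning
        le′ : suc (lo + gap r) + gap r ≤ hi
        le′ = begin
          suc (lo + gap r) + gap r    ≡⟨ cong suc (+-assoc lo (gap r) (gap r)) ⟩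
          suc (lo + (gap r + gap r))  ≡⟨ sym (+-suc lo _) ⟩
          lo + gap (suc r)            ≤⟨ w ⟩
          hi                          ∎

    backAndForth : BackAndForth M.perm M′.perm Close
    backAndForth = record
      { ≐-resp = λ { {r} (close l w h pts) i j →
          ⇔-sym point≡′ ⇔-∘ (proj₂ (alike-px l (wide⇒< r w) h (pts i) (pts j)) ⇔-∘ point≡) }
      ; <₁-resp = λ { {r} (close l w h pts) i j →
          ⇔-sym (M′.x-order _ _) ⇔-∘ (proj₁ (alike-px l (wide⇒< r w) h (pts i) (pts j)) ⇔-∘ M.x-order _ _) }
      ; <₂-resp = λ { {r} (close l w h pts) i j →
          ⇔-sym (M′.y-order _ _) ⇔-∘ (proj₁ (alike-py l (wide⇒< r w) h (pts i) (pts j)) ⇔-∘ M.y-order _ _) }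
      ; forth = forth
      ; back = back
      }
      where
        forth : ∀ {r m} {ρ : Fin m → Fin M.size} {ρ′ : Fin m → Fin M′.size} → Close (suc r) ρ ρ′ →
          ∀ x → ∃ λ x′ → Close r (extend ρ x) (extend ρ′ x′)
        forth {r} (close {lo} {hi} l w h pts) x with M.point x in eq | M.isPresent x
        ... | (t , i) , v | pr with ≤-total (lo + gap r) t
        ... | inj₁ le =
          let hi′ , w′ , hi′≤hi , hi′≤t = keepLeft {r = r} w le
              al = alike (above hi′≤t)
              x′ , eq′ = M′.index (to (alike-present l (wide⇒< r w′) (≤-trans hi′≤hi h) al) pr)
          in x′ , close-refine ≤-refl w′ hi′≤hi l h pts (subst₂ (Alike lo hi′) (sym eq) (sym eq′) al)
        ... | inj₂ le =
          let lo′ , lo≤lo′ , w′ , t<lo′ = keepRight {r = r} w le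
              al = alike (below t<lo′)
              x′ , eq′ = M′.index (to (alike-present (≤-trans l lo≤lo′) (wide⇒< r w′) h al) pr)
          in x′ , close-refine lo≤lo′ w′ ≤-refl l h pts (subst₂ (Alike lo′ hi) (sym eq) (sym eq′) al)

        back : ∀ {r m} {ρ : Fin m → Fin M.size} {ρ′ : Fin m → Fin M′.size} → Close (suc r) ρ ρ′ →
          ∀ x′ → ∃ λ x → Close r (extend ρ x) (extend ρ′ x′)
        back {r} (close {lo} {hi} l w h pts) x′ with M′.point x′ in eq | M′.isPresent x′
        -- Beyond this bound the column counts as shifted, so it is a successor and is answered by
        -- its predecessor.
        ... | (t′ , i) , v | pr with t′ ≤? lo + gap r
        back {r} (close {lo} {hi} l w h pts) x′ | (zero , i) , v | pr | no nle = contradiction z≤n nle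
        back {r} (close {lo} {hi} l w h pts) x′ | (suc t , i) , v | pr | no nle =
          let hi′ , w′ , hi′≤hi , hi′≤t = keepLeft {r = r} w (s≤s⁻¹ (≰⇒> nle))
              al = alike (above hi′≤t)
              x , eq′ = M.index (from (alike-present l (wide⇒< r w′) (≤-trans hi′≤hi h) al) pr)
          in x , close-refine ≤-refl w′ hi′≤hi l h pts (subst₂ (Alike lo hi′) (sym eq′) (sym eq) al)
        back {r} (close {lo} {hi} l w h pts) x′ | (t′ , i) , v | pr | yes le =
          let lo′ , lo≤lo′ , w′ , t<lo′ = keepRight {r = r} w le
              al = alike (below t<lo′)
              x , eq′ = M.index (from (alike-present (≤-trans l lo≤lo′) (wide⇒< r w′) h al) pr)
          in x , close-refine lo≤lo′ w′ ≤-refl l h pts (subst₂ (Alike lo′ hi) (sym eq′) (sym eq) al)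

    ⊨-insertion : ∀ φ → suc (gap (rank φ)) ≤ n → (M.perm ⊨ φ) ⇔ (M′.perm ⊨ φ)
    ⊨-insertion φ le = mk⇔ (trans (sym same)) (trans same)
      where
        same : sat M.perm (λ ()) φ ≡ sat M′.perm (λ ()) φ
        -- Before the first move all middle columns are free.
        same = sat-resp backAndForth φ ≤-refl (close {lo = 1} {hi = n} (s≤s z≤n) le ≤-refl λ ())

-- Finite subsets and increasing maps of finite sets.

least : ∀ {n} {P : Fin n → Set} → Decidable P → ∃ P → ∃ λ l → P l × ∀ x → P x → toℕ l ≤ toℕ x
least {suc n} P? (a , pa) with P? zero
... | yes p0 = zero , p0 , λ _ _ → z≤n
least {suc n} P? (zero , pa) | no ¬p0 = contradiction pa ¬p0
least {suc n} P? (suc a , pa) | no ¬p0 =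
  let l , pl , min = least (P? ∘ suc) (a , pa)
  in suc l , pl , λ { zero p → contradiction p ¬p0 ; (suc x) p → s≤s (min x p) }

greatest : ∀ {n} {P : Fin n → Set} → Decidable P → ∃ P → ∃ λ g → P g × ∀ x → P x → toℕ x ≤ toℕ g
greatest {suc n} P? (a , pa) with any? (P? ∘ suc)
... | yes e =
  let g , pg , max = greatest (P? ∘ suc) e
  in suc g , pg , λ { zero _ → z≤n ; (suc x) p → s≤s (max x p) }
greatest {suc n} P? (zero , pa) | no ¬e = zero , pa , λ { zero _ → z≤n ; (suc x) p → contradiction (x , p) ¬e }
greatest {suc n} P? (suc a , pa) | no ¬e = contradiction (a , pa) ¬e

None One Many : ∀ {n} → (Fin n → Set) → Set
None P = ∀ a → ¬ P a
One P = ∃ λ a → P a × ∀ b → P b → b ≡ a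
Many P = ∃₂ λ a b → a ≢ b × P a × P b

-- Interval arguments need two points in the set. The cases of no point and of one point always
-- require separate reasons.
none-one-many : ∀ {n} {P : Fin n → Set} → Decidable P → None P ⊎ One P ⊎ Many P
none-one-many P? with any? P?
... | no ¬e = inj₁ λ a p → ¬e (a , p)
... | yes (a , pa) with any? (λ b → P? b ×-dec ¬? (b ≟ᶠ a))
...   | yes (b , pb , b≢a) = inj₂ (inj₂ (b , a , b≢a , pb , pa))
...   | no ¬e = inj₂ (inj₁ (a , pa , λ b pb → decidable-stable (b ≟ᶠ a) λ b≢a → ¬e (b , pb , b≢a)))

third : ∀ {n} → 3 ≤ n → (a b : Fin n) → ∃ λ c → c ≢ a × c ≢ b
third (s≤s (s≤s (s≤s _))) zero zero = suc zero , (λ ()) , λ ()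
third (s≤s (s≤s (s≤s _))) zero (suc zero) = suc (suc zero) , (λ ()) , λ ()
third (s≤s (s≤s (s≤s _))) zero (suc (suc b)) = suc zero , (λ ()) , λ ()
third (s≤s (s≤s (s≤s _))) (suc zero) zero = suc (suc zero) , (λ ()) , λ ()
third (s≤s (s≤s (s≤s _))) (suc (suc a)) zero = suc zero , (λ ()) , λ ()
third (s≤s (s≤s (s≤s _))) (suc a) (suc b) = zero , (λ ()) , λ ()

increasing-lower : ∀ {m} c (f : Fin m → ℕ) → Increasing f → (∀ i → c ≤ f i) → ∀ i → toℕ i + c ≤ f i
increasing-lower c f inc low zero = low zero
increasing-lower c f inc low (suc i) = subst (_≤ f (suc i)) (+-suc (toℕ i) c)
  (increasing-lower (suc c) (f ∘ suc) (λ a b lt → inc (suc a) (suc b) (s≤s lt))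
    (λ a → ≤-trans (s≤s (low zero)) (inc zero (suc a) (s≤s z≤n))) i)

-- A subtraction-free form of `f i ≤ K - (m - i)`: the `m - i` values from index `i` on are distinct
-- and below `K`.
increasing-upper : ∀ {m} K (f : Fin m → ℕ) → Increasing f → (∀ i → f i < K) → ∀ i → f i + m ≤ K + toℕ i
increasing-upper {suc zero} K f inc up zero =
  subst₂ _≤_ (+-comm 1 (f zero)) (sym (+-identityʳ K)) (up zero)
increasing-upper {suc (suc m)} K f inc up zero = begin
  f zero + suc (suc m)     ≡⟨ +-suc (f zero) (suc m) ⟩
  suc (f zero) + suc m     ≤⟨ +-monoˡ-≤ (suc m) (inc zero (suc zero) (s≤s z≤n)) ⟩
  f (suc zero) + suc m     ≤⟨ increasing-upper K (f ∘ suc) (λ a b lt → inc (suc a) (suc b) (s≤s lt)) (up ∘ suc) zero ⟩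
  K + 0                    ∎
  where open ≤-Reasoning
increasing-upper {suc m} K f inc up (suc i) = subst₂ _≤_ (sym (+-suc (f (suc i)) m)) (sym (+-suc K (toℕ i)))
  (s≤s (increasing-upper K (f ∘ suc) (λ a b lt → inc (suc a) (suc b) (s≤s lt)) (up ∘ suc) i))

increasing-endo : ∀ {m} (f : Fin m → Fin m) → Increasing (toℕ ∘ f) → ∀ i → f i ≡ i
increasing-endo {m} f inc i = toℕ-injective (≤-antisym
  (+-cancelʳ-≤ m (toℕ (f i)) (toℕ i) (subst (toℕ (f i) + m ≤_) (+-comm m (toℕ i))
    (increasing-upper m (toℕ ∘ f) inc (toℕ<n ∘ f) i)))
  (subst (_≤ toℕ (f i)) (+-identityʳ (toℕ i)) (increasing-lower 0 (toℕ ∘ f) inc (λ _ → z≤n) i)))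

-- Simple permutations: intervals, sums and skew sums.

module Simplicity {k : ℕ} (α : Perm k) (simple : Simple α) where

  pos val : Fin k → ℕ
  pos = toℕ
  val a = toℕ (α ⟨$⟩ʳ a)

  val-injective : ∀ {a b} → val a ≡ val b → a ≡ b
  val-injective = perm-injective α ∘ toℕ-injective

  module _ {P : Fin k → Set} (P? : Decidable P) where

    -- Simplicity for decidable sets instead of blocks. Convexity in position makes `P` the block
    -- from its first to its last point, and convexity in value makes this block an interval.
    no-interval : Many P → ∃ (¬_ ∘ P) →
      (∀ x y z → P x → P y → ¬ P z → pos x < pos z → ¬ pos z < pos y) →
      (∀ x y z → P x → P y → ¬ P z → val x < val z → ¬ val z < val y) → ⊥
    no-interval (a , b , a≢b , pa , pb) (c , ¬pc) xc yc =
      simple (pos l) ℓ 2≤ℓ ℓ<k (subst (_≤ k) (sym l+ℓ) (toℕ<n g)) λ x y p xi yi pi (lt , gt) →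
        yc x y p (inside x xi) (inside y yi) (λ pp → pi (min p pp , subst (pos p <_) (sym l+ℓ) (s≤s (max p pp)))) lt gt
      where
        L = least P? (a , pa)
        G = greatest P? (a , pa)
        l = proj₁ L
        g = proj₁ G
        min = proj₂ (proj₂ L)
        max = proj₂ (proj₂ G)
        l≤g : pos l ≤ pos g
        l≤g = min g (proj₁ (proj₂ G))
        ℓ = suc (pos g ∸ pos l)
        l+ℓ : pos l + ℓ ≡ suc (pos g)
        l+ℓ = trans (+-suc (pos l) _) (cong suc (m+[n∸m]≡n l≤g))
        l<g : pos l < pos g
        l<g with m≤n⇒m<n∨m≡n l≤g
        ... | inj₁ lt = lt
        ... | inj₂ eq = contradiction (trans (pin a pa) (sym (pin b pb))) a≢b
          where
            pin : ∀ x → P x → x ≡ l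
            pin x px = toℕ-injective (≤-antisym (subst (pos x ≤_) (sym eq) (max x px)) (min x px))
        2≤ℓ : 2 ≤ ℓ
        2≤ℓ = s≤s (m<n⇒0<n∸m l<g)
        inside : ∀ x → InBlock (pos l) ℓ x → P x
        inside x (l≤x , x<) = decidable-stable (P? x) λ ¬px →
          xc l g x (proj₁ (proj₂ L)) (proj₁ (proj₂ G)) ¬px
            (≤∧≢⇒< l≤x λ e → ¬px (subst P (toℕ-injective e) (proj₁ (proj₂ L))))
            (≤∧≢⇒< (s≤s⁻¹ (subst (pos x <_) l+ℓ x<)) λ e → ¬px (subst P (sym (toℕ-injective e)) (proj₁ (proj₂ G))))
        -- The point outside `P` lies before or after the block, so the block is proper.
        ℓ<k : ℓ < k
        ℓ<k with pos c <? pos l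
        ... | yes c<l = ≤-trans (+-monoˡ-≤ ℓ (≤-trans (s≤s z≤n) c<l)) (subst (_≤ k) (sym l+ℓ) (toℕ<n g))
        ... | no c≮l = ≤-trans (s≤s (m≤n+m ℓ (pos l))) (≤-trans (s≤s (≤-trans (≤-reflexive l+ℓ) g<c)) (toℕ<n c))
          where
            g<c : pos g < pos c
            g<c = ≰⇒> λ c≤g → ¬pc (inside c (≮⇒≥ c≮l , subst (pos c <_) (sym l+ℓ) (s≤s c≤g)))

  NonTrivial : (Fin k → Set) → Set
  NonTrivial P = ∃ P × ∃ (¬_ ∘ P)

  module _ (3≤k : 3 ≤ k) where

    -- If `P` has two points, it is an interval. If it has one, `3 ≤ k` leaves two points outside,
    -- and the complement is an interval.
    sum-indecomposable : ∀ {P} → Decidable P → NonTrivial P →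
      (∀ a b → P a → ¬ P b → pos a < pos b × val a < val b) → ⊥
    sum-indecomposable {P} P? ((a , pa) , (b , ¬pb)) sep with none-one-many P?
    ... | inj₁ none = none a pa
    ... | inj₂ (inj₂ many) = no-interval P? many (b , ¬pb)
      (λ x y z px py ¬pz _ lt → <-asym lt (proj₁ (sep y z py ¬pz)))
      (λ x y z px py ¬pz _ lt → <-asym lt (proj₂ (sep y z py ¬pz)))
    ... | inj₂ (inj₁ (a′ , pa′ , uniq)) with third 3≤k a′ b
    ...   | c , c≢a′ , c≢b = no-interval (¬? ∘ P?) (b , c , c≢b ∘ sym , ¬pb , c≢a′ ∘ uniq c) (a , λ ¬pa → ¬pa pa)
      (λ x y z ¬px ¬py ¬¬pz lt _ → <-asym lt (proj₁ (sep z x (decidable-stable (P? z) ¬¬pz) ¬px)))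
      (λ x y z ¬px ¬py ¬¬pz lt _ → <-asym lt (proj₂ (sep z x (decidable-stable (P? z) ¬¬pz) ¬px)))

    skew-indecomposable : ∀ {P} → Decidable P → NonTrivial P →
      (∀ a b → P a → ¬ P b → pos a < pos b × val b < val a) → ⊥
    skew-indecomposable {P} P? ((a , pa) , (b , ¬pb)) sep with none-one-many P?
    ... | inj₁ none = none a pa
    ... | inj₂ (inj₂ many) = no-interval P? many (b , ¬pb)
      (λ x y z px py ¬pz _ lt → <-asym lt (proj₁ (sep y z py ¬pz)))
      (λ x y z px py ¬pz lt _ → <-asym lt (proj₂ (sep x z px ¬pz)))
    ... | inj₂ (inj₁ (a′ , pa′ , uniq)) with third 3≤k a′ b
    ...   | c , c≢a′ , c≢b = no-interval (¬? ∘ P?) (b , c , c≢b ∘ sym , ¬pb , c≢a′ ∘ uniq c) (a , λ ¬pa → ¬pa pa)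
      (λ x y z ¬px ¬py ¬¬pz lt _ → <-asym lt (proj₁ (sep z x (decidable-stable (P? z) ¬¬pz) ¬px)))
      (λ x y z ¬px ¬py ¬¬pz _ lt → <-asym lt (proj₂ (sep z y (decidable-stable (P? z) ¬¬pz) ¬py)))

-- Colourings of inflated skeletons.

≢⇒≡ : ∀ {b c d : Bool} → b ≢ d → c ≢ d → b ≡ c
≢⇒≡ {true} {true} _ _ = refl
≢⇒≡ {false} {false} _ _ = refl
≢⇒≡ {true} {false} {true} p _ = contradiction refl p
≢⇒≡ {true} {false} {false} _ q = contradiction refl q
≢⇒≡ {false} {true} {true} _ q = contradiction refl q
≢⇒≡ {false} {true} {false} p _ = contradiction refl p

module Colouring (T : Table) {k : ℕ} (α : Perm k) (simple : Simple α) (4≤k : 4 ≤ k) where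
  open Table T
  open Grid T α
  open Simplicity α simple

  -- A transversal copy of `α`, that is, one with its points in pairwise different slots, seen at
  -- the level of slots.
  Follows : ℕ → (Fin k → Slot) → Set
  Follows n h = (∀ a b → pos a < pos b → sx (h a) < sx (h b)) ×
                (∀ a b → val a < val b → sy n (h a) < sy n (h b))

  module Following (n : ℕ) (h : Fin k → Slot) (follows : Follows n h) where

    h-x : ∀ {a b} → pos a < pos b → sx (h a) < sx (h b)
    h-x = proj₁ follows _ _

    x-h : ∀ {a b} → sx (h a) < sx (h b) → pos a < pos b
    x-h = reflects pos (sx ∘ h) toℕ-injective (proj₁ follows) _ _

    y-h : ∀ {a b} → sy n (h a) < sy n (h b) → val a < val b
    y-h = reflects val (sy n ∘ h) val-injective (proj₂ follows) _ _

    h-injective : ∀ {a b} → h a ≡ h b → a ≡ b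
    h-injective = increasing-injective (sx ∘ h) (proj₁ follows) ∘ cong sx

    col : Fin k → ℕ
    col = proj₁ ∘ h

    left : ∀ {a b} → col a < col b → pos a < pos b
    left lt = x-h (lex-<ˡ _ _ lt)

  Wild Single : ℕ → Slot → Set
  Wild n s = proj₁ s ≤ n × kind (at n s) ≡ wild
  Single n s = proj₁ s ≤ n × kind (at n s) ≡ single

  -- Wild slots are unconstrained because they offer both colours; a transversal copy is
  -- monochromatic as soon as its single slots agree.
  SkeletonFree : ℕ → (Slot → Bool) → Set
  SkeletonFree n colour = ∀ c h → Follows n h → (∀ a → Occupied n (h a)) →
    ¬ (∀ a → kind (at n (h a)) ≡ single → colour (h a) ≡ c)

  module _ {n : ℕ} (M : Model n) where
    open Model M

    slot : Fin size → Slot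
    slot = proj₁ ∘ point

    copy : (f : Fin k → Fin size) →
      (∀ a b → pos a < pos b → px (point (f a)) < px (point (f b))) →
      (∀ a b → val a < val b → py n (point (f a)) < py n (point (f b))) → Induces α perm f
    copy f x-inc y-inc =
      (λ a b lt → from (x-order (f a) (f b)) (x-inc a b lt)) ,
      λ a b → mk⇔ (mono a b) (reflects val (λ a → toℕ (perm ⟨$⟩ʳ f a)) val-injective mono a b)
      where
        mono : ∀ a b → val a < val b → toℕ (perm ⟨$⟩ʳ f a) < toℕ (perm ⟨$⟩ʳ f b)
        mono a b lt = from (y-order (f a) (f b)) (y-inc a b lt)

    origin : Fin k
    origin = fromℕ< (≤-trans (s≤s z≤n) 4≤k)

    lone : ∀ {s} → Single n s → ∃ λ x → slot x ≡ s
    lone {s} (le , κ) = let x , eq = index {s , origin} (le , inj₂ (κ , toℕ-fromℕ< _)) in x , cong proj₁ eq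

    paint : (Fin size → Bool) → ∀ s → Single n s → Bool
    paint red s σ = red (proj₁ (lone {s} σ))

    module _ {red : Fin size → Bool} (free : MonoFree α perm red) where

      no-transversal : ∀ h → Follows n h → ∀ c → ¬ (∀ a → ∃ λ x → slot x ≡ h a × red x ≡ c)
      no-transversal h (h-x , h-y) c pick = free c f
        (copy f (λ a b lt → lex-<ˡ _ _ (subst₂ (λ s s′ → sx s < sx s′) (sym (f-slot a)) (sym (f-slot b)) (h-x a b lt)))
                (λ a b lt → lex-<ˡ _ _ (subst₂ (λ s s′ → sy n s < sy n s′) (sym (f-slot a)) (sym (f-slot b)) (h-y a b lt))))
        (λ a → proj₂ (proj₂ (pick a)))
        where
          f : Fin k → Fin size
          f a = proj₁ (pick a)
          f-slot : ∀ a → slot (f a) ≡ h a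
          f-slot a = proj₁ (proj₂ (pick a))

      -- A slot without colour `c` would contain a monochromatic copy of `α`, namely the inserted
      -- one.
      wild-bichromatic : ∀ {s} → Wild n s → ∀ c → ∃ λ x → slot x ≡ s × red x ≡ c
      wild-bichromatic {s} (le , κ) c with any? (λ w → red (f w) ≟ᵇ c)
        where
          f : Fin k → Fin size
          f w = proj₁ (index {s , w} (le , inj₁ κ))
      ... | yes (w , eq) = let x , e = index {s , w} (le , inj₁ κ) in x , cong proj₁ e , eq
      ... | no ¬e = contradiction (λ w → ≢⇒≡ (¬e ∘ (w ,_)) (¬e ∘ (origin ,_)))
              (free (red (f origin)) f (copy f
                (λ a b lt → subst₂ (λ p q → px p < px q) (sym (f-point a)) (sym (f-point b)) (lex-<ʳ (sx s) lt))
                (λ a b lt → subst₂ (λ p q → py n p < py n q) (sym (f-point a)) (sym (f-point b)) (lex-<ʳ (sy n s) lt))))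
        where
          f : Fin k → Fin size
          f w = proj₁ (index {s , w} (le , inj₁ κ))
          f-point : ∀ w → point (f w) ≡ (s , w)
          f-point w = proj₂ (index {s , w} (le , inj₁ κ))

      -- The wild slots offer points of either colour, so equal colours at a and b
      -- could be completed to a monochromatic copy.
      forced-≢ : ∀ h → Follows n h → ∀ a b → (∀ c → c ≢ a → c ≢ b → Wild n (h c)) →
        ∀ x y → slot x ≡ h a → slot y ≡ h b → red x ≢ red y
      forced-≢ h h-follows a b wilds x y x-slot y-slot eq = no-transversal h h-follows (red x) pick
        where
          pick : ∀ c → ∃ λ z → slot z ≡ h c × red z ≡ red x
          pick c with c ≟ᶠ a | c ≟ᶠ b
          ... | yes refl | _ = x , x-slot , refl
          ... | no _ | yes refl = y , y-slot , sym eq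
          ... | no c≢a | no c≢b = wild-bichromatic (wilds c c≢a c≢b) (red x)

    module _ (colour : Slot → Bool) where

      -- In a wild slot the first point gets one colour and all others the second, so that the
      -- inserted copy is not monochromatic.
      pointColour : Point → Bool
      pointColour (s , w) with kind (at n s)
      ... | wild = does (toℕ w ≟ 0)
      ... | _ = colour s

      wild-colour : ∀ s w → kind (at n s) ≡ wild → pointColour (s , w) ≡ does (toℕ w ≟ 0)
      wild-colour s w eq rewrite eq = refl

      single-colour : ∀ s w → kind (at n s) ≡ single → pointColour (s , w) ≡ colour s
      single-colour s w eq rewrite eq = refl

      _≟ˢ_ : (s s′ : Slot) → Dec (s ≡ s′)
      _≟ˢ_ = ≡-dec _≟_ _≟ᶠ_

      -- In an inflation of a skeleton, a copy of the simple permutation α is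
      -- either transversal or contained in one block.
      skeletonFree⇒monoFree : SeparatedRows n → SkeletonFree n colour → MonoFree α perm (pointColour ∘ point)
      skeletonFree⇒monoFree sep free c f (f-inc , f-val) mono
        with any? (λ a → any? (λ b → ¬? (a ≟ᶠ b) ×-dec (slot (f a) ≟ˢ slot (f b))))
      ... | no inj = free c h (h-x , h-y) (present⇒occupied ∘ isPresent ∘ f)
              (λ a κ → trans (sym (single-colour (h a) _ κ)) (mono a))
        where
          h = slot ∘ f
          distinct : ∀ a b → a ≢ b → h a ≢ h b
          distinct a b a≢b eq = inj (a , b , a≢b , eq)
          h-x : ∀ a b → pos a < pos b → sx (h a) < sx (h b)
          h-x a b lt with to (lex-< (sx (h a)) (sx (h b)) _ _) (to (x-order (f a) (f b)) (f-inc a b lt))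
          ... | inj₁ lt′ = lt′
          ... | inj₂ (eq , _) = contradiction (cong proj₁ (px-injective {h a , origin} {h b , origin}
                  (cong (λ u → lex u origin) eq))) (distinct a b (<⇒≢ lt ∘ cong toℕ))
          h-y : ∀ a b → val a < val b → sy n (h a) < sy n (h b)
          h-y a b lt with to (lex-< (sy n (h a)) (sy n (h b)) _ _) (to (y-order (f a) (f b)) (to (f-val a b) lt))
          ... | inj₁ lt′ = lt′
          ... | inj₂ (eq , _) = contradiction
                  (sep (present⇒occupied (isPresent (f a))) (present⇒occupied (isPresent (f b))) eq)
                  (distinct a b (<⇒≢ lt ∘ cong val))
      ... | yes (a₀ , b₀ , a₀≢b₀ , same) = inBlock (kind (at n s₀)) refl
        where
          s₀ = slot (f a₀)
          h = slot ∘ f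
          px-inc : ∀ a b → pos a < pos b → px (point (f a)) < px (point (f b))
          px-inc a b lt = to (x-order (f a) (f b)) (f-inc a b lt)
          py-inc : ∀ a b → val a < val b → py n (point (f a)) < py n (point (f b))
          py-inc a b lt = to (y-order (f a) (f b)) (to (f-val a b) lt)
          allIn : ∀ a → h a ≡ s₀
          allIn a = decidable-stable (h a ≟ˢ s₀) λ out →
            no-interval (λ z → h z ≟ˢ s₀) (a₀ , b₀ , a₀≢b₀ , refl , sym same) (a , out)
              (λ x y z px≡ py≡ out lt gt → out (cong proj₁ (px-injective {h z , origin} {s₀ , origin}
                (cong (λ u → lex u origin) (≤-antisym
                  (subst (λ s → sx (h z) ≤ sx s) py≡ (lex-≤ˡ _ _ _ _ (px-inc z y gt)))
                  (subst (λ s → sx s ≤ sx (h z)) px≡ (lex-≤ˡ _ _ _ _ (px-inc x z lt))))))))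
              (λ x y z px≡ py≡ out lt gt → out
                (sep (present⇒occupied (isPresent (f z))) (present⇒occupied (isPresent (f a₀))) (≤-antisym
                  (subst (λ s → sy n (h z) ≤ sy n s) py≡ (lex-≤ˡ _ _ _ _ (py-inc z y gt)))
                  (subst (λ s → sy n s ≤ sy n (h z)) px≡ (lex-≤ˡ _ _ _ _ (py-inc x z lt))))))
          w : Fin k → Fin k
          w a = proj₂ (point (f a))
          w-inc : Increasing (toℕ ∘ w)
          w-inc a b lt with to (lex-< (sx (h a)) (sx (h b)) _ _) (px-inc a b lt)
          ... | inj₁ lt′ = contradiction (subst₂ (λ s s′ → sx s < sx s′) (allIn a) (allIn b) lt′) (<-irrefl refl)
          ... | inj₂ (_ , lt′) = lt′
          second : Fin k
          second = fromℕ< (≤-trans (s≤s (s≤s z≤n)) 4≤k)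
          origin<second : pos origin < pos second
          origin<second = subst₂ _<_ (sym (toℕ-fromℕ< _)) (sym (toℕ-fromℕ< _)) (s≤s z≤n)
          inBlock : ∀ κ → kind (at n s₀) ≡ κ → ⊥
          inBlock vacant eq = proj₂ (present⇒occupied (isPresent (f a₀))) eq
          -- A copy of `α` inside a block of `k` points is the whole block, and its first two points
          -- differ in colour.
          inBlock wild eq = contradiction (trans (sym (colour-of origin)) (colour-of second)) (≢-does)
            where
              colour-of : ∀ a → c ≡ does (toℕ a ≟ 0)
              colour-of a = trans (sym (mono a)) (trans (wild-colour (h a) (w a)
                (subst (λ s → kind (at n s) ≡ wild) (sym (allIn a)) eq))
                (cong (λ v → does (toℕ v ≟ 0)) (increasing-endo w w-inc a)))
              ≢-does : does (toℕ origin ≟ 0) ≢ does (toℕ second ≟ 0)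
              ≢-does e with () ← trans (sym (dec-true (toℕ origin ≟ 0) (toℕ-fromℕ< _)))
                (trans e (dec-false (toℕ second ≟ 0) (λ z → contradiction (subst (pos origin <_) z origin<second) λ ())))
          inBlock single eq = <-irrefl (trans (zero-w origin) (sym (zero-w second))) (w-inc origin second origin<second)
            where
              zero-w : ∀ a → toℕ (w a) ≡ 0
              zero-w a with proj₂ (isPresent (f a))
              ... | inj₁ κ with () ← trans (sym (subst (λ s → kind (at n s) ≡ single) (sym (allIn a)) eq)) κ
              ... | inj₂ (_ , z) = z

  -- The grid with even `n` and the one with a further column satisfy the same sentences of the rank
  -- of `φ`, but only the latter belongs to the class.
  notDefinable : (∀ n → 1 ≤ n → SeparatedRows n) →
    (∀ m → 1 ≤ m → (M : Model (m + m)) → ∀ red → ¬ MonoFree α (Model.perm M) red) →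
    (∀ m → 1 ≤ m → ∃ (SkeletonFree (suc (m + m)))) →
    ¬ FODefinable (Av α ⊙ Av α)
  notDefinable sep uncolourable colourable (φ , defines) =
    let red , free = ⊙⇒monoFree α (Model.perm M) (to (defines _ (Model.perm M))
          (from (Insertion.⊨-insertion T α M M′ φ (m≤m+n m m)) (from (defines _ (Model.perm M′)) member)))
    in uncolourable m (s≤s z≤n) M red free
    where
      -- `⊨-insertion` asks for at least `suc (gap (rank φ))`, and `m + m` exceeds `m`.
      m = suc (gap (rank φ))
      sep′ = sep (suc (m + m)) (s≤s z≤n)
      M = model (m + m) (sep (m + m) (s≤s z≤n))
      M′ = model (suc (m + m)) sep′
      colour = proj₁ (colourable m (s≤s z≤n))
      member : (Av α ⊙ Av α) (Model.perm M′)
      member = monoFree⇒⊙ α (Model.perm M′) (pointColour M′ colour ∘ Model.point M′ ,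
        skeletonFree⇒monoFree M′ colour sep′ (proj₂ (colourable m (s≤s z≤n))))

-- Zones, parity and maps that skip a place.

zone-< : ∀ {n t} → t < n → zone n t ≢ last
zone-< {n} {suc t} t<n eq with n ≟ suc t
... | yes refl = <-irrefl refl t<n
zone-< {n} {suc t} t<n () | no _

zone-last : ∀ {n} → 1 ≤ n → zone n n ≡ last
zone-last {suc n} _ with suc n ≟ suc n
... | yes _ = refl
... | no ne = contradiction refl ne

zone-suc : ∀ n t → zone n (suc t) ≢ first
zone-suc n t eq with n ≟ suc t
zone-suc n t () | yes _
zone-suc n t () | no _

isEven : ℕ → Bool
isEven zero = true
isEven (suc n) = not (isEven n)

isEven-double : ∀ m → isEven (m + m) ≡ true
isEven-double zero = refl
isEven-double (suc m) rewrite +-suc m m | isEven-double m = refl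

alternating : (c : ℕ → Bool) → ∀ {N} → (∀ t → t ≤ N → c t ≢ c (suc t)) → ∀ j → j + j ≤ suc N → c (j + j) ≡ c 0
alternating c alt zero _ = refl
alternating c alt (suc j) le rewrite +-suc j j = trans
  (≢⇒≡ (alt (suc (j + j)) (s≤s⁻¹ le) ∘ sym) (alt (j + j) (≤-trans (n≤1+n _) (s≤s⁻¹ le))))
  (alternating c alt j (≤-trans (n≤1+n _) (≤-trans (n≤1+n _) le)))

punchIn-< : ∀ {n} (j : Fin (suc n)) i → toℕ i < toℕ j → toℕ (punchIn j i) ≡ toℕ i
punchIn-< (suc j) zero _ = refl
punchIn-< (suc j) (suc i) (s≤s lt) = cong suc (punchIn-< j i lt)

punchIn-≥ : ∀ {n} (j : Fin (suc n)) i → toℕ j ≤ toℕ i → toℕ (punchIn j i) ≡ suc (toℕ i)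
punchIn-≥ zero i _ = refl
punchIn-≥ (suc j) (suc i) (s≤s le) = cong suc (punchIn-≥ j i le)

punchIn-strict : ∀ {n} (j : Fin (suc n)) a b → toℕ a < toℕ b → toℕ (punchIn j a) < toℕ (punchIn j b)
punchIn-strict j a b lt = ≤∧≢⇒< (punchIn-mono-≤ j a b (<⇒≤ lt))
  (<⇒≢ lt ∘ cong toℕ ∘ punchIn-injective j a b ∘ toℕ-injective)

<-≡ : ∀ {a b c : ℕ} → c ≡ b → a < b → a < c
<-≡ refl lt = lt

≡-< : ∀ {a b c : ℕ} → a ≡ b → b < c → a < c
≡-< refl lt = lt

-- The chain closed by a hook.

module Hooked {k : ℕ} (α : Perm k) (simple : Simple α) (4≤k : 4 ≤ k) (L T : Fin k)
    (pos-L : toℕ L ≡ 0) (val-L : suc (suc (toℕ (α ⟨$⟩ʳ L))) ≡ k)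
    (pos-T : suc (suc (toℕ T)) ≡ k) (val-T : suc (toℕ (α ⟨$⟩ʳ T)) ≡ k) where
  open Simplicity α simple

  -- The point in the place of `T` of column `t` is moved to row `t + 1`, where it serves as `L` of
  -- the next column; so only column 0 has an `L` of its own. The hook stands in column 0 and in row
  -- `n`: it serves as `T` for column 0 and as `L` for column `n`. Level `k` is an extra one that
  -- lifts the head of column `n` above the hook.
  leftCell topCell hookCell : Zone → Cell (suc k)
  leftCell first = cell single own (inject₁ (α ⟨$⟩ʳ L))
  leftCell _ = cell vacant own (inject₁ (α ⟨$⟩ʳ L))
  topCell last = cell single own (fromℕ k)
  topCell _ = cell single next (inject₁ (α ⟨$⟩ʳ L))
  hookCell first = cell single top (inject₁ (α ⟨$⟩ʳ T))
  hookCell _ = cell vacant own (inject₁ (α ⟨$⟩ʳ T))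

  role : Zone → Fin k → Cell (suc k)
  role z i with i ≟ᶠ L | i ≟ᶠ T
  ... | yes _ | _ = leftCell z
  ... | no _ | yes _ = topCell z
  ... | no _ | no _ = cell wild own (inject₁ (α ⟨$⟩ʳ i))

  -- An extra place just to the right of that of `T`, so that the hook can replace `T` in column 0;
  -- `ι` skips it.
  h₀ : Fin (suc k)
  h₀ = suc T

  ι : Fin k → Fin (suc k)
  ι = punchIn h₀

  table : Table
  table = record { width = suc k ; height = suc k ; entry = entry }
    where
      entry : Zone → Fin (suc k) → Cell (suc k)
      entry z j with h₀ ≟ᶠ j
      ... | yes _ = hookCell z
      ... | no ne = role z (punchOut ne)

  open Grid table α
  open Colouring table α simple 4≤k

  L≢T : L ≢ T
  L≢T refl = contradiction (trans val-L (sym val-T)) (1+n≢n)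

  at-hook : ∀ n t → at n (t , h₀) ≡ hookCell (zone n t)
  at-hook n t with h₀ ≟ᶠ h₀
  ... | yes _ = refl
  ... | no ne = contradiction refl ne

  at-ι : ∀ n t i → at n (t , ι i) ≡ role (zone n t) i
  at-ι n t i with h₀ ≟ᶠ ι i
  ... | yes eq = contradiction (sym eq) (punchInᵢ≢i h₀ i)
  ... | no ne = cong (role (zone n t)) (trans (punchOut-cong h₀ refl) (punchOut-punchIn h₀))

  role-L : ∀ z → role z L ≡ leftCell z
  role-L z with L ≟ᶠ L
  ... | yes _ = refl
  ... | no ne = contradiction refl ne

  role-T : ∀ z → role z T ≡ topCell z
  role-T z with T ≟ᶠ L | T ≟ᶠ T
  ... | yes eq | _ = contradiction (sym eq) L≢T
  ... | no _ | yes _ = refl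
  ... | no _ | no ne = contradiction refl ne

  role-wild : ∀ z {i} → i ≢ L → i ≢ T → role z i ≡ cell wild own (inject₁ (α ⟨$⟩ʳ i))
  role-wild z {i} i≢L i≢T with i ≟ᶠ L | i ≟ᶠ T
  ... | yes eq | _ = contradiction eq i≢L
  ... | no _ | yes eq = contradiction eq i≢T
  ... | no _ | no _ = refl

  topCell-< : ∀ {z} → z ≢ last → topCell z ≡ cell single next (inject₁ (α ⟨$⟩ʳ L))
  topCell-< {first} _ = refl
  topCell-< {middle} _ = refl
  topCell-< {last} ne = contradiction refl ne

  at-wild : ∀ n t {i} → i ≢ L → i ≢ T → at n (t , ι i) ≡ cell wild own (inject₁ (α ⟨$⟩ʳ i))
  at-wild n t {i} i≢L i≢T = trans (at-ι n t i) (role-wild (zone n t) i≢L i≢T)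

  at-tail : ∀ n → at n (0 , ι L) ≡ cell single own (inject₁ (α ⟨$⟩ʳ L))
  at-tail n = trans (at-ι n 0 L) (role-L first)

  at-arc : ∀ {n t} → t < n → at n (t , ι T) ≡ cell single next (inject₁ (α ⟨$⟩ʳ L))
  at-arc {n} {t} t<n = trans (at-ι n t T) (trans (role-T (zone n t)) (topCell-< (zone-< t<n)))

  at-head : ∀ {n} → 1 ≤ n → at n (n , ι T) ≡ cell single own (fromℕ k)
  at-head {n} 1≤n = trans (at-ι n n T) (trans (role-T (zone n n)) (cong topCell (zone-last 1≤n)))

  -- The single points form the chain 0, …, n + 1 of forced colour changes:
  -- the tail, the arcs from column t to row t + 1, and the head.
  data Element (n : ℕ) : Slot → ℕ → Fin (suc k) → Set where
    box : ∀ {t i} → t ≤ n → i ≢ L → i ≢ T → Element n (t , ι i) t (inject₁ (α ⟨$⟩ʳ i))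
    tail : Element n (0 , ι L) 0 (inject₁ (α ⟨$⟩ʳ L))
    arc : ∀ {t} → t < n → Element n (t , ι T) (suc t) (inject₁ (α ⟨$⟩ʳ L))
    head : Element n (n , ι T) n (fromℕ k)
    hook : Element n (0 , h₀) n (inject₁ (α ⟨$⟩ʳ T))

  record Described (n : ℕ) (s : Slot) : Set where
    constructor described
    field
      {row′} : ℕ
      {level′} : Fin (suc k)
      element : Element n s row′ level′
      sy≡ : sy n s ≡ lex row′ level′

  split : ∀ j → j ≡ h₀ ⊎ ∃ λ i → j ≡ ι i
  split j with h₀ ≟ᶠ j
  ... | yes eq = inj₁ (sym eq)
  ... | no ne = inj₂ (punchOut ne , sym (punchIn-punchOut ne))

  describe : ∀ {n} → 1 ≤ n → ∀ s → Occupied n s → Described n s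
  describe {n} 1≤n (t , j) (t≤n , nv) with split j
  describe {n} 1≤n (zero , j) _ | inj₁ refl =
    described hook (sy-at n (0 , h₀) (at-hook n 0))
  describe {n} 1≤n (suc t , j) (_ , nv) | inj₁ refl =
    contradiction (trans (cong kind (at-hook n (suc t))) (vacant-hook (zone-suc n t))) nv
    where
      vacant-hook : ∀ {z} → z ≢ first → kind (hookCell z) ≡ vacant
      vacant-hook {first} ne = contradiction refl ne
      vacant-hook {middle} _ = refl
      vacant-hook {last} _ = refl
  ... | inj₂ (i , refl) with i ≟ᶠ L | i ≟ᶠ T
  ... | no i≢L | no i≢T = let eq = at-wild n t i≢L i≢T in
    described (box t≤n i≢L i≢T) (sy-at n (t , ι i) eq)
  describe {n} 1≤n (zero , j) _ | inj₂ (i , refl) | yes refl | _ =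
    described tail (sy-at n (0 , ι i) (at-tail n))
  describe {n} 1≤n (suc t , j) (_ , nv) | inj₂ (i , refl) | yes refl | _ =
    contradiction (trans (cong kind (trans (at-ι n (suc t) i) (role-L _))) (vacant-left (zone-suc n t))) nv
    where
      vacant-left : ∀ {z} → z ≢ first → kind (leftCell z) ≡ vacant
      vacant-left {first} ne = contradiction refl ne
      vacant-left {middle} _ = refl
      vacant-left {last} _ = refl
  describe {n} 1≤n (t , j) (t≤n , _) | inj₂ (i , refl) | no _ | yes refl with m≤n⇒m<n∨m≡n t≤n
  ... | inj₁ t<n = described (arc t<n) (sy-at n (t , ι i) (at-arc t<n))
  ... | inj₂ refl = described head (sy-at n (t , ι i) (at-head 1≤n))

  level-top : ∀ a → inject₁ (α ⟨$⟩ʳ a) ≢ fromℕ k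
  level-top a eq = <⇒≢ (toℕ<n (α ⟨$⟩ʳ a)) (trans (sym (toℕ-inject₁ _)) (trans (cong toℕ eq) (toℕ-fromℕ k)))

  level-injective : ∀ {a b} → inject₁ (α ⟨$⟩ʳ a) ≡ inject₁ (α ⟨$⟩ʳ b) → a ≡ b
  level-injective = perm-injective α ∘ inject₁-injective

  separate : ∀ {n s s′ r r′ ℓ ℓ′} → Element n s r ℓ → Element n s′ r′ ℓ′ →
    r ≡ r′ → ℓ ≡ ℓ′ → s ≡ s′
  separate (box _ _ _) (box _ _ _) refl ℓ≡ = cong (λ i → _ , ι i) (level-injective ℓ≡)
  separate (box _ i≢L _) tail _ ℓ≡ = contradiction (level-injective ℓ≡) i≢L
  separate (box _ i≢L _) (arc _) _ ℓ≡ = contradiction (level-injective ℓ≡) i≢L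
  separate (box _ _ _) head _ ℓ≡ = contradiction ℓ≡ (level-top _)
  separate (box _ _ i≢T) hook _ ℓ≡ = contradiction (level-injective ℓ≡) i≢T
  separate tail (box _ i≢L _) _ ℓ≡ = contradiction (sym (level-injective ℓ≡)) i≢L
  separate tail tail _ _ = refl
  separate tail head _ ℓ≡ = contradiction ℓ≡ (level-top _)
  separate tail hook _ ℓ≡ = contradiction (level-injective ℓ≡) L≢T
  separate (arc _) (box _ i≢L _) _ ℓ≡ = contradiction (sym (level-injective ℓ≡)) i≢L
  separate (arc _) (arc _) refl _ = refl
  separate (arc _) head _ ℓ≡ = contradiction ℓ≡ (level-top _)
  separate (arc _) hook _ ℓ≡ = contradiction (level-injective ℓ≡) L≢T
  separate head (box _ _ _) _ ℓ≡ = contradiction (sym ℓ≡) (level-top _)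
  separate head tail _ ℓ≡ = contradiction (sym ℓ≡) (level-top _)
  separate head (arc _) _ ℓ≡ = contradiction (sym ℓ≡) (level-top _)
  separate head head _ _ = refl
  separate head hook _ ℓ≡ = contradiction (sym ℓ≡) (level-top _)
  separate hook (box _ _ i≢T) _ ℓ≡ = contradiction (sym (level-injective ℓ≡)) i≢T
  separate hook tail _ ℓ≡ = contradiction (sym (level-injective ℓ≡)) L≢T
  separate hook (arc _) _ ℓ≡ = contradiction (sym (level-injective ℓ≡)) L≢T
  separate hook head _ ℓ≡ = contradiction ℓ≡ (level-top _)
  separate hook hook _ _ = refl

  separated : ∀ n → 1 ≤ n → SeparatedRows n
  separated n 1≤n {s} {s′} occ occ′ eq with describe 1≤n s occ | describe 1≤n s′ occ′
  ... | described e sy₁ | described e′ sy₂ =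
    let r≡ , ℓ≡ = lex-≡ _ _ _ _ (trans (sym sy₁) (trans eq sy₂)) in separate e e′ r≡ ℓ≡

  val≤T : ∀ a → val a ≤ val T
  val≤T a = s≤s⁻¹ (subst (val a <_) (sym val-T) (toℕ<n (α ⟨$⟩ʳ a)))

  val<T : ∀ {a} → a ≢ T → val a < val T
  val<T {a} a≢T = ≤∧≢⇒< (val≤T a) (a≢T ∘ val-injective)

  val≤L : ∀ {a} → a ≢ T → val a ≤ val L
  val≤L {a} a≢T = s≤s⁻¹ (s≤s⁻¹ (subst (suc (suc (val a)) ≤_) (sym (trans val-L (sym val-T))) (s≤s (val<T a≢T))))

  val<L : ∀ {a} → a ≢ L → a ≢ T → val a < val L
  val<L a≢L a≢T = ≤∧≢⇒< (val≤L a≢T) (a≢L ∘ val-injective)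

  L≤ : ∀ a → pos L ≤ pos a
  L≤ a = subst (_≤ pos a) (sym pos-L) z≤n

  L< : ∀ {a} → a ≢ L → pos L < pos a
  L< {a} a≢L = ≤∧≢⇒< (L≤ a) (a≢L ∘ sym ∘ toℕ-injective)

  inject-mono : ∀ {a b} → val a < val b → toℕ (inject₁ (α ⟨$⟩ʳ a)) < toℕ (inject₁ (α ⟨$⟩ʳ b))
  inject-mono {a} {b} = subst₂ _<_ (sym (toℕ-inject₁ (α ⟨$⟩ʳ a))) (sym (toℕ-inject₁ (α ⟨$⟩ʳ b)))

  node : ℕ → Slot
  node zero = 0 , ι L
  node (suc t) = t , ι T

  node-single : ∀ {n} → 1 ≤ n → ∀ t → t ≤ suc n → Single n (node t)
  node-single {n} 1≤n zero _ = z≤n , cong kind (at-tail n)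
  node-single 1≤n (suc t) (s≤s t≤n) with m≤n⇒m<n∨m≡n t≤n
  ... | inj₁ t<n = t≤n , cong kind (at-arc t<n)
  ... | inj₂ refl = t≤n , cong kind (at-head 1≤n)

  hook-single : ∀ n → Single n (0 , h₀)
  hook-single n = z≤n , cong kind (at-hook n 0)

  sy-node : ∀ {n} t → t ≤ n → sy n (node t) ≡ lex t (inject₁ (α ⟨$⟩ʳ L))
  sy-node {n} zero _ = sy-at n (0 , ι L) (at-tail n)
  sy-node {n} (suc t) t<n = sy-at n (t , ι T) (at-arc t<n)

  sy-wild : ∀ n t {i} → i ≢ L → i ≢ T → sy n (t , ι i) ≡ lex t (inject₁ (α ⟨$⟩ʳ i))
  sy-wild n t {i} i≢L i≢T = sy-at n (t , ι i) (at-wild n t i≢L i≢T)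

  sy-hook : ∀ n → sy n (0 , h₀) ≡ lex n (inject₁ (α ⟨$⟩ʳ T))
  sy-hook n = sy-at n (0 , h₀) (at-hook n 0)

  sy-node-above : ∀ {n} → 1 ≤ n → ∀ {t} → t ≤ n → ∀ i → lex t (inject₁ (α ⟨$⟩ʳ i)) < sy n (node (suc t))
  sy-node-above {n} 1≤n {t} t≤n i with m≤n⇒m<n∨m≡n t≤n
  ... | inj₁ t<n = <-≡ (sy-node (suc t) t<n) (lex-<ˡ {a = t} (inject₁ (α ⟨$⟩ʳ i)) (inject₁ (α ⟨$⟩ʳ L)) ≤-refl)
  ... | inj₂ refl = <-≡ (sy-at n (t , ι T) (at-head 1≤n)) (lex-<ʳ t
    (subst₂ _<_ (sym (toℕ-inject₁ _)) (sym (toℕ-fromℕ k)) (toℕ<n (α ⟨$⟩ʳ i))))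

  sx-node : ∀ t {i} → i ≢ L → sx (node t) < sx (t , ι i)
  sx-node zero i≢L = lex-<ʳ 0 (punchIn-strict h₀ _ _ (L< i≢L))
  sx-node (suc t) {i} _ = lex-<ˡ {a = t} (ι T) (ι i) ≤-refl

  -- The gadget: `s` as `L`, `s′` as `T`, and the wild slots of column `t` for all other points.
  -- Whenever it follows `α`, the colours of `s` and `s′` differ.
  frame : Slot → ℕ → Slot → Fin k → Slot
  frame s t s′ i with i ≟ᶠ L | i ≟ᶠ T
  ... | yes _ | _ = s
  ... | no _ | yes _ = s′
  ... | no _ | no _ = t , ι i

  frame-L : ∀ s t s′ → frame s t s′ L ≡ s
  frame-L s t s′ with L ≟ᶠ L
  ... | yes _ = refl
  ... | no ne = contradiction refl ne

  frame-T : ∀ s t s′ → frame s t s′ T ≡ s′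
  frame-T s t s′ with T ≟ᶠ L | T ≟ᶠ T
  ... | yes eq | _ = contradiction (sym eq) L≢T
  ... | no _ | yes _ = refl
  ... | no _ | no ne = contradiction refl ne

  frame-wild : ∀ n {s t s′} → t ≤ n → ∀ i → i ≢ L → i ≢ T → Wild n (frame s t s′ i)
  frame-wild n {t = t} t≤n i i≢L i≢T with i ≟ᶠ L | i ≟ᶠ T
  ... | yes eq | _ = contradiction eq i≢L
  ... | no _ | yes eq = contradiction eq i≢T
  ... | no _ | no _ = t≤n , cong kind (at-wild n t i≢L i≢T)

  frame-follows : ∀ {n s t s′} → t ≤ n →
    (∀ {i} → i ≢ L → sx s < sx (t , ι i)) → sx s < sx s′ →
    (∀ {i} → pos i < pos T → sx (t , ι i) < sx s′) → (∀ {i} → pos T < pos i → sx s′ < sx (t , ι i)) →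
    (∀ {i} → i ≢ L → i ≢ T → lex t (inject₁ (α ⟨$⟩ʳ i)) < sy n s) → sy n s < sy n s′ →
    (∀ i → i ≢ T → lex t (inject₁ (α ⟨$⟩ʳ i)) < sy n s′) →
    Follows n (frame s t s′)
  frame-follows {n} {s} {t} {s′} t≤n xL xLT x<T xT< yL yLT yT = x-inc , y-inc
    where
      x-inc : ∀ a b → pos a < pos b → sx (frame s t s′ a) < sx (frame s t s′ b)
      x-inc a b lt with a ≟ᶠ L | a ≟ᶠ T | b ≟ᶠ L | b ≟ᶠ T
      ... | _ | _ | yes refl | _ = contradiction lt (≤⇒≯ (L≤ a))
      ... | yes _ | _ | no _ | yes _ = xLT
      ... | yes _ | _ | no b≢L | no _ = xL b≢L
      ... | no _ | yes refl | no _ | yes refl = contradiction lt (<-irrefl refl)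
      ... | no _ | yes refl | no _ | no _ = xT< lt
      ... | no _ | no _ | no _ | yes refl = x<T lt
      ... | no _ | no _ | no _ | no _ = lex-<ʳ t (punchIn-strict h₀ a b lt)
      y-inc : ∀ a b → val a < val b → sy n (frame s t s′ a) < sy n (frame s t s′ b)
      y-inc a b lt with a ≟ᶠ L | a ≟ᶠ T | b ≟ᶠ L | b ≟ᶠ T
      ... | yes refl | _ | yes refl | _ = contradiction lt (<-irrefl refl)
      ... | yes _ | _ | no _ | yes _ = yLT
      ... | yes refl | _ | no _ | no b≢T = contradiction lt (≤⇒≯ (val≤L b≢T))
      ... | no _ | yes refl | _ | _ = contradiction lt (≤⇒≯ (val≤T b))
      ... | no a≢L | no a≢T | yes _ | _ = subst (_< sy n s) (sym (sy-wild n t a≢L a≢T)) (yL a≢L a≢T)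
      ... | no a≢L | no a≢T | no _ | yes _ = subst (_< sy n s′) (sym (sy-wild n t a≢L a≢T)) (yT a a≢T)
      ... | no a≢L | no a≢T | no b≢L | no b≢T =
        subst₂ _<_ (sym (sy-wild n t a≢L a≢T)) (sym (sy-wild n t b≢L b≢T)) (lex-<ʳ t (inject-mono lt))

  ι<hook : ∀ {i} → pos i ≤ pos T → toℕ (ι i) < toℕ h₀
  ι<hook {i} le = subst (_< toℕ h₀) (sym (punchIn-< h₀ i (s≤s le))) (s≤s le)

  hook<ι : ∀ {i} → pos T < pos i → toℕ h₀ < toℕ (ι i)
  hook<ι {i} lt = subst (toℕ h₀ <_) (sym (punchIn-≥ h₀ i lt)) (s≤s lt)

  forced : ∀ {n} (M : Model n) red → MonoFree α (Model.perm M) red → ∀ s t s′ → t ≤ n →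
    Follows n (frame s t s′) → (σ : Single n s) (σ′ : Single n s′) → paint M red s σ ≢ paint M red s′ σ′
  forced {n} M red free s t s′ t≤n fol σ σ′ = forced-≢ M {red} free (frame s t s′) fol L T (frame-wild n t≤n)
    (proj₁ (lone M {s} σ)) (proj₁ (lone M {s′} σ′))
    (trans (proj₂ (lone M {s} σ)) (sym (frame-L s t s′))) (trans (proj₂ (lone M {s′} σ′)) (sym (frame-T s t s′)))

  module _ {n : ℕ} (1≤n : 1 ≤ n) where

    link-follows : ∀ t → t ≤ n → Follows n (frame (node t) t (node (suc t)))
    link-follows t t≤n = frame-follows t≤n (sx-node t) (sx-node t (L≢T ∘ sym))
      (λ lt → lex-<ʳ t (punchIn-strict h₀ _ _ lt)) (λ lt → lex-<ʳ t (punchIn-strict h₀ _ _ lt))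
      (λ i≢L i≢T → <-≡ (sy-node t t≤n) (lex-<ʳ t (inject-mono (val<L i≢L i≢T))))
      (≡-< (sy-node t t≤n) (sy-node-above 1≤n t≤n L))
      (λ i _ → sy-node-above 1≤n t≤n i)

    start-follows : Follows n (frame (node 0) 0 (0 , h₀))
    start-follows = frame-follows z≤n (sx-node 0) (lex-<ʳ 0 (ι<hook (L≤ T)))
      (λ lt → lex-<ʳ 0 (ι<hook (<⇒≤ lt))) (λ lt → lex-<ʳ 0 (hook<ι lt))
      (λ i≢L i≢T → <-≡ (sy-node 0 z≤n) (lex-<ʳ 0 (inject-mono (val<L i≢L i≢T))))
      (≡-< (sy-node 0 z≤n) (<-≡ (sy-hook n) (lex-<ˡ _ _ 1≤n)))
      (λ i _ → <-≡ (sy-hook n) (lex-<ˡ _ _ 1≤n))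

    end-follows : Follows n (frame (0 , h₀) n (node (suc n)))
    end-follows = frame-follows ≤-refl (λ _ → lex-<ˡ _ _ 1≤n) (lex-<ˡ _ _ 1≤n)
      (λ lt → lex-<ʳ n (punchIn-strict h₀ _ _ lt)) (λ lt → lex-<ʳ n (punchIn-strict h₀ _ _ lt))
      (λ i≢L i≢T → <-≡ (sy-hook n) (lex-<ʳ n (inject-mono (val<T i≢T))))
      (≡-< (sy-hook n) (sy-node-above 1≤n ≤-refl T))
      (λ i _ → sy-node-above 1≤n ≤-refl i)

  -- The chain has `n + 1` links, an odd number, so its two ends differ in colour. But both ends
  -- differ from the hook.
  uncolourable : ∀ m → 1 ≤ m → (M : Model (m + m)) → ∀ red → ¬ MonoFree α (Model.perm M) red
  uncolourable m 1≤m M red free = step n ≤-refl (trans (alternating c step m (n≤1+n n))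
      (trans (c≡ 0 z≤n) (trans (≢⇒≡ start (end ∘ sym)) (sym (c≡ (suc n) ≤-refl)))))
    where
      n = m + m
      1≤n : 1 ≤ n
      1≤n = ≤-trans 1≤m (m≤m+n m m)
      c : ℕ → Bool
      -- `alternating` takes a total function, hence a default beyond the head.
      c t with t ≤? suc n
      ... | yes le = paint M red (node t) (node-single 1≤n t le)
      ... | no _ = true
      c≡ : ∀ t le → c t ≡ paint M red (node t) (node-single 1≤n t le)
      c≡ t le with t ≤? suc n
      ... | yes le′ = cong (λ l → paint M red (node t) (node-single 1≤n t l)) (≤-irrelevant le′ le)
      ... | no nle = contradiction le nle
      step : ∀ t → t ≤ n → c t ≢ c (suc t)
      step t le = subst₂ _≢_ (sym (c≡ t (m≤n⇒m≤1+n le))) (sym (c≡ (suc t) (s≤s le)))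
        (forced M red free (node t) t (node (suc t)) le (link-follows 1≤n t le)
          (node-single 1≤n t (m≤n⇒m≤1+n le)) (node-single 1≤n (suc t) (s≤s le)))
      start = forced M red free (node 0) 0 (0 , h₀) z≤n (start-follows 1≤n) (node-single 1≤n 0 z≤n) (hook-single n)
      end = forced M red free (0 , h₀) n (node (suc n)) ≤-refl (end-follows 1≤n)
        (hook-single n) (node-single 1≤n (suc n) ≤-refl)

  -- Alternating along the chain, with `true` at the tail. For odd `n` the head is `true` too, which
  -- suits the `false` of the hook.
  colour : Slot → Bool
  colour (t , j) with j ≟ᶠ ι L | j ≟ᶠ h₀
  ... | yes _ | _ = true
  ... | no _ | yes _ = false
  ... | no _ | no _ = isEven (suc t)

  colour-node : ∀ t → colour (node t) ≡ isEven t
  colour-node zero with ι L ≟ᶠ ι L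
  ... | yes _ = refl
  ... | no ne = contradiction refl ne
  colour-node (suc t) with ι T ≟ᶠ ι L | ι T ≟ᶠ h₀
  ... | yes eq | _ = contradiction (sym (punchIn-injective h₀ T L eq)) L≢T
  ... | no _ | yes eq = contradiction eq (punchInᵢ≢i h₀ T)
  ... | no _ | no _ = refl

  colour-hook : colour (0 , h₀) ≡ false
  colour-hook with h₀ ≟ᶠ ι L | h₀ ≟ᶠ h₀
  ... | yes eq | _ = contradiction (sym eq) (punchInᵢ≢i h₀ L)
  ... | no _ | yes _ = refl
  ... | no _ | no ne = contradiction refl ne

  3≤k : 3 ≤ k
  3≤k = ≤-trans (n≤1+n 3) 4≤k

  val-LT : suc (val L) ≡ val T
  val-LT = suc-injective (trans val-L (sym val-T))

  no-val-between : ∀ {a} → val L < val a → ¬ val a < val T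
  no-val-between la at = <-irrefl refl (≤-trans at (subst (_≤ val _) val-LT la))

  module Skeleton {n : ℕ} (1≤n : 1 ≤ n) (odd : isEven n ≡ false) {c : Bool} {h : Fin k → Slot} (follows : Follows n h)
      (occupied : ∀ a → Occupied n (h a)) (mono : ∀ a → kind (at n (h a)) ≡ single → colour (h a) ≡ c) where

    open Following n h follows

    data Kinds (a : Fin k) : Set where
      isBox : ∀ i → i ≢ L → i ≢ T → h a ≡ (col a , ι i) → sy n (h a) ≡ lex (col a) (inject₁ (α ⟨$⟩ʳ i)) → Kinds a
      isNode : ∀ t → t ≤ suc n → h a ≡ node t → Kinds a
      isHook : h a ≡ (0 , h₀) → Kinds a

    kinds : ∀ a → Kinds a
    kinds a with h a in eq | describe 1≤n (h a) (occupied a)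
    ... | _ | described (box {i = i} _ i≢L i≢T) sy≡ = isBox i i≢L i≢T
      (trans eq (cong (λ s → proj₁ s , ι i) (sym eq))) (trans (cong (sy n) eq) (trans sy≡ (cong (λ s → lex (proj₁ s) _) (sym eq))))
    ... | _ | described tail _ = isNode 0 z≤n eq
    ... | _ | described (arc {t} t<n) _ = isNode (suc t) (s≤s (<⇒≤ t<n)) eq
    ... | _ | described head _ = isNode (suc n) ≤-refl eq
    ... | _ | described hook _ = isHook eq

    box≢node : ∀ {t i u} → i ≢ L → i ≢ T → (t , ι i) ≢ node u
    box≢node {u = zero} i≢L _ eq = i≢L (punchIn-injective h₀ _ L (cong proj₂ eq))
    box≢node {u = suc u} _ i≢T eq = i≢T (punchIn-injective h₀ _ T (cong proj₂ eq))

    hook≢node : ∀ u → (0 , h₀) ≢ node u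
    hook≢node zero eq = punchInᵢ≢i h₀ L (sym (cong proj₂ eq))
    hook≢node (suc u) eq = punchInᵢ≢i h₀ T (sym (cong proj₂ eq))

    node-bound : ∀ {a} u → h a ≡ node u → u ≤ suc n
    node-bound zero _ = z≤n
    node-bound {a} (suc u) eq = s≤s (subst (λ s → proj₁ s ≤ n) eq (proj₁ (occupied a)))

    node-parity : ∀ {a} u → h a ≡ node u → isEven u ≡ c
    node-parity {a} u eq = trans (sym (colour-node u)) (trans (cong colour (sym eq))
      (mono a (trans (cong (kind ∘ at n) eq) (proj₂ (node-single 1≤n u (node-bound u eq))))))

    no-next : ∀ {a b} u → h a ≡ node u → h b ≢ node (suc u)
    no-next u ea eb = not-¬ refl (trans (node-parity u ea) (sym (node-parity (suc u) eb)))

    col-node : ∀ u → proj₁ (node u) < suc u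
    col-node zero = s≤s z≤n
    col-node (suc u) = m≤n⇒m≤1+n ≤-refl

    oneColumn : ∀ t (place : Fin k → Fin k) → (∀ a → h a ≡ (t , ι (place a))) → ∀ a → place a ≡ a
    oneColumn t place eq = increasing-endo place λ a b lt →
      increasing-reflects (toℕ ∘ ι) (punchIn-strict h₀) (place a) (place b) (lex-cancel t (subst₂ (λ s s′ → sx s < sx s′) (eq a) (eq b) (h-x lt)))

    module NoHook (noHook : ∀ a → h a ≢ (0 , h₀)) where

      -- Only node `t` leads from a column before `t` to row `t`; the hook, which would do so as
      -- well, is excluded here.
      row≥col : ∀ a → ∃ λ r → ∃ λ ℓ → sy n (h a) ≡ lex r ℓ × col a ≤ r ×
        (∀ t → col a < t → h a ≢ node t → r < t)
      row≥col a with h a in eq | describe 1≤n (h a) (occupied a)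
      ... | _ | described (box _ _ _) sy≡ = _ , _ , sy≡ , ≤-refl , λ _ lt _ → lt
      ... | _ | described tail sy≡ = _ , _ , sy≡ , ≤-refl , λ _ lt _ → lt
      ... | _ | described (arc _) sy≡ = _ , _ , sy≡ , n≤1+n _ , λ t lt ne → ≤∧≢⇒< lt λ { refl → ne refl }
      ... | _ | described head sy≡ = _ , _ , sy≡ , ≤-refl , λ _ lt _ → lt
      ... | _ | described hook _ = contradiction eq (noHook a)

      -- Without the t-th node the columns before t lie below and to the left
      -- of the remaining ones.
      cut : ∀ t → (∀ a → h a ≢ node t) → ∀ a b → col a < t → ¬ t ≤ col b
      cut t absent a b a<t t≤b = sum-indecomposable 3≤k (λ a → col a <? t)
        ((a , a<t) , (b , λ lt → contradiction t≤b (<⇒≱ lt)))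
        λ a b a< b≮ → left (≤-trans a< (≮⇒≥ b≮)) ,
          (let r , _ , sy≡ , _ , up = row≥col a
               r′ , _ , sy≡′ , lo , _ = row≥col b
           in y-h (subst₂ _<_ (sym sy≡) (sym sy≡′) (lex-<ˡ _ _ (≤-trans (up t a< (absent a)) (≤-trans (≮⇒≥ b≮) lo)))))

      node? : ∀ a → Dec (∃ λ t → t ≤ suc n × h a ≡ node t)
      node? a with kinds a
      ... | isBox i i≢L i≢T eq _ = no λ { (t , _ , e) → box≢node i≢L i≢T (trans (sym eq) e) }
      ... | isNode t le eq = yes (t , le , eq)
      ... | isHook eq = no λ { (t , _ , e) → hook≢node t (trans (sym eq) e) }

      -- All cuts apply, so the copy consists of boxes of one column, and no box stands in the place
      -- of `L`.
      noNode : ¬ (∀ a → ¬ (∃ λ t → t ≤ suc n × h a ≡ node t))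
      noNode none = place≢L L (oneColumn t place slots L)
        where
          t = col L
          absent : ∀ u a → h a ≢ node u
          absent u a eq = none a (u , node-bound u eq , eq)
          col≡ : ∀ a → col a ≡ t
          col≡ a = ≤-antisym (s≤s⁻¹ (≰⇒> (cut (suc t) (absent (suc t)) L a ≤-refl)))
            (≮⇒≥ λ lt → cut t (absent t) a L lt ≤-refl)
          box-of : ∀ a → ∃ λ i → i ≢ L × h a ≡ (t , ι i)
          box-of a with kinds a
          ... | isBox i i≢L _ eq _ = i , i≢L , trans eq (cong (_, ι i) (col≡ a))
          ... | isNode u le eq = contradiction (u , le , eq) (none a)
          ... | isHook eq = contradiction eq (noHook a)
          place = proj₁ ∘ box-of
          place≢L = proj₁ ∘ proj₂ ∘ box-of
          slots = proj₂ ∘ proj₂ ∘ box-of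

      -- The neighbours of `node t` in the chain have the other colour, so the cuts leave only the
      -- columns `t - 1` and `t`, and no other node.
      module OneNode (a₀ : Fin k) (t : ℕ) (a₀≡ : h a₀ ≡ node t) where

        col≤ : ∀ b → col b ≤ t
        col≤ b = s≤s⁻¹ (≰⇒> (cut (suc t) (λ b → no-next t a₀≡) a₀ b (subst (λ s → proj₁ s < suc t) (sym a₀≡) (col-node t))))

        col≥ : ∀ b → t ≤ suc (col b)
        col≥ b = go t a₀≡
          where
            go : ∀ u → h a₀ ≡ node u → u ≤ suc (col b)
            go zero _ = z≤n
            go (suc u) eq = s≤s (≮⇒≥ λ lt → cut u (λ b e → no-next u e eq) b a₀ lt
              (subst (λ s → u ≤ proj₁ s) (sym eq) ≤-refl))

        only : ∀ {b} u → h b ≡ node u → b ≡ a₀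
        only {b} zero eq with m≤n⇒m<n∨m≡n (col≥ b) | cong proj₁ eq
        ... | inj₁ lt | c0 = h-injective (trans eq (sym (trans a₀≡ (cong node (n≤0⇒n≡0 (s≤s⁻¹ (subst (λ x → t < suc x) c0 lt)))))))
        ... | inj₂ e | c0 = contradiction (trans a₀≡ (cong node (trans e (cong suc c0)))) (no-next 0 eq)
        only {b} (suc u) eq with m≤n⇒m<n∨m≡n (col≤ b) | cong proj₁ eq
        ... | inj₂ e | c≡ = contradiction (trans eq (cong (node ∘ suc) (trans (sym c≡) e))) (no-next t a₀≡)
        ... | inj₁ lt | c≡ = h-injective (trans eq (trans (cong node (trans (cong suc (sym c≡)) (sym (≤-antisym (col≥ b) lt)))) (sym a₀≡)))

        box-of : ∀ b → b ≢ a₀ → ∃ λ i → i ≢ L × i ≢ T × h b ≡ (col b , ι i) × sy n (h b) ≡ lex (col b) (inject₁ (α ⟨$⟩ʳ i))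
        box-of b b≢ with kinds b
        ... | isBox i i≢L i≢T eq sy≡ = i , i≢L , i≢T , eq , sy≡
        ... | isNode u _ eq = contradiction (only u eq) b≢
        ... | isHook eq = contradiction eq (noHook b)

        Upper : Fin k → Set
        Upper b = b ≢ a₀ × t ≤ col b

        upper? : Decidable Upper
        upper? b = ¬? (b ≟ᶠ a₀) ×-dec (t ≤? col b)

        upper-x : ∀ {x z} → Upper x → ¬ Upper z → pos z < pos x
        upper-x {x} {z} (x≢ , t≤x) ¬uz with z ≟ᶠ a₀
        ... | no z≢ = left (≤-trans (≰⇒> (λ t≤z → ¬uz (z≢ , t≤z))) t≤x)
        ... | yes refl = let i , i≢L , _ , eq , _ = box-of x x≢ in
          x-h (subst₂ (λ s s′ → sx s < sx s′) (sym a₀≡)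
            (sym (trans eq (cong (_, ι i) (≤-antisym (col≤ x) t≤x)))) (sx-node t i≢L))

        upper-a₀ : ∀ {x} → Upper x → val x < val a₀
        upper-a₀ {x} (x≢ , t≤x) = let i , i≢L , i≢T , _ , sy≡ = box-of x x≢ in
          y-h (subst₂ _<_ (sym (trans sy≡ (cong (λ u → lex u (inject₁ (α ⟨$⟩ʳ i))) (≤-antisym (col≤ x) t≤x))))
            (sym (trans (cong (sy n) a₀≡) (sy-node t (≤-trans t≤x (proj₁ (occupied x))))))
            (lex-<ʳ t (inject-mono (val<L i≢L i≢T))))

        upper-lower : ∀ {x z} → Upper x → z ≢ a₀ → ¬ Upper z → val z < val x
        upper-lower {x} {z} (x≢ , t≤x) z≢ ¬uz =
          let _ , _ , _ , _ , sy≡ = box-of x x≢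
              _ , _ , _ , _ , sy≡′ = box-of z z≢
          in y-h (subst₂ _<_ (sym sy≡′) (sym sy≡) (lex-<ˡ _ _ (≤-trans (≰⇒> (λ t≤z → ¬uz (z≢ , t≤z))) t≤x)))

        -- The boxes of column `t` lie to the right of and below `a₀`, and after all other points in
        -- both orders; two of them would form an interval. A single one would have the second
        -- largest value and stand to the right of the largest value `a₀`, whereas `L` is leftmost.
        -- Without any, column `t - 1` would have to supply a point in the place of `L`.
        impossible : ⊥
        impossible with none-one-many upper?
        ... | inj₂ (inj₂ many) = no-interval upper? many (a₀ , λ u → proj₁ u refl)
          (λ x y z ux uy ¬uz lt _ → <-asym lt (upper-x ux ¬uz)) between
          where
            between : ∀ x y z → Upper x → Upper y → ¬ Upper z → val x < val z → ¬ val z < val y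
            between x y z ux uy ¬uz x<z z<y with z ≟ᶠ a₀
            ... | yes refl = <-asym z<y (upper-a₀ uy)
            ... | no z≢ = <-asym x<z (upper-lower ux z≢ ¬uz)
        ... | inj₂ (inj₁ (z , uz , unique)) = excluded
          where
            lower : ∀ {b} → b ≢ z → ¬ Upper b
            lower b≢z ub = b≢z (unique _ ub)
            L≢z : L ≢ z
            L≢z refl = contradiction (upper-x uz λ u → proj₁ u refl) (≤⇒≯ (L≤ a₀))
            excluded : ⊥
            excluded with L ≟ᶠ a₀
            ... | no L≢ = no-val-between (upper-lower uz L≢ (lower L≢z)) (≤-trans (upper-a₀ uz) (val≤T a₀))
            ... | yes refl with T ≟ᶠ z
            ...   | yes refl = contradiction (upper-a₀ uz) (≤⇒≯ (val≤T a₀))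
            ...   | no T≢z = contradiction (<-trans (upper-lower uz (L≢T ∘ sym) (lower T≢z)) (upper-a₀ uz)) (≤⇒≯ (val≤T a₀))
        ... | inj₁ none = go t a₀≡ col≥ λ b b≢ → ≰⇒> λ t≤b → none b (b≢ , t≤b)
          where
            go : ∀ u → h a₀ ≡ node u → (∀ b → u ≤ suc (col b)) → (∀ b → b ≢ a₀ → col b < u) → ⊥
            go zero _ _ under = let b , b≢ , _ = third 3≤k a₀ a₀ in contradiction (under b b≢) λ ()
            go (suc u) eq over under = place-L≢L (oneColumn u place slots L)
              where
                place-of : ∀ b → ∃ λ i → i ≢ L × h b ≡ (u , ι i)
                place-of b with b ≟ᶠ a₀
                ... | yes refl = T , L≢T ∘ sym , eq
                ... | no b≢ = let i , i≢L , _ , eb , _ = box-of b b≢ in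
                  i , i≢L , trans eb (cong (_, ι i) (≤-antisym (s≤s⁻¹ (under b b≢)) (s≤s⁻¹ (over b))))
                place = proj₁ ∘ place-of
                place-L≢L = proj₁ (proj₂ (place-of L))
                slots = proj₂ ∘ proj₂ ∘ place-of

      contradictory : ⊥
      contradictory with any? node?
      ... | yes (a₀ , t , _ , eq) = OneNode.impossible a₀ t eq
      ... | no ¬e = noNode λ a e → ¬e (a , e)

    module WithHook (a₀ : Fin k) (a₀≡ : h a₀ ≡ (0 , h₀)) where

      c≡ : c ≡ false
      c≡ = trans (sym (mono a₀ (trans (cong (kind ∘ at n) a₀≡) (proj₂ (hook-single n)))))
        (trans (cong colour a₀≡) colour-hook)

      no-tail : ∀ b → h b ≢ node 0
      no-tail b eq with () ← trans (node-parity 0 eq) c≡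

      hook-only : ∀ {b} → h b ≡ (0 , h₀) → b ≡ a₀
      hook-only eq = h-injective (trans eq (sym a₀≡))

      sy-a₀ : sy n (h a₀) ≡ lex n (inject₁ (α ⟨$⟩ʳ T))
      sy-a₀ = trans (cong (sy n) a₀≡) (sy-hook n)

      under-a₀ : ∀ {b r i} → sy n (h b) ≡ lex r (inject₁ (α ⟨$⟩ʳ i)) → r ≤ n → i ≢ T → val b < val a₀
      under-a₀ {b} {r} {i} eq r≤n i≢T = y-h (subst₂ _<_ (sym eq) (sym sy-a₀) (lt (m≤n⇒m<n∨m≡n r≤n)))
        where
          lt : r < n ⊎ r ≡ n → lex r (inject₁ (α ⟨$⟩ʳ i)) < lex n (inject₁ (α ⟨$⟩ʳ T))
          lt (inj₁ r<n) = lex-<ˡ _ _ r<n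
          lt (inj₂ refl) = lex-<ʳ r (inject-mono (val<T i≢T))

      -- Only the head lies above the hook, and for odd `n` it has the other colour. So the hook has
      -- to play `T`.
      highest : ∀ {b} → b ≢ a₀ → val b < val a₀
      highest {b} b≢ with kinds b
      ... | isBox i _ i≢T _ sy≡ = under-a₀ sy≡ (proj₁ (occupied b)) i≢T
      ... | isHook eq = contradiction (hook-only eq) b≢
      ... | isNode u le eq with m≤n⇒m<n∨m≡n le
      ...   | inj₁ (s≤s u≤n) = under-a₀ (trans (cong (sy n) eq) (sy-node u u≤n)) u≤n L≢T
      ...   | inj₂ refl with () ← trans (trans (sym (cong not odd)) (node-parity u eq)) c≡

      a₀≡T : a₀ ≡ T
      a₀≡T = decidable-stable (a₀ ≟ᶠ T) λ ne → contradiction (highest (ne ∘ sym)) (≤⇒≯ (val≤T a₀))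

      hT : h T ≡ (0 , h₀)
      hT = trans (cong h (sym a₀≡T)) a₀≡

      place : Fin k → Fin (suc k)
      place = proj₂ ∘ h

      beforeT : ∀ {b} → pos b < pos T → col b ≡ 0 × toℕ (place b) < toℕ h₀
      beforeT {b} lt with to (lex-< (col b) 0 (place b) h₀) (subst (λ s → sx (h b) < sx s) hT (h-x lt))
      ... | inj₁ ()
      ... | inj₂ (c0 , lt′) = c0 , lt′

      place≥1 : ∀ {b} → pos b < pos T → 1 ≤ toℕ (place b)
      place≥1 {b} lt with kinds b
      ... | isBox i i≢L _ eq _ = subst (λ s → 1 ≤ toℕ (proj₂ s)) (sym eq)
              (≤-trans (s≤s z≤n) (punchIn-strict h₀ L i (L< i≢L)))
      ... | isNode zero _ eq = contradiction eq (no-tail b)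
      ... | isNode (suc u) _ eq = subst (λ s → 1 ≤ toℕ (proj₂ s)) (sym eq)
              (≤-trans (s≤s z≤n) (punchIn-strict h₀ L T (L< (L≢T ∘ sym))))
      ... | isHook eq = contradiction lt (<-irrefl (cong pos (trans (hook-only eq) a₀≡T)))

      p : ℕ
      p = pos T

      at-position : Fin p → Fin k
      at-position i = inject≤ i (<⇒≤ (toℕ<n T))

      at-position< : ∀ i → pos (at-position i) < pos T
      at-position< i = subst (_< p) (sym (toℕ-inject≤ i _)) (toℕ<n i)

      places : Fin p → ℕ
      places i = toℕ (place (at-position i))

      places-inc : Increasing places
      places-inc i j lt with beforeT (at-position< i) | beforeT (at-position< j)
                           | to (lex-< _ _ _ _) (h-x {at-position i} {at-position j}
                               (subst₂ _<_ (sym (toℕ-inject≤ i _)) (sym (toℕ-inject≤ j _)) lt))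
      ... | ci , _ | cj , _ | inj₁ c< = contradiction (subst₂ _<_ ci cj c<) (<-irrefl refl)
      ... | _ | _ | inj₂ (_ , lt′) = lt′

      2≤p : 2 ≤ p
      2≤p = s≤s⁻¹ (s≤s⁻¹ (subst (4 ≤_) (sym pos-T) 4≤k))

      lastBefore : ∃ λ (i : Fin p) → suc (toℕ i) ≡ p
      lastBefore = fromℕ< (≤-reflexive e) , trans (cong suc (toℕ-fromℕ< (≤-reflexive e))) e
        where
          e : suc (p ∸ 1) ≡ p
          e = m+[n∸m]≡n (≤-trans (s≤s z≤n) 2≤p)

      -- The `p` points before `T` stand in column 0 to the left of the hook, in places 1, ..., `p`,
      -- as place 0 belongs to the tail, which has the other colour. They fill these places, so the
      -- last of them is `node 1`, in row 1. As `L` lies in row 0, the value of this point is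
      -- strictly between the consecutive values of `L` and `T`.
      contradictory : ⊥
      contradictory = finish (kinds L)
        where
          i = proj₁ lastBefore
          b = at-position i
          pos-b : pos b ≡ toℕ i
          pos-b = toℕ-inject≤ i _
          L<b : pos L < pos b
          L<b = subst₂ _<_ (sym pos-L) (sym pos-b) (s≤s⁻¹ (subst (2 ≤_) (sym (proj₂ lastBefore)) 2≤p))
          hb : h b ≡ node 1
          hb = cong₂ _,_ (proj₁ (beforeT (at-position< i))) (toℕ-injective (trans (≤-antisym
              (s≤s⁻¹ (proj₂ (beforeT (at-position< i))))
              (subst (_≤ places i) (trans (+-comm (toℕ i) 1) (proj₂ lastBefore))
                (increasing-lower 1 places places-inc (place≥1 ∘ at-position<) i)))
            (sym (punchIn-< h₀ T ≤-refl))))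
          b≢T : b ≢ T
          b≢T eq = <-irrefl (cong pos eq) (at-position< i)
          finish : Kinds L → ⊥
          finish (isBox j _ _ _ sy≡) = no-val-between
            (y-h (subst₂ _<_ (sym (trans sy≡ (cong (λ u → lex u _) (proj₁ (beforeT (<-trans L<b (at-position< i)))))))
                   (sym (trans (cong (sy n) hb) (sy-node 1 1≤n))) (lex-<ˡ {a = 0} {1} (inject₁ (α ⟨$⟩ʳ j)) (inject₁ (α ⟨$⟩ʳ L)) (s≤s z≤n))))
            (val<T b≢T)
          finish (isNode zero _ eq) = no-tail L eq
          finish (isNode (suc u) _ eq) = <-irrefl (cong pos (h-injective {L} {b} (trans eq (trans
            (cong (_, ι T) (trans (sym (cong proj₁ eq)) (proj₁ (beforeT (<-trans L<b (at-position< i)))))) (sym hb))))) L<b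
          finish (isHook eq) = L≢T (trans (hook-only eq) a₀≡T)

    impossible : ⊥
    impossible with any? (λ a → ≡-dec _≟_ _≟ᶠ_ (h a) (0 , h₀))
    ... | yes (a₀ , eq) = WithHook.contradictory a₀ eq
    ... | no ¬e = NoHook.contradictory λ a eq → ¬e (a , eq)

  hooked-notDefinable : ¬ FODefinable (Av α ⊙ Av α)
  hooked-notDefinable = notDefinable separated uncolourable λ m 1≤m → colour ,
    λ c h follows occupied mono → Skeleton.impossible (s≤s z≤n) (cong not (isEven-double m)) follows occupied mono

-- Extreme points, bottlenecks and gaps.

record Extremes {k : ℕ} (α : Perm k) : Set where
  field
    L R T B : Fin k
    L-min : ∀ (a : Fin k) → toℕ L ≤ toℕ a
    R-max : ∀ (a : Fin k) → toℕ a ≤ toℕ R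
    T-max : ∀ a → toℕ (α ⟨$⟩ʳ a) ≤ toℕ (α ⟨$⟩ʳ T)
    B-min : ∀ a → toℕ (α ⟨$⟩ʳ B) ≤ toℕ (α ⟨$⟩ʳ a)

-- There is no bottleneck, meaning a point `p` whose deletion leaves a direct sum with at least two
-- points in either summand.
SumGood : ∀ {k} → Perm k → Set₁
SumGood {k} α = ∀ p {P : Fin k → Set} → Decidable P →
  (∀ a b → a ≢ p → b ≢ p → P a → ¬ P b → toℕ a < toℕ b × toℕ (α ⟨$⟩ʳ a) < toℕ (α ⟨$⟩ʳ b)) →
  Many (λ a → a ≢ p × P a) → ¬ Many (λ b → b ≢ p × ¬ P b)

module Corners {k : ℕ} (α : Perm k) (simple : Simple α) (3≤k : 3 ≤ k) (E : Extremes α) where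
  open Simplicity α simple
  open Extremes E

  L-least : ∀ {a} → a ≢ L → pos L < pos a
  L-least {a} a≢ = ≤∧≢⇒< (L-min a) (a≢ ∘ sym ∘ toℕ-injective)

  R-greatest : ∀ {a} → a ≢ R → pos a < pos R
  R-greatest {a} a≢ = ≤∧≢⇒< (R-max a) (a≢ ∘ toℕ-injective)

  T-greatest : ∀ {a} → a ≢ T → val a < val T
  T-greatest a≢ = ≤∧≢⇒< (T-max _) (a≢ ∘ val-injective)

  B-least : ∀ {a} → a ≢ B → val B < val a
  B-least a≢ = ≤∧≢⇒< (B-min _) (a≢ ∘ sym ∘ val-injective)

  private
    point : ∀ x → NonTrivial (_≡ x)
    point x = (x , refl) , (let b , b≢ , _ = third 3≤k x x in b , b≢)

  -- A point that is extreme in both orders is a summand or a skew summand on its own; the next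
  -- three lemmas follow in the same way.
  L≢B : L ≢ B
  L≢B eq = sum-indecomposable 3≤k (_≟ᶠ L) (point L) λ { a b refl b≢ →
    L-least b≢ , subst (λ l → val l < val b) (sym eq) (B-least (b≢ ∘ λ e → trans e (sym eq))) }

  L≢T : L ≢ T
  L≢T eq = skew-indecomposable 3≤k (_≟ᶠ L) (point L) λ { a b refl b≢ →
    L-least b≢ , subst (λ l → val b < val l) (sym eq) (T-greatest (b≢ ∘ λ e → trans e (sym eq))) }

  R≢T : R ≢ T
  R≢T eq = sum-indecomposable 3≤k (¬? ∘ (_≟ᶠ R)) ((let b , b≢ , _ = third 3≤k R R in b , b≢) , R , λ n → n refl)
    λ a b a≢ b≡ → subst (λ r → pos a < pos r) (sym (stable b≡)) (R-greatest a≢) ,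
      subst (λ r → val a < val r) (sym (trans (stable b≡) eq)) (T-greatest (a≢ ∘ λ e → trans e (sym eq)))
    where
      stable : ∀ {b} → ¬ ¬ (b ≡ R) → b ≡ R
      stable = decidable-stable (_ ≟ᶠ R)

  R≢B : R ≢ B
  R≢B eq = skew-indecomposable 3≤k (¬? ∘ (_≟ᶠ R)) ((let b , b≢ , _ = third 3≤k R R in b , b≢) , R , λ n → n refl)
    λ a b a≢ b≡ → subst (λ r → pos a < pos r) (sym (stable b≡)) (R-greatest a≢) ,
      subst (λ r → val r < val a) (sym (trans (stable b≡) eq)) (B-least (a≢ ∘ λ e → trans e (sym eq)))
    where
      stable : ∀ {b} → ¬ ¬ (b ≡ R) → b ≡ R
      stable = decidable-stable (_ ≟ᶠ R)

-- If one of these gaps is empty, a point of another column can take over the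
-- role of an extreme point, and the even cycle is not colourable either.
record Spread {k : ℕ} (α : Perm k) (E : Extremes α) : Set where
  open Extremes E
  field
    T-R : ∃ λ (e : Fin k) → toℕ T < toℕ e × toℕ e < toℕ R
    L-B : ∃ λ (e : Fin k) → toℕ L < toℕ e × toℕ e < toℕ B
    B-L : ∃ λ (e : Fin k) → toℕ (α ⟨$⟩ʳ B) < toℕ (α ⟨$⟩ʳ e) × toℕ (α ⟨$⟩ʳ e) < toℕ (α ⟨$⟩ʳ L)
    R-T : ∃ λ (e : Fin k) → toℕ (α ⟨$⟩ʳ R) < toℕ (α ⟨$⟩ʳ e) × toℕ (α ⟨$⟩ʳ e) < toℕ (α ⟨$⟩ʳ T)

-- The cycle closed through the last column.

module Staircase {k : ℕ} (α : Perm k) (simple : Simple α) (4≤k : 4 ≤ k)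
    (E : Extremes α) (good : SumGood α) (S : Spread α E) where
  open Extremes E
  open Spread S

  3≤k : 3 ≤ k
  3≤k = ≤-trans (n≤1+n 3) 4≤k

  open Simplicity α simple
  open Corners α simple 3≤k E

  -- Each column has a node in the place `hit` and a vacancy in the place `miss`, filled by the
  -- preceding node of the cycle. The `T` of a column, moved up one row, becomes the `L` of the next
  -- column; the `B` of the last column, moved down to row 0, becomes the `R` of column 0.
  hit miss : Zone → Fin k
  hit last = B
  hit _ = T
  miss first = R
  miss _ = L

  hitCell : Zone → Cell k
  hitCell last = cell single bottom (α ⟨$⟩ʳ R)
  hitCell _ = cell single next (α ⟨$⟩ʳ L)

  table : Table
  table = record { width = k ; height = k ; entry = entry }
    where
      entry : Zone → Fin k → Cell k
      entry z i with i ≟ᶠ hit z | i ≟ᶠ miss z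
      ... | yes _ | _ = hitCell z
      ... | no _ | yes _ = cell vacant own (α ⟨$⟩ʳ i)
      ... | no _ | no _ = cell wild own (α ⟨$⟩ʳ i)

  open Grid table α
  open Colouring table α simple 4≤k

  miss≢hit : ∀ z → miss z ≢ hit z
  miss≢hit first = R≢T
  miss≢hit middle = L≢T
  miss≢hit last = L≢B

  at-hit : ∀ n t → at n (t , hit (zone n t)) ≡ hitCell (zone n t)
  at-hit n t with hit (zone n t) ≟ᶠ hit (zone n t)
  ... | yes _ = refl
  ... | no ne = contradiction refl ne

  at-wild : ∀ n t i → i ≢ hit (zone n t) → i ≢ miss (zone n t) → at n (t , i) ≡ cell wild own (α ⟨$⟩ʳ i)
  at-wild n t i ≢hit ≢miss with i ≟ᶠ hit (zone n t) | i ≟ᶠ miss (zone n t)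
  ... | yes eq | _ = contradiction eq ≢hit
  ... | no _ | yes eq = contradiction eq ≢miss
  ... | no _ | no _ = refl

  hit-< : ∀ {n t} → t < n → hit (zone n t) ≡ T
  hit-< {n} {t} t<n with zone n t in eq
  ... | first = refl
  ... | middle = refl
  ... | last = contradiction eq (zone-< t<n)

  hitCell-< : ∀ {n t} → t < n → hitCell (zone n t) ≡ cell single next (α ⟨$⟩ʳ L)
  hitCell-< {n} {t} t<n with zone n t in eq
  ... | first = refl
  ... | middle = refl
  ... | last = contradiction eq (zone-< t<n)

  miss-suc : ∀ n t → miss (zone n (suc t)) ≡ L
  miss-suc n t with zone n (suc t) in eq
  ... | first = contradiction eq (zone-suc n t)
  ... | middle = refl
  ... | last = refl

  at-arc : ∀ {n t} → t < n → at n (t , T) ≡ cell single next (α ⟨$⟩ʳ L)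
  at-arc {n} {t} t<n = trans (cong (λ i → at n (t , i)) (sym (hit-< t<n))) (trans (at-hit n t) (hitCell-< t<n))

  at-hook : ∀ {n} → 1 ≤ n → at n (n , B) ≡ cell single bottom (α ⟨$⟩ʳ R)
  at-hook {n} 1≤n = trans (cong (λ i → at n (n , i)) (sym (cong hit (zone-last 1≤n))))
    (trans (at-hit n n) (cong hitCell (zone-last 1≤n)))

  data Element (n : ℕ) : Slot → ℕ → Fin k → Set where
    box : ∀ {t i} → t ≤ n → i ≢ hit (zone n t) → i ≢ miss (zone n t) → Element n (t , i) t (α ⟨$⟩ʳ i)
    arc : ∀ {t} → t < n → Element n (t , T) (suc t) (α ⟨$⟩ʳ L)
    hook : Element n (n , B) 0 (α ⟨$⟩ʳ R)

  record Described (n : ℕ) (s : Slot) : Set where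
    constructor described
    field
      {row′} : ℕ
      {level′} : Fin k
      element : Element n s row′ level′
      sy≡ : sy n s ≡ lex row′ level′

  describe : ∀ {n} → 1 ≤ n → ∀ s → Occupied n s → Described n s
  describe {n} 1≤n (t , i) (t≤n , nv) with i ≟ᶠ hit (zone n t) in eh
  describe {n} 1≤n (t , i) (t≤n , nv) | yes i≡ with m≤n⇒m<n∨m≡n t≤n
  ... | inj₁ t<n with refl ← trans i≡ (hit-< t<n) = described (arc t<n) (sy-at n (t , T) (at-arc t<n))
  ... | inj₂ refl with refl ← trans i≡ (cong hit (zone-last 1≤n)) =
    described hook (sy-at n (t , B) (at-hook 1≤n))
  describe {n} 1≤n (t , i) (t≤n , nv) | no ≢hit with i ≟ᶠ miss (zone n t)
  ... | yes i≡ = contradiction refl nv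
  ... | no ≢miss = described (box t≤n ≢hit ≢miss) (sy-at n (t , i) (at-wild n t i ≢hit ≢miss))

  separate : ∀ {n s s′ r r′ ℓ ℓ′} → Element n s r ℓ → Element n s′ r′ ℓ′ → r ≡ r′ → ℓ ≡ ℓ′ → s ≡ s′
  separate (box _ _ _) (box _ _ _) refl ℓ≡ = cong (_ ,_) (perm-injective α ℓ≡)
  separate {n} (box _ _ ≢miss) (arc {t} _) refl ℓ≡ = contradiction (trans (perm-injective α ℓ≡) (sym (miss-suc n t))) ≢miss
  separate (box _ _ ≢miss) hook refl ℓ≡ = contradiction (perm-injective α ℓ≡) ≢miss
  separate {n} (arc {t} _) (box _ _ ≢miss) refl ℓ≡ = contradiction (trans (sym (perm-injective α ℓ≡)) (sym (miss-suc n t))) ≢miss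
  separate (arc _) (arc _) refl _ = refl
  separate hook (box _ _ ≢miss) refl ℓ≡ = contradiction (sym (perm-injective α ℓ≡)) ≢miss
  separate hook hook _ _ = refl

  separated : ∀ n → 1 ≤ n → SeparatedRows n
  separated n 1≤n {s} {s′} occ occ′ eq with describe 1≤n s occ | describe 1≤n s′ occ′
  ... | described e sy₁ | described e′ sy₂ =
    let r≡ , ℓ≡ = lex-≡ _ _ _ _ (trans (sym sy₁) (trans eq sy₂)) in separate e e′ r≡ ℓ≡

  node : ℕ → ℕ → Slot
  node n t = t , hit (zone n t)

  node-single : ∀ {n} t → t ≤ n → Single n (node n t)
  node-single {n} t t≤n = t≤n , trans (cong kind (at-hit n t)) (hitCell-single (zone n t))
    where
      hitCell-single : ∀ z → kind (hitCell z) ≡ single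
      hitCell-single first = refl
      hitCell-single middle = refl
      hitCell-single last = refl

  sy-arc : ∀ {n t} → t < n → sy n (node n t) ≡ lex (suc t) (α ⟨$⟩ʳ L)
  sy-arc {n} {t} t<n = sy-at n (node n t) (trans (at-hit n t) (hitCell-< t<n))

  sy-hook : ∀ {n} → 1 ≤ n → sy n (node n n) ≡ lex 0 (α ⟨$⟩ʳ R)
  sy-hook {n} 1≤n = sy-at n (node n n) (trans (at-hit n n) (cong hitCell (zone-last 1≤n)))

  -- The copy of α at column t consists of the places of that column, except
  -- that one of them is filled by the preceding node of the cycle.
  previous : ℕ → ℕ → Slot
  previous n zero = node n n
  previous n (suc t) = node n t

  previous-single : ∀ {n} t → t ≤ n → Single n (previous n t)
  previous-single zero _ = node-single _ ≤-refl
  previous-single (suc t) t<n = node-single t (<⇒≤ t<n)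

  sy-previous : ∀ {n} → 1 ≤ n → ∀ t → t ≤ n → sy n (previous n t) ≡ lex t (α ⟨$⟩ʳ miss (zone n t))
  sy-previous 1≤n zero _ = sy-hook 1≤n
  sy-previous {n} 1≤n (suc t) t<n = trans (sy-arc t<n) (cong (λ i → lex (suc t) (α ⟨$⟩ʳ i)) (sym (miss-suc n t)))

  frame : ℕ → ℕ → Fin k → Slot
  frame n t i with i ≟ᶠ miss (zone n t)
  ... | yes _ = previous n t
  ... | no _ = t , i

  frame-miss : ∀ n t → frame n t (miss (zone n t)) ≡ previous n t
  frame-miss n t with miss (zone n t) ≟ᶠ miss (zone n t)
  ... | yes _ = refl
  ... | no ne = contradiction refl ne

  frame-other : ∀ n t {i} → i ≢ miss (zone n t) → frame n t i ≡ (t , i)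
  frame-other n t {i} ne with i ≟ᶠ miss (zone n t)
  ... | yes eq = contradiction eq ne
  ... | no _ = refl

  frame-wild : ∀ n {t} → t ≤ n → ∀ i → i ≢ miss (zone n t) → i ≢ hit (zone n t) → Wild n (frame n t i)
  frame-wild n {t} t≤n i ≢miss ≢hit =
    subst (Wild n) (sym (frame-other n t ≢miss)) (t≤n , cong kind (at-wild n t i ≢hit ≢miss))

  frame-follows : ∀ {n} → 1 ≤ n → ∀ t → t ≤ n → Follows n (frame n t)
  frame-follows {n} 1≤n t t≤n = x-inc t , y-inc
    where
      x-inc : ∀ t a b → pos a < pos b → sx (frame n t a) < sx (frame n t b)
      x-inc t a b lt with a ≟ᶠ miss (zone n t) | b ≟ᶠ miss (zone n t)
      ... | no _ | no _ = lex-<ʳ t lt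
      x-inc zero a b lt | yes refl | _ = contradiction lt (≤⇒≯ (R-max b))
      x-inc zero a b lt | no _ | yes refl = lex-<ˡ _ _ 1≤n
      x-inc (suc t) a b lt | _ | yes b≡ = contradiction lt (≤⇒≯ (subst (λ l → pos l ≤ pos a) (sym (trans b≡ (miss-suc n t))) (L-min a)))
      x-inc (suc t) a b lt | yes _ | no _ = lex-<ˡ {a = t} (hit (zone n t)) b ≤-refl
      sy-frame : ∀ {i} → i ≢ hit (zone n t) → sy n (frame n t i) ≡ lex t (α ⟨$⟩ʳ i)
      sy-frame {i} ≢hit with i ≟ᶠ miss (zone n t)
      ... | yes refl = sy-previous 1≤n t t≤n
      ... | no ≢miss = sy-at n (t , i) (at-wild n t i ≢hit ≢miss)
      frame-hit : frame n t (hit (zone n t)) ≡ node n t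
      frame-hit = frame-other n t (miss≢hit (zone n t) ∘ sym)
      y-inc : ∀ a b → val a < val b → sy n (frame n t a) < sy n (frame n t b)
      y-inc a b lt with a ≟ᶠ hit (zone n t) | b ≟ᶠ hit (zone n t) | m≤n⇒m<n∨m≡n t≤n
      ... | no a≢ | no b≢ | _ = subst₂ _<_ (sym (sy-frame a≢)) (sym (sy-frame b≢)) (lex-<ʳ t lt)
      ... | yes refl | yes refl | _ = contradiction lt (<-irrefl refl)
      ... | no a≢ | yes refl | inj₁ t<n = subst₂ _<_ (sym (sy-frame a≢)) (sym (trans (cong (sy n) frame-hit) (sy-arc t<n)))
              (lex-<ˡ {a = t} (α ⟨$⟩ʳ a) (α ⟨$⟩ʳ L) ≤-refl)
      ... | no a≢ | yes refl | inj₂ refl = contradiction lt (≤⇒≯ (subst (λ i → val i ≤ val a) (sym (cong hit (zone-last 1≤n))) (B-min a)))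
      ... | yes refl | no b≢ | inj₁ t<n = contradiction lt (≤⇒≯ (subst (λ i → val b ≤ val i) (sym (hit-< t<n)) (T-max b)))
      ... | yes refl | no b≢ | inj₂ refl = subst₂ _<_ (sym (trans (cong (sy n) frame-hit) (sy-hook 1≤n))) (sym (sy-frame b≢))
              (lex-<ˡ {a = 0} {t} (α ⟨$⟩ʳ R) (α ⟨$⟩ʳ b) 1≤n)

  -- For even `n` the `n + 1` nodes form an odd cycle: alternation gives nodes 0 and `n` the same
  -- colour, but the gadget at column 0 requires different ones.
  uncolourable : ∀ m → 1 ≤ m → (M : Model (m + m)) → ∀ red → ¬ MonoFree α (Model.perm M) red
  uncolourable (suc m) 1≤m M red free = subst₂ _≢_ (sym (c≡ n ≤-refl)) (sym (c≡ 0 z≤n)) (forced 0 z≤n)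
      (alternating c (λ t t≤ → subst₂ _≢_ (sym (c≡ t (<⇒≤ (s≤s t≤)))) (sym (c≡ (suc t) (s≤s t≤))) (step t (s≤s t≤))) (suc m) ≤-refl)
    where
      n = suc m + suc m
      forced : ∀ t (t≤n : t ≤ n) → paint M red (previous n t) (previous-single t t≤n) ≢ paint M red (node n t) (node-single t t≤n)
      forced t t≤n = forced-≢ M {red} free (frame n t) (frame-follows (s≤s z≤n) t t≤n) (miss (zone n t)) (hit (zone n t))
        (frame-wild n t≤n) (proj₁ (lone M {previous n t} (previous-single t t≤n))) (proj₁ (lone M {node n t} (node-single t t≤n)))
        (trans (proj₂ (lone M {previous n t} (previous-single t t≤n))) (sym (frame-miss n t)))
        (trans (proj₂ (lone M {node n t} (node-single t t≤n))) (sym (frame-other n t (miss≢hit (zone n t) ∘ sym))))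
      step : ∀ t (lt : suc t ≤ n) → paint M red (node n t) (node-single t (<⇒≤ lt)) ≢ paint M red (node n (suc t)) (node-single (suc t) lt)
      step t lt = forced (suc t) lt
      c : ℕ → Bool
      c t with t ≤? n
      ... | yes le = paint M red (node n t) (node-single t le)
      ... | no _ = true
      c≡ : ∀ t le → c t ≡ paint M red (node n t) (node-single t le)
      c≡ t le with t ≤? n
      ... | yes le′ = cong (λ l → paint M red (node n t) (node-single t l)) (≤-irrelevant le′ le)
      ... | no nle = contradiction le nle

  module Skeleton {n : ℕ} (1≤n : 1 ≤ n) (odd : isEven n ≡ false) {c : Bool} {h : Fin k → Slot} (follows : Follows n h)
      (occupied : ∀ a → Occupied n (h a)) (mono : ∀ a → kind (at n (h a)) ≡ single → isEven (proj₁ (h a)) ≡ c) where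

    open Following n h follows

    data Kinds (a : Fin k) : Set where
      isBox : ∀ i → i ≢ hit (zone n (col a)) → i ≢ miss (zone n (col a)) → h a ≡ (col a , i) →
        sy n (h a) ≡ lex (col a) (α ⟨$⟩ʳ i) → Kinds a
      isArc : ∀ t → t < n → h a ≡ (t , T) → sy n (h a) ≡ lex (suc t) (α ⟨$⟩ʳ L) → Kinds a
      isHook : h a ≡ (n , B) → sy n (h a) ≡ lex 0 (α ⟨$⟩ʳ R) → Kinds a

    kinds : ∀ a → Kinds a
    kinds a with h a in eq | describe 1≤n (h a) (occupied a)
    ... | _ | described (box {t} {i} _ ≢hit ≢miss) sy≡ =
      isBox i (subst (λ s → i ≢ hit (zone n (proj₁ s))) (sym eq) ≢hit) (subst (λ s → i ≢ miss (zone n (proj₁ s))) (sym eq) ≢miss)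
        (trans eq (cong (λ s → proj₁ s , i) (sym eq))) (trans (cong (sy n) eq) (trans sy≡ (cong (λ s → lex (proj₁ s) (α ⟨$⟩ʳ i)) (sym eq))))
    ... | _ | described (arc t<n) sy≡ = isArc _ t<n eq (trans (cong (sy n) eq) sy≡)
    ... | _ | described hook sy≡ = isHook eq (trans (cong (sy n) eq) sy≡)

    Arc : ℕ → Fin k → Set
    Arc t a = t < n × h a ≡ (t , T)

    arc-parity : ∀ {a} t → Arc t a → isEven t ≡ c
    arc-parity {a} t (t<n , eq) = trans (cong (isEven ∘ proj₁) (sym eq))
      (mono a (trans (cong (kind ∘ at n) eq) (cong kind (at-arc t<n))))

    no-next : ∀ {a b} t → Arc t a → ¬ Arc (suc t) b
    no-next t ea eb = not-¬ refl (trans (arc-parity t ea) (sym (arc-parity (suc t) eb)))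

    module NoHook (noHook : ∀ a → h a ≢ (n , B)) where

      row≥col : ∀ a → ∃ λ r → ∃ λ ℓ → sy n (h a) ≡ lex r ℓ × col a ≤ r × (∀ t → col a ≤ t → ¬ Arc t a → r ≤ t)
      row≥col a with kinds a
      ... | isBox _ _ _ _ sy≡ = _ , _ , sy≡ , ≤-refl , λ _ le _ → le
      ... | isArc t t<n eq sy≡ = _ , _ , sy≡ , subst (λ s → proj₁ s ≤ suc t) (sym eq) (n≤1+n t) ,
              λ u le ¬arc → ≤∧≢⇒< (subst (λ s → proj₁ s ≤ u) eq le) λ { refl → ¬arc (t<n , eq) }
      ... | isHook eq _ = contradiction eq (noHook a)

      -- Without the arc leaving column t the columns up to t lie below and to
      -- the left of the remaining ones.
      cut : ∀ t → (∀ a → ¬ Arc t a) → ∀ a b → col a ≤ t → ¬ t < col b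
      cut t absent a b a≤t t<b = sum-indecomposable 3≤k (λ a → col a ≤? t)
        ((a , a≤t) , (b , <⇒≱ t<b))
        λ a b a≤ b≰ → left (≤-trans (s≤s a≤) (≰⇒> b≰)) ,
          (let r , _ , sy≡ , _ , up = row≥col a
               r′ , _ , sy≡′ , lo , _ = row≥col b
           in y-h (subst₂ _<_ (sym sy≡) (sym sy≡′) (lex-<ˡ _ _ (≤-trans (s≤s (up t a≤ (absent a))) (≤-trans (≰⇒> b≰) lo)))))

      arc? : ∀ a → Dec (∃ λ t → Arc t a)
      arc? a with kinds a
      ... | isBox i ≢hit _ eq _ = no λ { (t , t<n , e) → ≢hit (trans (cong proj₂ (trans (sym eq) e))
              (sym (hit-< (subst (λ s → proj₁ s < n) (sym e) t<n)))) }
      ... | isArc t t<n eq _ = yes (t , t<n , eq)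
      ... | isHook eq _ = contradiction eq (noHook a)

      -- Every cut applies, and in the one column that remains nothing stands in the place `hit`.
      noArc : ¬ (∀ a → ¬ (∃ λ t → Arc t a))
      noArc none = proj₁ (proj₂ (box-of e)) (increasing-endo place inc e)
        where
          t = col L
          e = hit (zone n t)
          col≡ : ∀ a → col a ≡ t
          col≡ a = ≤-antisym (≮⇒≥ λ lt → cut t (λ b e → none b (t , e)) L a ≤-refl lt)
            (≮⇒≥ λ lt → cut (col a) (λ b e → none b (col a , e)) a L ≤-refl lt)
          box-of : ∀ a → ∃ λ i → i ≢ hit (zone n t) × h a ≡ (t , i)
          box-of a with kinds a
          ... | isBox i ≢hit _ eq _ = i , subst (λ u → i ≢ hit (zone n u)) (col≡ a) ≢hit , trans eq (cong (_, i) (col≡ a))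
          ... | isArc u u<n eq _ = contradiction (u , u<n , eq) (none a)
          ... | isHook eq _ = contradiction eq (noHook a)
          place = proj₁ ∘ box-of
          inc : Increasing (toℕ ∘ place)
          inc a b lt = lex-cancel t (subst₂ (λ s s′ → sx s < sx s′) (proj₂ (proj₂ (box-of a))) (proj₂ (proj₂ (box-of b))) (h-x lt))

      -- Arcs `u - 1` and `u + 1` have the other colour, so the cuts leave the columns `u` and
      -- `u + 1`, joined by `a₀` alone.
      module OneArc (a₀ : Fin k) (u : ℕ) (arc₀ : Arc u a₀) where

        u<n = proj₁ arc₀

        col₀ : col a₀ ≡ u
        col₀ = cong proj₁ (proj₂ arc₀)

        col≤ : ∀ b → col b ≤ suc u
        col≤ b = ≮⇒≥ (cut (suc u) (λ b → no-next u arc₀) a₀ b (subst (_≤ suc u) (sym col₀) (n≤1+n u)))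

        col≥ : ∀ b → u ≤ col b
        col≥ b = go u arc₀
          where
            go : ∀ t → Arc t a₀ → t ≤ col b
            go zero _ = z≤n
            go (suc t) here = ≮⇒≥ λ lt → cut t (λ b e → no-next t e here) b a₀ (s≤s⁻¹ lt)
              (subst (λ s → t < proj₁ s) (sym (proj₂ here)) ≤-refl)

        sy₀ : sy n (h a₀) ≡ lex (suc u) (α ⟨$⟩ʳ L)
        sy₀ = trans (cong (sy n) (proj₂ arc₀)) (sy-at n (u , T) (at-arc u<n))

        Lower Upper : Fin k → Set
        Lower b = b ≢ a₀ × col b ≤ u
        Upper b = b ≢ a₀ × ¬ col b ≤ u

        lower? : Decidable Lower
        lower? b = ¬? (b ≟ᶠ a₀) ×-dec (col b ≤? u)

        upper? : Decidable Upper
        upper? b = ¬? (b ≟ᶠ a₀) ×-dec ¬? (col b ≤? u)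

        col-lower : ∀ {b} → Lower b → col b ≡ u
        col-lower {b} (_ , le) = ≤-antisym le (col≥ b)

        col-upper : ∀ {b} → Upper b → col b ≡ suc u
        col-upper {b} (_ , nle) = ≤-antisym (col≤ b) (≰⇒> nle)

        box-at : ∀ b → b ≢ a₀ → ∀ t → col b ≡ t →
          ∃ λ i → i ≢ hit (zone n t) × i ≢ miss (zone n t) × h b ≡ (t , i) × sy n (h b) ≡ lex t (α ⟨$⟩ʳ i)
        box-at b b≢ t refl with kinds b
        ... | isBox i ≢hit ≢miss eq sy≡ = i , ≢hit , ≢miss , eq , sy≡
        ... | isHook eq _ = contradiction eq (noHook b)
        ... | isArc v v<n eq _ with m≤n⇒m<n∨m≡n (col≤ b)
        ...   | inj₁ lt = contradiction (h-injective (trans eq (trans (cong (_, T) (≤-antisym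
                  (subst (_≤ u) (cong proj₁ eq) (s≤s⁻¹ lt)) (subst (u ≤_) (cong proj₁ eq) (col≥ b)))) (sym (proj₂ arc₀))))) b≢
        ...   | inj₂ c≡ = contradiction (subst (λ w → Arc w b) (trans (sym (cong proj₁ eq)) c≡) (v<n , eq)) (no-next u arc₀)

        lower-upper : ∀ {y z} → Lower y → Upper z → pos y < pos z × val y < val z
        lower-upper {y} {z} ly uz =
          let _ , _ , _ , _ , sy≡ = box-at y (proj₁ ly) u (col-lower ly)
              _ , _ , _ , _ , sy≡′ = box-at z (proj₁ uz) (suc u) (col-upper uz)
          in left (subst₂ _<_ (sym (col-lower ly)) (sym (col-upper uz)) ≤-refl) ,
             y-h (subst₂ _<_ (sym sy≡) (sym sy≡′) (lex-<ˡ {a = u} _ _ ≤-refl))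

        a₀-upper : ∀ {z} → Upper z → pos a₀ < pos z
        a₀-upper uz = left (subst₂ _<_ (sym col₀) (sym (col-upper uz)) ≤-refl)

        lower-a₀ : ∀ {y} → Lower y → val y < val a₀
        lower-a₀ {y} ly = let _ , _ , _ , _ , sy≡ = box-at y (proj₁ ly) u (col-lower ly) in
          y-h (subst₂ _<_ (sym sy≡) (sym sy₀) (lex-<ˡ {a = u} _ _ ≤-refl))

        side : ∀ b → b ≡ a₀ ⊎ Lower b ⊎ Upper b
        side b with b ≟ᶠ a₀ | col b ≤? u
        ... | yes eq | _ = inj₁ eq
        ... | no b≢ | yes le = inj₂ (inj₁ (b≢ , le))
        ... | no b≢ | no nle = inj₂ (inj₂ (b≢ , nle))

        -- a₀ plays the role of L for the boxes above it and the role of T for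
        -- the boxes below it.
        up down : Fin k → Fin k
        up b with side b
        ... | inj₁ _ = L
        ... | inj₂ (inj₁ _) = L
        ... | inj₂ (inj₂ ub) = proj₁ (box-at b (proj₁ ub) (suc u) (col-upper ub))
        down b with side b
        ... | inj₁ _ = T
        ... | inj₂ (inj₁ lb) = proj₁ (box-at b (proj₁ lb) u (col-lower lb))
        ... | inj₂ (inj₂ _) = T

        -- Now `up` reads the copy inside column `u + 1`, with `a₀` in the vacant place of `L`.
        -- Being increasing, it is the identity, but it misses the place `hit`.
        noLower : ¬ None Lower
        noLower none = up≢hit e refl (increasing-endo up inc e)
          where
            e = hit (zone n (suc u))
            L≢hit : L ≢ e
            L≢hit eq = miss≢hit (zone n (suc u)) (trans (miss-suc n u) eq)
            up≢hit : ∀ b → b ≡ e → up b ≢ b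
            up≢hit b b≡ eq with side b
            ... | inj₁ _ = L≢hit (trans eq b≡)
            ... | inj₂ (inj₁ lb) = none b lb
            ... | inj₂ (inj₂ ub) = proj₁ (proj₂ (box-at b (proj₁ ub) (suc u) (col-upper ub))) (trans eq b≡)
            inc : Increasing (toℕ ∘ up)
            inc a b lt with side a | side b
            ... | inj₂ (inj₁ la) | _ = contradiction la (none a)
            ... | _ | inj₂ (inj₁ lb) = contradiction lb (none b)
            ... | inj₁ refl | inj₁ refl = contradiction lt (<-irrefl refl)
            ... | inj₂ (inj₂ ua) | inj₁ refl = contradiction lt (<-asym (a₀-upper ua))
            ... | inj₁ _ | inj₂ (inj₂ ub) =
              L-least λ eq → proj₁ (proj₂ (proj₂ (box-at b (proj₁ ub) (suc u) (col-upper ub)))) (trans eq (sym (miss-suc n u)))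
            ... | inj₂ (inj₂ ua) | inj₂ (inj₂ ub) = lex-cancel (suc u) (subst₂ (λ s s′ → sx s < sx s′)
              (proj₁ (proj₂ (proj₂ (proj₂ (box-at a (proj₁ ua) (suc u) (col-upper ua))))))
              (proj₁ (proj₂ (proj₂ (proj₂ (box-at b (proj₁ ub) (suc u) (col-upper ub)))))) (h-x lt))

        noUpper : ¬ None Upper
        noUpper none = down≢miss e refl (increasing-endo down inc e)
          where
            e = miss (zone n u)
            down≢miss : ∀ b → b ≡ e → down b ≢ b
            down≢miss b b≡ eq with side b
            ... | inj₁ _ = miss≢hit (zone n u) (trans (trans (sym b≡) (sym eq)) (sym (hit-< u<n)))
            ... | inj₂ (inj₁ lb) = proj₁ (proj₂ (proj₂ (box-at b (proj₁ lb) u (col-lower lb)))) (trans eq b≡)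
            ... | inj₂ (inj₂ ub) = none b ub
            down-slot : ∀ b → h b ≡ (u , down b)
            down-slot b with side b
            ... | inj₁ refl = proj₂ arc₀
            ... | inj₂ (inj₁ lb) = proj₁ (proj₂ (proj₂ (proj₂ (box-at b (proj₁ lb) u (col-lower lb)))))
            ... | inj₂ (inj₂ ub) = contradiction ub (none b)
            inc : Increasing (toℕ ∘ down)
            inc a b lt = lex-cancel u (subst₂ (λ s s′ → sx s < sx s′) (down-slot a) (down-slot b) (h-x lt))

        -- The only lower point is `B`. It is not also leftmost, so `a₀` is to its left and equals
        -- `L`. All other points are to the right of `B`, against `L-B`.
        notOneLower : ¬ One Lower
        notOneLower (y , ly , unique) = finish (side e)
          where
            lowest : ∀ b → b ≢ y → val y < val b
            lowest b b≢ with side b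
            ... | inj₁ refl = lower-a₀ ly
            ... | inj₂ (inj₁ lb) = contradiction (unique b lb) b≢
            ... | inj₂ (inj₂ ub) = proj₂ (lower-upper ly ub)
            y≡B : y ≡ B
            y≡B = decidable-stable (y ≟ᶠ B) λ ne → contradiction (lowest B (ne ∘ sym)) (≤⇒≯ (B-min y))
            leftmost : pos y < pos a₀ → ∀ b → b ≢ y → pos y < pos b
            leftmost lt b b≢ with side b
            ... | inj₁ refl = lt
            ... | inj₂ (inj₁ lb) = contradiction (unique b lb) b≢
            ... | inj₂ (inj₂ ub) = proj₁ (lower-upper ly ub)
            a₀<y : pos a₀ < pos y
            a₀<y with <-cmp (pos a₀) (pos y)
            ... | tri< lt _ _ = lt
            ... | tri≈ _ eq _ = contradiction (sym (toℕ-injective eq)) (proj₁ ly)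
            ... | tri> _ _ gt with L ≟ᶠ y
            ...   | yes eq = contradiction (trans eq y≡B) L≢B
            ...   | no ne = contradiction (leftmost gt L ne) (≤⇒≯ (L-min y))
            a₀≡L : a₀ ≡ L
            a₀≡L with side L
            ... | inj₁ eq = sym eq
            ... | inj₂ (inj₁ lL) = contradiction a₀<y (≤⇒≯ (subst (λ l → pos l ≤ pos a₀) (unique L lL) (L-min a₀)))
            ... | inj₂ (inj₂ uL) = contradiction (a₀-upper uL) (≤⇒≯ (L-min a₀))
            e = proj₁ L-B
            L<e = proj₁ (proj₂ L-B)
            e<B = proj₂ (proj₂ L-B)
            finish : e ≡ a₀ ⊎ Lower e ⊎ Upper e → ⊥
            finish (inj₁ eq) = <-irrefl (cong pos (sym (trans eq a₀≡L))) L<e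
            finish (inj₂ (inj₁ le)) = <-irrefl (cong pos (trans (unique e le) y≡B)) e<B
            finish (inj₂ (inj₂ ue)) = <-asym e<B (subst (λ b → pos b < pos e) y≡B (proj₁ (lower-upper ly ue)))

        -- The only upper point is `R`. It is not also topmost, so `a₀` is above it and equals `T`,
        -- and all other points are below `R`, against `R-T`.
        notOneUpper : ¬ One Upper
        notOneUpper (z , uz , unique) = finish (side e)
          where
            rightmost : ∀ b → b ≢ z → pos b < pos z
            rightmost b b≢ with side b
            ... | inj₁ refl = a₀-upper uz
            ... | inj₂ (inj₁ lb) = proj₁ (lower-upper lb uz)
            ... | inj₂ (inj₂ ub) = contradiction (unique b ub) b≢
            z≡R : z ≡ R
            z≡R = decidable-stable (z ≟ᶠ R) λ ne → contradiction (rightmost R (ne ∘ sym)) (≤⇒≯ (R-max z))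
            topmost : val a₀ < val z → ∀ b → b ≢ z → val b < val z
            topmost lt b b≢ with side b
            ... | inj₁ refl = lt
            ... | inj₂ (inj₁ lb) = proj₂ (lower-upper lb uz)
            ... | inj₂ (inj₂ ub) = contradiction (unique b ub) b≢
            z<a₀ : val z < val a₀
            z<a₀ with <-cmp (val z) (val a₀)
            ... | tri< lt _ _ = lt
            ... | tri≈ _ eq _ = contradiction (val-injective eq) (proj₁ uz)
            ... | tri> _ _ gt with T ≟ᶠ z
            ...   | yes eq = contradiction (trans (sym z≡R) (sym eq)) R≢T
            ...   | no ne = contradiction (topmost gt T ne) (≤⇒≯ (T-max z))
            a₀≡T : a₀ ≡ T
            a₀≡T with side T
            ... | inj₁ eq = sym eq
            ... | inj₂ (inj₁ lT) = contradiction (lower-a₀ lT) (≤⇒≯ (T-max a₀))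
            ... | inj₂ (inj₂ uT) = contradiction z<a₀ (≤⇒≯ (subst (λ t → val a₀ ≤ val t) (unique T uT) (T-max a₀)))
            e = proj₁ R-T
            R<e = proj₁ (proj₂ R-T)
            e<T = proj₂ (proj₂ R-T)
            finish : e ≡ a₀ ⊎ Lower e ⊎ Upper e → ⊥
            finish (inj₁ eq) = <-irrefl (cong val (trans eq a₀≡T)) e<T
            finish (inj₂ (inj₁ le)) = <-asym R<e (subst (λ b → val e < val b) z≡R (proj₂ (lower-upper le uz)))
            finish (inj₂ (inj₂ ue)) = <-irrefl (cong val (sym (trans (unique e ue) z≡R))) R<e

        impossible : ⊥
        impossible with none-one-many lower? | none-one-many upper?
        ... | inj₁ none | _ = noLower none
        ... | inj₂ (inj₁ one) | _ = notOneLower one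
        ... | _ | inj₁ none = noUpper none
        ... | _ | inj₂ (inj₁ one) = notOneUpper one
        -- Here `a₀` would be a bottleneck between the two columns.
        ... | inj₂ (inj₂ lower) | inj₂ (inj₂ upper) = good a₀ (λ b → col b ≤? u)
          (λ a b a≢ b≢ la ub → lower-upper (a≢ , la) (b≢ , ub)) lower upper

      contradictory : ⊥
      contradictory with any? arc?
      ... | yes (a₀ , t , e) = OneArc.impossible a₀ t e
      ... | no ¬e = noArc λ a e → ¬e (a , e)

    module WithHook (g : Fin k) (g≡ : h g ≡ (n , B)) where

      c≡ : c ≡ false
      c≡ = trans (sym (trans (cong (isEven ∘ proj₁) (sym g≡)) (mono g (trans (cong (kind ∘ at n) g≡) (cong kind (at-hook 1≤n)))))) odd

      col-g : col g ≡ n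
      col-g = cong proj₁ g≡

      -- The colour of the hook admits only arcs with odd `t`. As `n` is odd, neither arc 0 nor arc
      -- `n - 1` is used, which separates columns 0 and `n` from those in between.
      arc>0 : ∀ {a} t → Arc t a → 0 < t
      arc>0 zero here with () ← trans (arc-parity 0 here) c≡
      arc>0 (suc t) _ = s≤s z≤n

      arc<n : ∀ {a} t → Arc t a → suc t < n
      arc<n t here = ≤∧≢⇒< (proj₁ here) λ { refl → contradiction (trans (sym (cong not (trans (arc-parity t here) c≡))) odd) λ () }

      rows : ∀ b → b ≢ g → ∃ λ r → ∃ λ ℓ → sy n (h b) ≡ lex r ℓ ×
        (col b ≡ 0 → r ≡ 0) × (0 < col b → 0 < r) × (col b < n → r < n) × (col b ≡ n → r ≡ n)
      rows b b≢ with kinds b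
      ... | isBox i _ _ _ sy≡ = _ , _ , sy≡ , id , id , id , id
      ... | isArc t t<n eq sy≡ = _ , _ , sy≡ , (λ z → contradiction (trans (sym (cong proj₁ eq)) z) (<⇒≢ (arc>0 t (t<n , eq)) ∘ sym)) ,
              (λ _ → s≤s z≤n) , (λ _ → arc<n t (t<n , eq)) , λ e → contradiction (trans (sym (cong proj₁ eq)) e) (<⇒≢ t<n)
      ... | isHook eq _ = contradiction (h-injective (trans eq (sym g≡))) b≢

      sy-g : sy n (h g) ≡ lex 0 (α ⟨$⟩ʳ R)
      sy-g = trans (cong (sy n) g≡) (sy-at n (n , B) (at-hook 1≤n))

      Low Mid High : Fin k → Set
      Low b = b ≢ g × col b ≡ 0
      Mid b = b ≢ g × 0 < col b × col b < n
      High b = b ≢ g × col b ≡ n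

      low? : Decidable Low
      low? b = ¬? (b ≟ᶠ g) ×-dec (col b ≟ 0)

      mid? : Decidable Mid
      mid? b = ¬? (b ≟ᶠ g) ×-dec (0 <? col b) ×-dec (col b <? n)

      high? : Decidable High
      high? b = ¬? (b ≟ᶠ g) ×-dec (col b ≟ n)

      part : ∀ b → b ≢ g → Low b ⊎ Mid b ⊎ High b
      part b b≢ with m≤n⇒m<n∨m≡n (z≤n {col b}) | m≤n⇒m<n∨m≡n (proj₁ (occupied b))
      ... | inj₂ z | _ = inj₁ (b≢ , sym z)
      ... | inj₁ pos | inj₁ lt = inj₂ (inj₁ (b≢ , pos , lt))
      ... | inj₁ _ | inj₂ e = inj₂ (inj₂ (b≢ , e))

      low-rest : ∀ {a b} → Low a → b ≢ g → 0 < col b → pos a < pos b × val a < val b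
      low-rest {a} {b} (a≢ , z) b≢ nz =
        let _ , _ , sy≡ , r0 , _ = rows a a≢
            _ , _ , sy≡′ , _ , r>0 , _ = rows b b≢
        in left (subst (_< col b) (sym z) nz) , y-h (subst₂ _<_ (sym sy≡) (sym sy≡′) (lex-<ˡ _ _ (≡-< (r0 z) (r>0 nz))))

      rest-high : ∀ {a b} → a ≢ g → col a < n → High b → pos a < pos b × val a < val b
      rest-high {a} {b} a≢ lt (b≢ , e) =
        let _ , _ , sy≡ , _ , _ , r<n , _ = rows a a≢
            _ , _ , sy≡′ , _ , _ , _ , r≡n = rows b b≢
        in left (subst (col a <_) (sym e) lt) , y-h (subst₂ _<_ (sym sy≡) (sym sy≡′) (lex-<ˡ _ _ (<-≡ (r≡n e) (r<n lt))))

      g-right : ∀ {b} → col b < n → pos b < pos g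
      g-right {b} lt = left (subst (col b <_) (sym col-g) lt)

      g-under : ∀ {b} → b ≢ g → 0 < col b → val g < val b
      g-under {b} b≢ nz = let _ , _ , sy≡ , _ , r>0 , _ = rows b b≢ in
        y-h (subst₂ _<_ (sym sy-g) (sym sy≡) (lex-<ˡ _ _ (r>0 nz)))

      low<n : ∀ {b} → Low b → col b < n
      low<n (_ , z) = subst (_< n) (sym z) 1≤n

      high>0 : ∀ {b} → High b → 0 < col b
      high>0 (_ , e) = subst (0 <_) (sym e) 1≤n

      -- The hook is to the right of and below all middle points, low points come before them and
      -- high points after them in both orders. So nothing splits the middle part.
      notManyMid : ¬ Many Mid
      notManyMid many = no-interval mid? many (g , λ m → proj₁ m refl) xc yc
        where
          xc : ∀ x y z → Mid x → Mid y → ¬ Mid z → pos x < pos z → ¬ pos z < pos y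
          xc x y z (x≢ , x>0 , _) (y≢ , _ , y<n) ¬mz x<z z<y with z ≟ᶠ g
          ... | yes refl = <-asym z<y (g-right y<n)
          ... | no z≢ with part z z≢
          ...   | inj₁ lz = <-asym x<z (proj₁ (low-rest lz x≢ x>0))
          ...   | inj₂ (inj₁ mz) = ¬mz mz
          ...   | inj₂ (inj₂ hz) = <-asym z<y (proj₁ (rest-high y≢ y<n hz))
          yc : ∀ x y z → Mid x → Mid y → ¬ Mid z → val x < val z → ¬ val z < val y
          yc x y z (x≢ , x>0 , _) (y≢ , _ , y<n) ¬mz x<z z<y with z ≟ᶠ g
          ... | yes refl = <-asym x<z (g-under x≢ x>0)
          ... | no z≢ with part z z≢
          ...   | inj₁ lz = <-asym x<z (proj₂ (low-rest lz x≢ x>0))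
          ...   | inj₂ (inj₁ mz) = ¬mz mz
          ...   | inj₂ (inj₂ hz) = <-asym z<y (proj₂ (rest-high y≢ y<n hz))

      -- Such a `y` is `L`, and nothing but the hook can be below it. However, `B` and the point
      -- given by `B-L` are both below `L`.
      noCorner-low : ∀ y → pos y < pos g → ¬ (∀ b → b ≢ y → b ≢ g → pos y < pos b × val y < val b)
      noCorner-low y y<g before = finish (B ≟ᶠ y) (B ≟ᶠ g)
        where
          y≡L : y ≡ L
          y≡L with y ≟ᶠ L | L ≟ᶠ g
          ... | yes eq | _ = eq
          ... | no _ | yes eq = contradiction y<g (≤⇒≯ (subst (λ l → pos l ≤ pos y) eq (L-min y)))
          ... | no ne | no L≢g = contradiction (proj₁ (before L (ne ∘ sym) L≢g)) (≤⇒≯ (L-min y))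
          e = proj₁ B-L
          B<e = proj₁ (proj₂ B-L)
          e<y : val e < val y
          e<y = subst (λ l → val e < val l) (sym y≡L) (proj₂ (proj₂ B-L))
          e≡g : e ≡ g
          e≡g = decidable-stable (e ≟ᶠ g) λ ne → <-asym e<y (proj₂ (before e (λ eq → <-irrefl (cong val eq) e<y) ne))
          finish : Dec (B ≡ y) → Dec (B ≡ g) → ⊥
          finish (yes eq) _ = <-irrefl (cong val eq) (<-trans B<e e<y)
          finish _ (yes eq) = <-irrefl (cong val (trans eq (sym e≡g))) B<e
          finish (no B≢y) (no B≢g) = <-asym (<-trans B<e e<y) (proj₂ (before B B≢y B≢g))

      -- Such a `z` is `T`, and nothing but the hook can be to its right. However, `R` and the point
      -- given by `T-R` both are.
      noCorner-high : ∀ z → val g < val z → ¬ (∀ b → b ≢ z → b ≢ g → pos b < pos z × val b < val z)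
      noCorner-high z g<z after = finish (R ≟ᶠ z) (R ≟ᶠ g)
        where
          z≡T : z ≡ T
          z≡T with z ≟ᶠ T | T ≟ᶠ g
          ... | yes eq | _ = eq
          ... | no _ | yes eq = contradiction g<z (≤⇒≯ (subst (λ t → val z ≤ val t) eq (T-max z)))
          ... | no ne | no T≢g = contradiction (proj₂ (after T (ne ∘ sym) T≢g)) (≤⇒≯ (T-max z))
          e = proj₁ T-R
          z<e : pos z < pos e
          z<e = subst (λ t → pos t < pos e) (sym z≡T) (proj₁ (proj₂ T-R))
          e<R = proj₂ (proj₂ T-R)
          e≡g : e ≡ g
          e≡g = decidable-stable (e ≟ᶠ g) λ ne → <-asym z<e (proj₁ (after e (λ eq → <-irrefl (cong pos (sym eq)) z<e) ne))
          finish : Dec (R ≡ z) → Dec (R ≡ g) → ⊥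
          finish (yes eq) _ = <-irrefl (cong pos (sym eq)) (<-trans z<e e<R)
          finish _ (yes eq) = <-irrefl (cong pos (trans e≡g (sym eq))) e<R
          finish (no R≢z) (no R≢g) = <-asym (<-trans z<e e<R) (proj₁ (after R R≢z R≢g))

      notOneLow : ¬ One Low
      notOneLow (y , ly , unique) = noCorner-low y (g-right (low<n ly)) before
        where
          before : ∀ b → b ≢ y → b ≢ g → pos y < pos b × val y < val b
          before b b≢y b≢g with part b b≢g
          ... | inj₁ lb = contradiction (unique b lb) b≢y
          ... | inj₂ (inj₁ (_ , b>0 , _)) = low-rest ly b≢g b>0
          ... | inj₂ (inj₂ hb) = low-rest ly b≢g (high>0 hb)

      notOneHigh : ¬ One High
      notOneHigh (z , hz , unique) = noCorner-high z (g-under (proj₁ hz) (high>0 hz)) after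
        where
          after : ∀ b → b ≢ z → b ≢ g → pos b < pos z × val b < val z
          after b b≢z b≢g with part b b≢g
          ... | inj₁ lb = rest-high b≢g (low<n lb) hz
          ... | inj₂ (inj₁ (_ , _ , b<n)) = rest-high b≢g b<n hz
          ... | inj₂ (inj₂ hb) = contradiction (unique b hb) b≢z

      noLow : ¬ None Low
      noLow none with none-one-many mid?
      ... | inj₂ (inj₂ many) = notManyMid many
      ... | inj₂ (inj₁ (m , mm , unique)) = noCorner-low m (g-right (proj₂ (proj₂ mm))) before
        where
          before : ∀ b → b ≢ m → b ≢ g → pos m < pos b × val m < val b
          before b b≢m b≢g with part b b≢g
          ... | inj₁ lb = contradiction lb (none b)
          ... | inj₂ (inj₁ mb) = contradiction (unique b mb) b≢m
          ... | inj₂ (inj₂ hb) = rest-high (proj₁ mm) (proj₂ (proj₂ mm)) hb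
      -- Everything, including the hook, stands in column `n`, where the place of `L` is vacant.
      ... | inj₁ none′ = place≢L (kinds L) (increasing-endo place inc L)
        where
          place = proj₂ ∘ h
          slots : ∀ b → col b ≡ n
          slots b with b ≟ᶠ g
          ... | yes refl = col-g
          ... | no b≢ with part b b≢
          ...   | inj₁ lb = contradiction lb (none b)
          ...   | inj₂ (inj₁ mb) = contradiction mb (none′ b)
          ...   | inj₂ (inj₂ (_ , e)) = e
          inc : Increasing (toℕ ∘ place)
          inc a b lt = lex-cancel n (subst₂ _<_ (cong (λ t → lex t (place a)) (slots a)) (cong (λ t → lex t (place b)) (slots b)) (h-x lt))
          place≢L : Kinds L → place L ≢ L
          place≢L (isBox i _ ≢miss eq _) e = ≢miss (trans (sym (cong proj₂ eq)) (trans e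
            (sym (trans (cong (miss ∘ zone n) (slots L)) (cong miss (zone-last 1≤n))))))
          place≢L (isArc t t<n eq _) _ = <⇒≢ t<n (trans (sym (cong proj₁ eq)) (slots L))
          place≢L (isHook eq _) e = L≢B (trans (sym e) (cong proj₂ eq))

      noHigh : ¬ None High
      noHigh none with none-one-many mid?
      ... | inj₂ (inj₂ many) = notManyMid many
      ... | inj₂ (inj₁ (m , mm , unique)) = noCorner-high m (g-under (proj₁ mm) (proj₁ (proj₂ mm))) after
        where
          after : ∀ b → b ≢ m → b ≢ g → pos b < pos m × val b < val m
          after b b≢m b≢g with part b b≢g
          ... | inj₁ lb = low-rest lb (proj₁ mm) (proj₁ (proj₂ mm))
          ... | inj₂ (inj₁ mb) = contradiction (unique b mb) b≢m
          ... | inj₂ (inj₂ hb) = contradiction hb (none b)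
      -- The hook plays `R` and the rest stands in column 0, where arc 0, the only point in the
      -- place of `T`, has the other colour.
      ... | inj₁ none′ = place≢T T refl (increasing-endo place inc T)
        where
          box-of : ∀ b → b ≢ g → ∃ λ i → i ≢ T × i ≢ R × h b ≡ (0 , i)
          box-of b b≢ with part b b≢
          ... | inj₂ (inj₁ mb) = contradiction mb (none′ b)
          ... | inj₂ (inj₂ hb) = contradiction hb (none b)
          ... | inj₁ (_ , z) with kinds b
          ...   | isBox i ≢hit ≢miss eq _ = i , subst (λ t → i ≢ hit (zone n t)) z ≢hit ,
                    subst (λ t → i ≢ miss (zone n t)) z ≢miss , trans eq (cong (_, i) z)
          ...   | isArc t t<n eq _ = contradiction (trans (sym z) (cong proj₁ eq)) (<⇒≢ (arc>0 t (t<n , eq)))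
          ...   | isHook eq _ = contradiction (h-injective (trans eq (sym g≡))) b≢
          place : Fin k → Fin k
          place b with b ≟ᶠ g
          ... | yes _ = R
          ... | no b≢ = proj₁ (box-of b b≢)
          place≢T : ∀ b → b ≡ T → place b ≢ b
          place≢T b b≡ e with b ≟ᶠ g
          ... | yes _ = R≢T (trans e b≡)
          ... | no b≢ = proj₁ (proj₂ (box-of b b≢)) (trans e b≡)
          inc : Increasing (toℕ ∘ place)
          inc a b lt with a ≟ᶠ g | b ≟ᶠ g
          ... | yes refl | yes refl = contradiction lt (<-irrefl refl)
          ... | yes refl | no b≢ = contradiction lt (<-asym (g-right (subst (_< n) (sym (cong proj₁ (proj₂ (proj₂ (proj₂ (box-of b b≢)))))) 1≤n)))
          ... | no a≢ | yes _ = R-greatest (proj₁ (proj₂ (proj₂ (box-of a a≢))))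
          ... | no a≢ | no b≢ = lex-cancel 0 (subst₂ (λ s s′ → sx s < sx s′)
            (proj₂ (proj₂ (proj₂ (box-of a a≢)))) (proj₂ (proj₂ (proj₂ (box-of b b≢)))) (h-x lt))

      contradictory : ⊥
      contradictory with none-one-many low? | none-one-many high?
      ... | inj₁ none | _ = noLow none
      ... | inj₂ (inj₁ one) | _ = notOneLow one
      ... | _ | inj₁ none = noHigh none
      ... | _ | inj₂ (inj₁ one) = notOneHigh one
      -- Here the hook would be a bottleneck between column 0 and the rest.
      ... | inj₂ (inj₂ low) | inj₂ (inj₂ (a , b , a≢b , ha , hb)) = good g (λ b → col b ≟ 0)
        (λ a b a≢ b≢ a0 b0 → low-rest (a≢ , a0) b≢ (n≢0⇒n>0 b0)) low
        (a , b , a≢b , (proj₁ ha , n>0⇒n≢0 (high>0 ha)) , proj₁ hb , n>0⇒n≢0 (high>0 hb))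

    impossible : ⊥
    impossible with any? (λ a → ≡-dec _≟_ _≟ᶠ_ (h a) (n , B))
    ... | yes (g , eq) = WithHook.contradictory g eq
    ... | no ¬e = NoHook.contradictory λ a eq → ¬e (a , eq)

  staircase-notDefinable : ¬ FODefinable (Av α ⊙ Av α)
  staircase-notDefinable = notDefinable separated uncolourable λ m 1≤m → isEven ∘ proj₁ ,
    λ c h follows occupied mono → Skeleton.impossible (s≤s z≤n) (cong not (isEven-double m)) follows occupied mono

-- Symmetries of the square.

complement : ∀ {n} → Perm n → Perm n
complement π = π ∘ₚ reverse

opposite-< : ∀ {n} (x y : Fin n) → (toℕ (opposite x) < toℕ (opposite y)) ⇔ (toℕ y < toℕ x)
opposite-< x y = mk⇔ (reflects-< x y) (mono x y)
  where
    mono : ∀ {n} (x y : Fin n) → toℕ y < toℕ x → toℕ (opposite x) < toℕ (opposite y)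
    mono x y lt = subst₂ _<_ (sym (opposite-prop x)) (sym (opposite-prop y)) (∸-monoʳ-< (s≤s lt) (toℕ<n x))
    reflects-< : ∀ {n} (x y : Fin n) → toℕ (opposite x) < toℕ (opposite y) → toℕ y < toℕ x
    reflects-< x y lt with <-cmp (toℕ y) (toℕ x)
    ... | tri< l _ _ = l
    ... | tri≈ _ e _ = contradiction lt (<-irrefl (cong (toℕ ∘ opposite) (sym (toℕ-injective e))))
    ... | tri> _ _ g = contradiction lt (<-asym (mono y x g))

complementFormula inverseFormula : ∀ {m} → Formula m → Formula m
complementFormula (i ≐ j) = i ≐ j
complementFormula (i <₁ j) = i <₁ j
complementFormula (i <₂ j) = j <₂ i
complementFormula (¬' φ) = ¬' complementFormula φ
complementFormula (φ ∧' ψ) = complementFormula φ ∧' complementFormula ψ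
complementFormula (∃' φ) = ∃' (complementFormula φ)
inverseFormula (i ≐ j) = i ≐ j
inverseFormula (i <₁ j) = i <₂ j
inverseFormula (i <₂ j) = i <₁ j
inverseFormula (¬' φ) = ¬' inverseFormula φ
inverseFormula (φ ∧' ψ) = inverseFormula φ ∧' inverseFormula ψ
inverseFormula (∃' φ) = ∃' (inverseFormula φ)

sat-∃ : ∀ {n n′ m m′} (π : Perm n) (π′ : Perm n′) {ρ : Fin m → Fin n} {ρ′ : Fin m′ → Fin n′} {φ φ′} →
  (∀ x → ∃ λ x′ → sat π (extend ρ x) φ ≡ sat π′ (extend ρ′ x′) φ′) →
  (∀ x′ → ∃ λ x → sat π (extend ρ x) φ ≡ sat π′ (extend ρ′ x′) φ′) → sat π ρ (∃' φ) ≡ sat π′ ρ′ (∃' φ′)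
sat-∃ π π′ {ρ} {ρ′} {φ} {φ′} forth back = bool-ext
  (λ t → let x , s = to (any-tabulate (λ x → sat π (extend ρ x) φ) id) t
             x′ , eq = forth x
         in from (any-tabulate (λ x → sat π′ (extend ρ′ x) φ′) id) (x′ , trans (sym eq) s))
  (λ t → let x′ , s = to (any-tabulate (λ x → sat π′ (extend ρ′ x) φ′) id) t
             x , eq = back x′
         in from (any-tabulate (λ x → sat π (extend ρ x) φ) id) (x , trans eq s))

sat-complement : ∀ {n m} (π : Perm n) (ρ : Fin m → Fin n) φ → sat (complement π) ρ φ ≡ sat π ρ (complementFormula φ)
sat-complement π ρ (i ≐ j) = refl
sat-complement π ρ (i <₁ j) = refl
sat-complement π ρ (i <₂ j) = does-⇔ (opposite-< (π ⟨$⟩ʳ ρ i) (π ⟨$⟩ʳ ρ j)) (_ <?ᶠ _) ((π ⟨$⟩ʳ ρ j) <?ᶠ (π ⟨$⟩ʳ ρ i))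
sat-complement π ρ (¬' φ) = cong not (sat-complement π ρ φ)
sat-complement π ρ (φ ∧' ψ) = cong₂ _∧_ (sat-complement π ρ φ) (sat-complement π ρ ψ)
sat-complement π ρ (∃' φ) = sat-∃ (complement π) π {ρ} {ρ} {φ} {complementFormula φ} (λ x → x , sat-complement π (extend ρ x) φ)
  (λ x → x , sat-complement π (extend ρ x) φ)

-- Elements of the structure are positions, and those of the inverse are the values of `π`; so
-- assignments have to be translated along `π`, too.
sat-inverse : ∀ {n m} (π : Perm n) (ρ ρ′ : Fin m → Fin n) → (∀ i → π ⟨$⟩ʳ ρ′ i ≡ ρ i) → ∀ φ →
  sat (flip π) ρ φ ≡ sat π ρ′ (inverseFormula φ)
sat-inverse π ρ ρ′ eq (i ≐ j) = does-⇔
  (mk⇔ (λ e → perm-injective π (trans (eq i) (trans e (sym (eq j))))) (λ e → trans (sym (eq i)) (trans (cong (π ⟨$⟩ʳ_) e) (eq j))))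
  (ρ i ≟ᶠ ρ j) (ρ′ i ≟ᶠ ρ′ j)
sat-inverse π ρ ρ′ eq (i <₁ j) = cong₂ (λ x y → does (x <?ᶠ y)) (sym (eq i)) (sym (eq j))
sat-inverse π ρ ρ′ eq (i <₂ j) = cong₂ (λ x y → does (x <?ᶠ y)) (back i) (back j)
  where
    back : ∀ i → π ⟨$⟩ˡ ρ i ≡ ρ′ i
    back i = trans (cong (π ⟨$⟩ˡ_) (sym (eq i))) (inverseˡ π)
sat-inverse π ρ ρ′ eq (¬' φ) = cong not (sat-inverse π ρ ρ′ eq φ)
sat-inverse π ρ ρ′ eq (φ ∧' ψ) = cong₂ _∧_ (sat-inverse π ρ ρ′ eq φ) (sat-inverse π ρ ρ′ eq ψ)
sat-inverse π ρ ρ′ eq (∃' φ) = sat-∃ (flip π) π {ρ} {ρ′} {φ} {inverseFormula φ}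
  (λ x → π ⟨$⟩ˡ x , sat-inverse π (extend ρ x) (extend ρ′ (π ⟨$⟩ˡ x)) (λ { zero → inverseʳ π ; (suc i) → eq i }) φ)
  (λ x′ → π ⟨$⟩ʳ x′ , sat-inverse π (extend ρ (π ⟨$⟩ʳ x′)) (extend ρ′ x′) (λ { zero → refl ; (suc i) → eq i }) φ)

monoFree-complement : ∀ {k n} (α : Perm k) (π : Perm n) red → MonoFree α (complement π) red ⇔ MonoFree (complement α) π red
monoFree-complement α π red = mk⇔
  (λ free c f (inc , val) → free c f (inc , λ i j →
    ⇔-sym (opposite-< (π ⟨$⟩ʳ f i) (π ⟨$⟩ʳ f j)) ⇔-∘ (val j i ⇔-∘ ⇔-sym (opposite-< (α ⟨$⟩ʳ j) (α ⟨$⟩ʳ i)))))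
  (λ free c f (inc , val) → free c f (inc , λ i j →
    opposite-< (π ⟨$⟩ʳ f j) (π ⟨$⟩ʳ f i) ⇔-∘ (val j i ⇔-∘ opposite-< (α ⟨$⟩ʳ i) (α ⟨$⟩ʳ j))))

-- One implication is enough, as the converse is the same statement for `flip α` and `flip π`.
monoFree-inverse : ∀ {k n} (α : Perm k) (π : Perm n) red → MonoFree α (flip π) red →
  MonoFree (flip α) π (red ∘ (π ⟨$⟩ʳ_))
monoFree-inverse α π red free c f (inc , val) mono = free c f′
  ( (λ a b lt → to (val (α ⟨$⟩ʳ a) (α ⟨$⟩ʳ b)) (subst₂ (λ u v → toℕ u < toℕ v) (sym (inverseˡ α)) (sym (inverseˡ α)) lt))
  , (λ a b → mk⇔ (λ lt → subst₂ (λ u v → toℕ u < toℕ v) (sym (inverseˡ π)) (sym (inverseˡ π)) (inc _ _ lt))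
      (λ lt → increasing-reflects (toℕ ∘ f) inc _ _ (subst₂ (λ u v → toℕ u < toℕ v) (inverseˡ π) (inverseˡ π) lt))))
  λ a → mono (α ⟨$⟩ʳ a)
  where
    f′ = λ a → π ⟨$⟩ʳ f (α ⟨$⟩ʳ a)

Undefinable : ∀ {k} → Perm k → Set
Undefinable α = ¬ FODefinable (Av α ⊙ Av α)

undefinable-complement : ∀ {k} (α : Perm k) → Undefinable (complement α) → Undefinable α
undefinable-complement α undef (φ , defines) = undef (complementFormula φ , λ n π → mk⇔
  (λ s → let red , free = ⊙⇒monoFree α (complement π) (to (defines n (complement π)) (trans (sat-complement π _ φ) s))
         in monoFree⇒⊙ (complement α) π (red , to (monoFree-complement α π red) free))
  (λ mem → let red , free = ⊙⇒monoFree (complement α) π mem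
           in trans (sym (sat-complement π _ φ)) (from (defines n (complement π))
                (monoFree⇒⊙ α (complement π) (red , from (monoFree-complement α π red) free)))))

undefinable-inverse : ∀ {k} (α : Perm k) → Undefinable (flip α) → Undefinable α
undefinable-inverse α undef (φ , defines) = undef (inverseFormula φ , λ n π → mk⇔
  (λ s → let red , free = ⊙⇒monoFree α (flip π) (to (defines n (flip π)) (trans (sat-inverse π _ _ (λ ()) φ) s))
         in monoFree⇒⊙ (flip α) π (red ∘ (π ⟨$⟩ʳ_) , monoFree-inverse α π red free))
  (λ mem → let red , free = ⊙⇒monoFree (flip α) π mem
           in trans (sym (sat-inverse π _ _ (λ ()) φ)) (from (defines n (flip π))
                (monoFree⇒⊙ α (flip π) (red ∘ (π ⟨$⟩ˡ_) , monoFree-inverse (flip α) (flip π) red free)))))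

simple-complement : ∀ {k} (α : Perm k) → Simple α → Simple (complement α)
simple-complement α simple a ℓ 2≤ℓ ℓ<k le interval = simple a ℓ 2≤ℓ ℓ<k le λ x y p xi yi pi (lt , gt) →
  interval y x p yi xi pi (from (opposite-< (α ⟨$⟩ʳ y) (α ⟨$⟩ʳ p)) gt , from (opposite-< (α ⟨$⟩ʳ p) (α ⟨$⟩ʳ x)) lt)

-- A block of positions of `flip α` is a set of points of `α` with consecutive values. If it is an
-- interval of `flip α`, these points also have consecutive positions.
simple-inverse : ∀ {k} (α : Perm k) → Simple α → Simple (flip α)
simple-inverse {k} α simple a ℓ 2≤ℓ ℓ<k le interval = no-interval P? (x , y , x≢y , px , py) outside xc yc
  where
    open Simplicity α simple
    P : Fin k → Set
    P i = InBlock a ℓ (α ⟨$⟩ʳ i)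
    P? : Decidable P
    P? i = (a ≤? val i) ×-dec (val i <? a + ℓ)
    withVal : ∀ v → v < k → ∃ λ i → val i ≡ v
    withVal v lt = α ⟨$⟩ˡ fromℕ< lt , trans (cong toℕ (inverseʳ α)) (toℕ-fromℕ< lt)
    a+1<a+ℓ : suc a < a + ℓ
    a+1<a+ℓ = subst (_≤ a + ℓ) (+-comm a 2) (+-monoʳ-≤ a 2≤ℓ)
    X = withVal a (≤-trans (<⇒≤ a+1<a+ℓ) le)
    Y = withVal (suc a) (≤-trans a+1<a+ℓ le)
    x = proj₁ X
    y = proj₁ Y
    x≢y : x ≢ y
    x≢y eq = contradiction (trans (sym (proj₂ X)) (trans (cong val eq) (proj₂ Y))) (<⇒≢ ≤-refl)
    px : P x
    px = ≤-reflexive (sym (proj₂ X)) , subst (_< a + ℓ) (sym (proj₂ X)) (<⇒≤ a+1<a+ℓ)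
    py : P y
    py = subst (a ≤_) (sym (proj₂ Y)) (n≤1+n a) , subst (_< a + ℓ) (sym (proj₂ Y)) a+1<a+ℓ
    outside : ∃ (¬_ ∘ P)
    outside with a ≟ 0
    ... | yes refl = let z , eq = withVal ℓ ℓ<k in z , λ (_ , lt) → <-irrefl eq lt
    ... | no a≢0 = let z , eq = withVal 0 (≤-trans (s≤s z≤n) ℓ<k) in
      z , λ (le , _) → contradiction (subst (a ≤_) eq le) (<⇒≱ (n≢0⇒n>0 a≢0))
    xc : ∀ x y z → P x → P y → ¬ P z → pos x < pos z → ¬ pos z < pos y
    xc x y z px py ¬pz lt gt = interval (α ⟨$⟩ʳ x) (α ⟨$⟩ʳ y) (α ⟨$⟩ʳ z) px py ¬pz
      (subst₂ (λ u v → toℕ u < toℕ v) (sym (inverseˡ α)) (sym (inverseˡ α)) lt ,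
       subst₂ (λ u v → toℕ u < toℕ v) (sym (inverseˡ α)) (sym (inverseˡ α)) gt)
    yc : ∀ x y z → P x → P y → ¬ P z → val x < val z → ¬ val z < val y
    yc x y z (a≤x , _) (_ , y<) ¬pz lt gt = ¬pz (≤-trans a≤x (<⇒≤ lt) , <-trans gt y<)

-- Empty gaps between extreme points.

module _ {k : ℕ} where

  Between : (Fin k → ℕ) → Fin k → Fin k → Set
  Between u a b = ∃ λ e → u a < u e × u e < u b

  between? : ∀ u a b → Dec (Between u a b)
  between? u a b = any? λ e → (u a <? u e) ×-dec (u e <? u b)

  fourth : 4 ≤ k → (a b c : Fin k) → ∃ λ d → d ≢ a × d ≢ b × d ≢ c
  fourth 4≤k a b c with any? (λ d → ¬? (d ≟ᶠ a) ×-dec ¬? (d ≟ᶠ b) ×-dec ¬? (d ≟ᶠ c))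
  ... | yes found = found
  ... | no none = contradiction (injective⇒≤ {f = f} f-injective) (<⇒≱ 4≤k)
    where
      known : ∀ d → d ≡ a ⊎ d ≡ b ⊎ d ≡ c
      known d with d ≟ᶠ a | d ≟ᶠ b | d ≟ᶠ c
      ... | yes e | _ | _ = inj₁ e
      ... | no _ | yes e | _ = inj₂ (inj₁ e)
      ... | no _ | no _ | yes e = inj₂ (inj₂ e)
      ... | no d≢a | no d≢b | no d≢c = contradiction (d , d≢a , d≢b , d≢c) none
      f : Fin k → Fin 3
      f d with known d
      ... | inj₁ _ = zero
      ... | inj₂ (inj₁ _) = suc zero
      ... | inj₂ (inj₂ _) = suc (suc zero)
      f-injective : ∀ {d d′} → f d ≡ f d′ → d ≡ d′
      f-injective {d} {d′} eq with known d | known d′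
      ... | inj₁ e | inj₁ e′ = trans e (sym e′)
      ... | inj₂ (inj₁ e) | inj₂ (inj₁ e′) = trans e (sym e′)
      ... | inj₂ (inj₂ e) | inj₂ (inj₂ e′) = trans e (sym e′)
      f-injective () | inj₁ _ | inj₂ (inj₁ _)
      f-injective () | inj₁ _ | inj₂ (inj₂ _)
      f-injective () | inj₂ (inj₁ _) | inj₁ _
      f-injective () | inj₂ (inj₁ _) | inj₂ (inj₂ _)
      f-injective () | inj₂ (inj₂ _) | inj₁ _
      f-injective () | inj₂ (inj₂ _) | inj₂ (inj₁ _)

  module _ (u : Fin k → ℕ) (u-injective : ∀ {a b} → u a ≡ u b → a ≡ b) where

    -- A fourth point would have to lie in one of the two gaps.
    no-three : 4 ≤ k → ∀ {lo mid hi} → (∀ a → u lo ≤ u a) → (∀ a → u a ≤ u hi) →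
      ¬ Between u lo mid → ¬ Between u mid hi → ⊥
    no-three 4≤k {lo} {mid} {hi} min max gap₁ gap₂ with fourth 4≤k lo mid hi
    ... | d , d≢lo , d≢mid , d≢hi with <-cmp (u d) (u mid)
    ...   | tri< lt _ _ = gap₁ (d , ≤∧≢⇒< (min d) (d≢lo ∘ sym ∘ u-injective) , lt)
    ...   | tri≈ _ eq _ = d≢mid (u-injective eq)
    ...   | tri> _ _ gt = gap₂ (d , gt , ≤∧≢⇒< (max d) (d≢hi ∘ u-injective))

    same-predecessor : ∀ {a b hi} → u a < u hi → u b < u hi → ¬ Between u a hi → ¬ Between u b hi → a ≡ b
    same-predecessor {a} {b} a< b< gap₁ gap₂ with <-cmp (u a) (u b)
    ... | tri< lt _ _ = contradiction (b , lt , b<) gap₁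
    ... | tri≈ _ eq _ = u-injective eq
    ... | tri> _ _ gt = contradiction (a , gt , a<) gap₂

    same-successor : ∀ {a b lo} → u lo < u a → u lo < u b → ¬ Between u lo a → ¬ Between u lo b → a ≡ b
    same-successor {a} {b} <a <b gap₁ gap₂ with <-cmp (u a) (u b)
    ... | tri< lt _ _ = contradiction (a , <a , lt) gap₂
    ... | tri≈ _ eq _ = u-injective eq
    ... | tri> _ _ gt = contradiction (b , <b , gt) gap₁

extremes : ∀ {k} (α : Perm k) → 1 ≤ k → Extremes α
extremes {suc k} α _ = record
  { L = zero ; R = fromℕ k ; T = α ⟨$⟩ˡ fromℕ k ; B = α ⟨$⟩ˡ zero
  ; L-min = λ _ → z≤n
  ; R-max = ≤fromℕ
  ; T-max = λ a → subst (λ v → toℕ (α ⟨$⟩ʳ a) ≤ toℕ v) (sym (inverseʳ α)) (≤fromℕ (α ⟨$⟩ʳ a))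
  ; B-min = λ a → subst (λ v → toℕ v ≤ toℕ (α ⟨$⟩ʳ a)) (sym (inverseʳ α)) z≤n
  }

opposite-≤ : ∀ {n} (x y : Fin n) → toℕ y ≤ toℕ x → toℕ (opposite x) ≤ toℕ (opposite y)
opposite-≤ x y le = ≮⇒≥ λ lt → contradiction le (<⇒≱ (to (opposite-< y x) lt))

extremes-complement : ∀ {k} {α : Perm k} → Extremes α → Extremes (complement α)
extremes-complement {α = α} E = record
  { L = L ; R = R ; T = B ; B = T ; L-min = L-min ; R-max = R-max
  ; T-max = λ a → opposite-≤ (α ⟨$⟩ʳ a) (α ⟨$⟩ʳ B) (B-min a)
  ; B-min = λ a → opposite-≤ (α ⟨$⟩ʳ T) (α ⟨$⟩ʳ a) (T-max a)
  }
  where open Extremes E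

extremes-inverse : ∀ {k} {α : Perm k} → Extremes α → Extremes (flip α)
extremes-inverse {α = α} E = record
  { L = α ⟨$⟩ʳ B ; R = α ⟨$⟩ʳ T ; T = α ⟨$⟩ʳ R ; B = α ⟨$⟩ʳ L
  ; L-min = λ a → subst (λ v → toℕ (α ⟨$⟩ʳ B) ≤ toℕ v) (inverseʳ α) (B-min (α ⟨$⟩ˡ a))
  ; R-max = λ a → subst (λ v → toℕ v ≤ toℕ (α ⟨$⟩ʳ T)) (inverseʳ α) (T-max (α ⟨$⟩ˡ a))
  ; T-max = λ a → subst (λ v → toℕ (α ⟨$⟩ˡ a) ≤ toℕ v) (sym (inverseˡ α)) (R-max (α ⟨$⟩ˡ a))
  ; B-min = λ a → subst (λ v → toℕ v ≤ toℕ (α ⟨$⟩ˡ a)) (sym (inverseˡ α)) (L-min (α ⟨$⟩ˡ a))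
  }
  where open Extremes E

valueOf : ∀ {k} → Perm k → Fin k → ℕ
valueOf α a = toℕ (α ⟨$⟩ʳ a)

between-complement : ∀ {k} (α : Perm k) a b → Between (valueOf (complement α)) a b ⇔ Between (valueOf α) b a
between-complement α a b = mk⇔
  (λ (e , lt , gt) → e , to (opposite-< (α ⟨$⟩ʳ e) (α ⟨$⟩ʳ b)) gt , to (opposite-< (α ⟨$⟩ʳ a) (α ⟨$⟩ʳ e)) lt)
  (λ (e , lt , gt) → e , from (opposite-< (α ⟨$⟩ʳ a) (α ⟨$⟩ʳ e)) gt , from (opposite-< (α ⟨$⟩ʳ e) (α ⟨$⟩ʳ b)) lt)

between-inverse-pos : ∀ {k} (α : Perm k) a b → Between toℕ (α ⟨$⟩ʳ a) (α ⟨$⟩ʳ b) → Between (valueOf α) a b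
between-inverse-pos α a b (e , lt , gt) = α ⟨$⟩ˡ e ,
  subst (λ v → toℕ (α ⟨$⟩ʳ a) < toℕ v) (sym (inverseʳ α)) lt , subst (λ v → toℕ v < toℕ (α ⟨$⟩ʳ b)) (sym (inverseʳ α)) gt

between-inverse-val : ∀ {k} (α : Perm k) a b → Between (valueOf (flip α)) (α ⟨$⟩ʳ a) (α ⟨$⟩ʳ b) → Between toℕ a b
between-inverse-val α a b (e , lt , gt) = α ⟨$⟩ˡ e ,
  subst (λ v → toℕ v < toℕ (α ⟨$⟩ˡ e)) (inverseˡ α) lt , subst (λ v → toℕ (α ⟨$⟩ˡ e) < toℕ v) (inverseˡ α) gt

-- The eight cases are the images of the first one under the symmetries of the
-- square.
module _ {k : ℕ} (4≤k : 4 ≤ k) where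

  Claim : (∀ {α : Perm k} → Extremes α → Set) → Set
  Claim P = ∀ (α : Perm k) → Simple α → (E : Extremes α) → P E → Undefinable α

  via-complement : ∀ {P Q : ∀ {α : Perm k} → Extremes α → Set} →
    (∀ {α} (E : Extremes α) → Q E → P (extremes-complement E)) → Claim P → Claim Q
  via-complement conv claim α simple E q = undefinable-complement α
    (claim (complement α) (simple-complement α simple) (extremes-complement E) (conv E q))

  via-inverse : ∀ {P Q : ∀ {α : Perm k} → Extremes α → Set} →
    (∀ {α} (E : Extremes α) → Q E → P (extremes-inverse E)) → Claim P → Claim Q
  via-inverse conv claim α simple E q = undefinable-inverse α
    (claim (flip α) (simple-inverse α simple) (extremes-inverse E) (conv E q))

  -- The first two letters name a gap in position, the last two a gap in value. Each condition
  -- combines one gap from `Spread` with a gap in the other direction that the complement would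
  -- need.
  TR-LT BR-BL BR-RT TR-BR LB-LT LT-BL LT-RT LB-BR : ∀ {α : Perm k} → Extremes α → Set
  TR-LT {α} E = ¬ Between toℕ T R × ¬ Between (valueOf α) L T where open Extremes E
  BR-BL {α} E = ¬ Between toℕ B R × ¬ Between (valueOf α) B L where open Extremes E
  BR-RT {α} E = ¬ Between toℕ B R × ¬ Between (valueOf α) R T where open Extremes E
  TR-BR {α} E = ¬ Between toℕ T R × ¬ Between (valueOf α) B R where open Extremes E
  LB-LT {α} E = ¬ Between toℕ L B × ¬ Between (valueOf α) L T where open Extremes E
  LT-BL {α} E = ¬ Between toℕ L T × ¬ Between (valueOf α) B L where open Extremes E
  LT-RT {α} E = ¬ Between toℕ L T × ¬ Between (valueOf α) R T where open Extremes E
  LB-BR {α} E = ¬ Between toℕ L B × ¬ Between (valueOf α) B R where open Extremes E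

  -- As `L`, `T` and `T`, `R` are distinct, the empty gaps make their values and positions
  -- consecutive, which is the shape required by `Hooked`.
  claim-TR-LT : Claim TR-LT
  claim-TR-LT α simple E (gapx , gapy) = Hooked.hooked-notDefinable α simple 4≤k L T pos-L val-L pos-T val-T
    where
      open Extremes E
      open Simplicity α simple
      open Corners α simple (≤-trans (n≤1+n 3) 4≤k) E
      1≤k : 1 ≤ k
      1≤k = ≤-trans (s≤s z≤n) 4≤k
      withVal : ∀ v → v < k → ∃ λ i → val i ≡ v
      withVal v lt = α ⟨$⟩ˡ fromℕ< lt , trans (cong toℕ (inverseʳ α)) (toℕ-fromℕ< lt)
      last-of : suc (k ∸ 1) ≡ k
      last-of = m+[n∸m]≡n 1≤k
      pos-L : pos L ≡ 0
      pos-L = n≤0⇒n≡0 (subst (pos L ≤_) (toℕ-fromℕ< 1≤k) (L-min (fromℕ< 1≤k)))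
      val-T : suc (val T) ≡ k
      val-T = ≤-antisym (toℕ<n (α ⟨$⟩ʳ T)) (let i , eq = withVal (k ∸ 1) (≤-reflexive last-of) in
        subst (_≤ suc (val T)) (trans (cong suc eq) last-of) (s≤s (T-max i)))
      pos-R : suc (pos R) ≡ k
      pos-R = ≤-antisym (toℕ<n R) (subst (_≤ suc (pos R)) (trans (cong suc (toℕ-fromℕ< (≤-reflexive last-of))) last-of)
        (s≤s (R-max (fromℕ< (≤-reflexive last-of)))))
      adjacent-pos : suc (pos T) ≡ pos R
      adjacent-pos with m≤n⇒m<n∨m≡n (R-greatest (R≢T ∘ sym))
      ... | inj₂ eq = eq
      ... | inj₁ lt = contradiction (fromℕ< lt′ , subst (pos T <_) (sym (toℕ-fromℕ< lt′)) ≤-refl ,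
                        subst (_< pos R) (sym (toℕ-fromℕ< lt′)) lt) gapx
        where
          lt′ : suc (pos T) < k
          lt′ = <-trans lt (toℕ<n R)
      adjacent-val : suc (val L) ≡ val T
      adjacent-val with m≤n⇒m<n∨m≡n (T-greatest L≢T)
      ... | inj₂ eq = eq
      ... | inj₁ lt = let i , eq = withVal (suc (val L)) (<-trans lt (toℕ<n (α ⟨$⟩ʳ T))) in
            contradiction (i , subst (val L <_) (sym eq) ≤-refl , subst (_< val T) (sym eq) lt) gapy
      pos-T : suc (suc (pos T)) ≡ k
      pos-T = trans (cong suc adjacent-pos) pos-R
      val-L : suc (suc (val L)) ≡ k
      val-L = trans (cong suc adjacent-val) val-T

  claim-BR-BL : Claim BR-BL
  claim-BR-BL = via-complement (λ {α} E (gx , gy) → gx , gy ∘ to (between-complement α _ _)) claim-TR-LT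

  claim-BR-RT : Claim BR-RT
  claim-BR-RT = via-inverse (λ {α} E (gx , gy) → gy ∘ between-inverse-pos α _ _ , gx ∘ between-inverse-val α _ _) claim-TR-LT

  claim-TR-BR : Claim TR-BR
  claim-TR-BR = via-complement (λ {α} E (gx , gy) → gx , gy ∘ to (between-complement α _ _)) claim-BR-RT

  claim-LB-LT : Claim LB-LT
  claim-LB-LT = via-inverse (λ {α} E (gx , gy) → gy ∘ between-inverse-pos α _ _ , gx ∘ between-inverse-val α _ _) claim-BR-BL

  claim-LT-BL : Claim LT-BL
  claim-LT-BL = via-complement (λ {α} E (gx , gy) → gx , gy ∘ to (between-complement α _ _)) claim-LB-LT

  claim-LT-RT : Claim LT-RT
  claim-LT-RT = via-inverse (λ {α} E (gx , gy) → gy ∘ between-inverse-pos α _ _ , gx ∘ between-inverse-val α _ _) claim-TR-BR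

  claim-LB-BR : Claim LB-BR
  claim-LB-BR = via-complement (λ {α} E (gx , gy) → gx , gy ∘ to (between-complement α _ _)) claim-LT-RT

-- Spread of the complement, read in α itself.
record Spread′ {k : ℕ} (α : Perm k) (E : Extremes α) : Set where
  open Extremes E
  field
    B-R : Between toℕ B R
    L-T : Between toℕ L T
    L-T′ : Between (valueOf α) L T
    B-R′ : Between (valueOf α) B R

spread′⇒spread : ∀ {k} {α : Perm k} {E : Extremes α} → Spread′ α E → Spread (complement α) (extremes-complement E)
spread′⇒spread {α = α} S = record
  { T-R = B-R ; L-B = L-T ; B-L = from (between-complement α _ _) L-T′ ; R-T = from (between-complement α _ _) B-R′ }
  where open Spread′ S

complement-spread′⇒spread : ∀ {k} {α : Perm k} {E : Extremes α} → Spread′ (complement α) (extremes-complement E) → Spread α E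
complement-spread′⇒spread {α = α} S = record
  { T-R = B-R ; L-B = L-T ; B-L = to (between-complement α _ _) L-T′ ; R-T = to (between-complement α _ _) B-R′ }
  where open Spread′ S

-- Consequences of a bottleneck.

module SumBad {k : ℕ} (α : Perm k) (simple : Simple α) (E : Extremes α) (p : Fin k) {P : Fin k → Set} (P? : Decidable P)
    (sep : ∀ a b → a ≢ p → b ≢ p → P a → ¬ P b → toℕ a < toℕ b × valueOf α a < valueOf α b)
    (lower : Many (λ a → a ≢ p × P a)) (upper : Many (λ b → b ≢ p × ¬ P b)) where
  open Simplicity α simple
  open Extremes E

  Lower Upper : Fin k → Set
  Lower a = a ≢ p × P a
  Upper b = b ≢ p × ¬ P b

  lower? : Decidable Lower
  lower? a = ¬? (a ≟ᶠ p) ×-dec P? a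

  upper? : Decidable Upper
  upper? b = ¬? (b ≟ᶠ p) ×-dec ¬? (P? b)

  apart : ∀ {a b} → Lower a → Upper b → pos a < pos b × val a < val b
  apart (a≢ , pa) (b≢ , ¬pb) = sep _ _ a≢ b≢ pa ¬pb

  beyond-lower : ∀ {z} → ¬ Lower z → z ≡ p ⊎ Upper z
  beyond-lower {z} ¬lz with z ≟ᶠ p
  ... | yes eq = inj₁ eq
  ... | no ne = inj₂ (ne , λ pz → ¬lz (ne , pz))

  beyond-upper : ∀ {z} → ¬ Upper z → z ≡ p ⊎ Lower z
  beyond-upper {z} ¬uz with z ≟ᶠ p
  ... | yes eq = inj₁ eq
  ... | no ne = inj₂ (ne , decidable-stable (P? z) λ ¬pz → ¬uz (ne , ¬pz))

  -- Both parts have to be split by p, and p can split them only in different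
  -- directions.
  splits : (u v : Fin k → ℕ) →
    (∀ {Q : Fin k → Set} → Decidable Q → Many Q → ∃ (¬_ ∘ Q) →
      (∀ x y z → Q x → Q y → ¬ Q z → u x < u z → ¬ u z < u y) →
      (∀ x y z → Q x → Q y → ¬ Q z → v x < v z → ¬ v z < v y) → ⊥) →
    (∀ {a b} → Lower a → Upper b → u a < u b × v a < v b) →
    ¬ (∀ x y → u x < u p → ¬ u p < u y)
  splits u v interval apart unsplit = interval lower? lower (p , λ l → proj₁ l refl) low-u low-v
    where
      low-u : ∀ x y z → Lower x → Lower y → ¬ Lower z → u x < u z → ¬ u z < u y
      low-u x y z lx ly ¬lz lt gt with beyond-lower ¬lz
      ... | inj₁ refl = unsplit x y lt gt
      ... | inj₂ uz = <-asym gt (proj₁ (apart ly uz))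
      high-u : ∀ x y z → Upper x → Upper y → ¬ Upper z → u x < u z → ¬ u z < u y
      high-u x y z ux uy ¬uz lt gt with beyond-upper ¬uz
      ... | inj₁ refl = unsplit x y lt gt
      ... | inj₂ lz = <-asym lt (proj₁ (apart lz ux))
      low-v : ∀ x y z → Lower x → Lower y → ¬ Lower z → v x < v z → ¬ v z < v y
      low-v x y z lx ly ¬lz lt gt with beyond-lower ¬lz
      ... | inj₂ uz = <-asym gt (proj₂ (apart ly uz))
      -- Being before the lower point `y` in direction `v`, `p` is before all upper points. So the
      -- upper part is split in neither direction.
      ... | inj₁ refl = interval upper? upper (p , λ m → proj₁ m refl) high-u high-v
        where
          high-v : ∀ x′ y′ z′ → Upper x′ → Upper y′ → ¬ Upper z′ → v x′ < v z′ → ¬ v z′ < v y′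
          high-v x′ y′ z′ ux uy ¬uz lt′ gt′ with beyond-upper ¬uz
          ... | inj₁ refl = <-asym (<-trans lt′ gt) (proj₂ (apart ly ux))
          ... | inj₂ lz = <-asym lt′ (proj₂ (apart lz ux))

  -- If `p` were first or last, it could split the two parts only by value, and it cannot split
  -- both. So no extreme point is the bottleneck, and each belongs to the expected part.
  inner-pos : ¬ (∀ x y → pos x < pos p → ¬ pos p < pos y)
  inner-pos = splits pos val (λ Q? → no-interval Q?) apart

  inner-val : ¬ (∀ x y → val x < val p → ¬ val p < val y)
  inner-val = splits val pos (λ Q? many out xc yc → no-interval Q? many out yc xc)
    λ l m → proj₂ (apart l m) , proj₁ (apart l m)

  L-lower : Lower L
  L-lower = decidable-stable (lower? L) λ ¬l → out (beyond-lower ¬l)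
    where
      out : L ≡ p ⊎ Upper L → ⊥
      out (inj₁ refl) = inner-pos λ x _ lt _ → contradiction lt (≤⇒≯ (L-min x))
      out (inj₂ uL) = let a , _ , _ , la , _ = lower in contradiction (proj₁ (apart la uL)) (≤⇒≯ (L-min a))

  B-lower : Lower B
  B-lower = decidable-stable (lower? B) λ ¬l → out (beyond-lower ¬l)
    where
      out : B ≡ p ⊎ Upper B → ⊥
      out (inj₁ refl) = inner-val λ x _ lt _ → contradiction lt (≤⇒≯ (B-min x))
      out (inj₂ uB) = let a , _ , _ , la , _ = lower in contradiction (proj₂ (apart la uB)) (≤⇒≯ (B-min a))

  R-upper : Upper R
  R-upper = decidable-stable (upper? R) λ ¬u → out (beyond-upper ¬u)
    where
      out : R ≡ p ⊎ Lower R → ⊥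
      out (inj₁ refl) = inner-pos λ _ y _ gt → contradiction gt (≤⇒≯ (R-max y))
      out (inj₂ lR) = let b , _ , _ , ub , _ = upper in contradiction (proj₁ (apart lR ub)) (≤⇒≯ (R-max b))

  T-upper : Upper T
  T-upper = decidable-stable (upper? T) λ ¬u → out (beyond-upper ¬u)
    where
      out : T ≡ p ⊎ Lower T → ⊥
      out (inj₁ refl) = inner-val λ _ y _ gt → contradiction gt (≤⇒≯ (T-max y))
      out (inj₂ lT) = let b , _ , _ , ub , _ = upper in contradiction (proj₂ (apart lT ub)) (≤⇒≯ (T-max b))

  -- Complementing reverses this inequality, so `α` and its complement do not both have a
  -- bottleneck.
  L-below-R : val L < val R
  L-below-R = proj₂ (apart L-lower R-upper)

  another : ∀ {Q : Fin k → Set} → Many Q → ∀ c → ∃ λ a → a ≢ c × Q a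
  another (a , b , a≢b , qa , qb) c with a ≟ᶠ c
  ... | no a≢c = a , a≢c , qa
  ... | yes refl = b , a≢b ∘ sym , qb

  -- Either part has a second point besides the extreme one that bounds the gap, and this point lies
  -- in the gap.
  spread′ : Spread′ α E
  spread′ = record
    { B-R = let e , e≢R , ue = another upper R in e , proj₁ (apart B-lower ue) , ≤∧≢⇒< (R-max e) (e≢R ∘ toℕ-injective)
    ; L-T = let e , e≢L , le = another lower L in e , ≤∧≢⇒< (L-min e) (e≢L ∘ sym ∘ toℕ-injective) , proj₁ (apart le T-upper)
    ; L-T′ = let e , e≢T , ue = another upper T in e , proj₂ (apart L-lower ue) , ≤∧≢⇒< (T-max e) (e≢T ∘ val-injective)
    ; B-R′ = let e , e≢B , le = another lower B in e , ≤∧≢⇒< (B-min e) (e≢B ∘ sym ∘ val-injective) , proj₂ (apart le R-upper)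
    }

-- Distinction of cases by empty gaps.

theorem2 : ∀ (k : ℕ) (α : Perm k) → 4 ≤ k → Simple α → ¬ FODefinable (Av α ⊙ Av α)
theorem2 k α 4≤k simple fd = analyse (between? toℕ T R) (between? toℕ L B) (between? val B L) (between? val R T)
  where
    3≤k : 3 ≤ k
    3≤k = ≤-trans (n≤1+n 3) 4≤k
    E : Extremes α
    E = extremes α (≤-trans (s≤s z≤n) 4≤k)
    Eᶜ = extremes-complement E
    simpleᶜ = simple-complement α simple
    open Extremes E
    open Simplicity α simple
    open Corners α simple 3≤k E
    -- If `α` has a bottleneck, its complement has none and is spread, so the staircase for the
    -- complement settles the claim.
    good : SumGood α
    good p P? sep lower upper = undefinable-complement α
      (Staircase.staircase-notDefinable (complement α) simpleᶜ 4≤k Eᶜ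
        (λ p′ P?′ sep′ lower′ upper′ → <-asym (SumBad.L-below-R α simple E p P? sep lower upper)
          (to (opposite-< (α ⟨$⟩ʳ L) (α ⟨$⟩ʳ R)) (SumBad.L-below-R (complement α) simpleᶜ Eᶜ p′ P?′ sep′ lower′ upper′)))
        (spread′⇒spread (SumBad.spread′ α simple E p P? sep lower upper))) fd
    -- A bottleneck of the complement makes `α` spread, and `α` is already known to have none.
    goodᶜ : SumGood (complement α)
    goodᶜ p P? sep lower upper = Staircase.staircase-notDefinable α simple 4≤k E good
      (complement-spread′⇒spread (SumBad.spread′ (complement α) simpleᶜ Eᶜ p P? sep lower upper)) fd
    staircase : Spread α E → ⊥
    staircase S = Staircase.staircase-notDefinable α simple 4≤k E good S fd
    tight : ¬ Spread′ α E
    tight S = undefinable-complement α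
      (Staircase.staircase-notDefinable (complement α) simpleᶜ 4≤k Eᶜ goodᶜ (spread′⇒spread S)) fd
    T≢B : T ≢ B
    T≢B eq = let b , b≢ , _ = third 3≤k T T in
      <-asym (T-greatest b≢) (subst (λ x → val x < val b) (sym eq) (B-least (λ e → b≢ (trans e (sym eq)))))
    L≢R : L ≢ R
    L≢R eq = let b , b≢ , _ = third 3≤k L L in
      <-asym (L-least b≢) (subst (λ x → pos b < pos x) (sym eq) (R-greatest (λ e → b≢ (trans e (sym eq)))))

    -- By `tight` the complement lacks one of its gaps; the four arguments refute the four
    -- possibilities.
    unspread : (¬ Between toℕ B R → ⊥) → (¬ Between toℕ L T → ⊥) → (¬ Between val L T → ⊥) → (¬ Between val B R → ⊥) → ⊥
    unspread f g h i = tight record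
      { B-R = decidable-stable (between? toℕ B R) f ; L-T = decidable-stable (between? toℕ L T) g
      ; L-T′ = decidable-stable (between? val L T) h ; B-R′ = decidable-stable (between? val B R) i }

    analyse : Dec (Between toℕ T R) → Dec (Between toℕ L B) → Dec (Between val B L) → Dec (Between val R T) → ⊥
    analyse (yes a) (yes b) (yes c) (yes d) = staircase record { T-R = a ; L-B = b ; B-L = c ; R-T = d }
    -- Two empty gaps in different directions are a hooked case up to symmetry. Two in the same
    -- direction would make two extreme points equal or leave room for three points only.
    analyse (no TR) _ _ _ = unspread
      (λ BR → T≢B (same-predecessor pos toℕ-injective (R-greatest (R≢T ∘ sym)) (R-greatest (R≢B ∘ sym)) TR BR))
      (λ LT → no-three pos toℕ-injective 4≤k L-min R-max LT TR)
      (λ LT → claim-TR-LT 4≤k α simple E (TR , LT) fd)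
      (λ BR → claim-TR-BR 4≤k α simple E (TR , BR) fd)
    analyse _ (no LB) _ _ = unspread
      (λ BR → no-three pos toℕ-injective 4≤k L-min R-max LB BR)
      (λ LT → T≢B (same-successor pos toℕ-injective (L-least (L≢T ∘ sym)) (L-least (L≢B ∘ sym)) LT LB))
      (λ LT → claim-LB-LT 4≤k α simple E (LB , LT) fd)
      (λ BR → claim-LB-BR 4≤k α simple E (LB , BR) fd)
    analyse _ _ (no BL) _ = unspread
      (λ BR → claim-BR-BL 4≤k α simple E (BR , BL) fd)
      (λ LT → claim-LT-BL 4≤k α simple E (LT , BL) fd)
      (λ LT → no-three val val-injective 4≤k B-min T-max BL LT)
      (λ BR → L≢R (same-successor val val-injective (B-least L≢B) (B-least R≢B) BL BR))
    analyse _ _ _ (no RT) = unspread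
      (λ BR → claim-BR-RT 4≤k α simple E (BR , RT) fd)
      (λ LT → claim-LT-RT 4≤k α simple E (LT , RT) fd)
      (λ LT → L≢R (same-predecessor val val-injective (T-greatest L≢T) (T-greatest R≢T) LT RT))
      (λ BR → no-three val val-injective 4≤k B-min T-max BR RT)
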